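{- Let $q$ be a prime power, let $n>1$ be an integer that is not a prime power, let $\delta(n)$ be the number of positive divisors of $n$, and let $1<k<\delta(n)$. Let $(d_1,\ldots,d_k)$ be a tuple of divisors of $n$ with $d_1<\cdots<d_k<n$ such that $d_i\nmid d_j$ whenever $i\ne j$. Let $(a_1,\ldots,a_k)$ with $a_i\in\mathbb{F}_{q^{d_i}}^*$ satisfy $N_{d_i/\gcd(d_i,d_j)}(a_i)=N_{d_j/\gcd(d_i,d_j)}(a_j)$ for all $1\le i<j\le k$. If $$\gcd\left(\frac{q^n-1}{q^{d_1}-1},\ldots,\frac{q^n-1}{q^{d_k}-1}\right)\ge W_q(x^n-1)\,q^{n/2},$$ then there exists $\alpha\in\mathbb{F}_{q^n}^*$ normal over $\mathbb{F}_q$ with $N_{n/d_i}(\alpha)=a_i$ for every $1\le i\le k$.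
   Context: For a divisor $d$ of $m$ and $\alpha\in\mathbb{F}_{q^m}^*$, $N_{m/d}(\alpha)=\alpha^{(q^m-1)/(q^d-1)}$ denotes the norm of $\alpha$ from $\mathbb{F}_{q^m}$ to $\mathbb{F}_{q^d}$. An element $\beta\in\mathbb{F}_{q^n}$ is normal over $\mathbb{F}_q$ if $\{\beta,\beta^q,\ldots,\beta^{q^{n-1}}\}$ is an $\mathbb{F}_q$-basis of $\mathbb{F}_{q^n}$. For $f\in\mathbb{F}_q[x]$, $W_q(f)$ denotes the number of monic squarefree divisors of $f$ in $\mathbb{F}_q[x]$. -}

module Defs where

open import Level using (0ℓ)
open import Data.Nat using (ℕ; zero; suc; _∸_; _^_; _≤_; _<_)
open import Data.Nat.DivMod using (_/_)
open import Data.Nat.Divisibility using (_∣_; _∣?_)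
open import Data.Nat.Primality using (Prime)
open import Data.Nat.GCD using (gcd)
open import Data.Fin using (Fin; toℕ)
open import Data.Vec using (Vec; toList)
open import Data.List using (List; []; _∷_; length; filter; applyUpTo; foldr; map; allFin; _++_)
open import Data.List.Relation.Unary.All using (All)
open import Data.List.Relation.Unary.Any using (Any)
open import Data.List.Relation.Unary.AllPairs using (AllPairs)
open import Data.Product using (Σ; ∃; _×_; _,_)
open import Relation.Nullary using (¬_; yes; no)
import Data.Nat
open import Relation.Binary using (Decidable)
open import Relation.Binary.PropositionalEquality using (_≡_)
open import Algebra.Bundles using (CommutativeRing)

IsPrimePower : ℕ → Set
IsPrimePower m = Σ ℕ λ p → Σ ℕ λ e → Prime p × 1 ≤ e × m ≡ p ^ e

δ : ℕ → ℕ
δ n = length (filter (λ m → m ∣? n) (applyUpTo suc n))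

-- natural-number division, only ever used with nonzero divisors
_÷_ : ℕ → ℕ → ℕ
a ÷ zero = 0
a ÷ suc b = a / suc b

gcdFam : (k : ℕ) → (Fin k → ℕ) → ℕ
gcdFam k f = foldr gcd 0 (map f (allFin k))

record FiniteField (N : ℕ) : Set₁ where
  field
    ring   : CommutativeRing 0ℓ 0ℓ
  open CommutativeRing ring public hiding (ring)
  field
    _≟_    : Decidable _≈_
    1≉0    : ¬ (1# ≈ 0#)
    inv    : ∀ x → ¬ (x ≈ 0#) → Σ Carrier λ y → x * y ≈ 1#
    enum   : Fin N → Carrier
    enum-injective  : ∀ i j → enum i ≈ enum j → i ≡ j
    enum-surjective : ∀ x → Σ (Fin N) λ i → enum i ≈ x

module Notions (q n : ℕ) (F : FiniteField (q ^ n)) where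
  open FiniteField F hiding (Carrier; _≈_; 0#)
  open FiniteField F public using (Carrier; _≈_; 0#)

  pow : Carrier → ℕ → Carrier
  pow x zero    = 1#
  pow x (suc m) = x * pow x m

  -- x ∈ 𝔽_{q^d}, the subfield {x | x^{q^d} = x}
  InSub : ℕ → Carrier → Set
  InSub d x = pow x (q ^ d) ≈ x

  -- N_{m/d}(α) = α^{(q^m-1)/(q^d-1)}  (norm from 𝔽_{q^m} to 𝔽_{q^d})
  Norm : (m d : ℕ) → Carrier → Carrier
  Norm m d α = pow α ((q ^ m ∸ 1) ÷ (q ^ d ∸ 1))

  Σᶠ : (m : ℕ) → (Fin m → Carrier) → Carrier
  Σᶠ m f = foldr _+_ 0# (map f (allFin m))

  IsNormal : Carrier → Set
  IsNormal β =
    (∀ (c : Fin n → Carrier) → (∀ i → InSub 1 (c i)) →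
       Σᶠ n (λ i → c i * pow β (q ^ toℕ i)) ≈ 0# → ∀ i → c i ≈ 0#)
    × (∀ x → Σ (Fin n → Carrier) λ c → (∀ i → InSub 1 (c i)) ×
         Σᶠ n (λ i → c i * pow β (q ^ toℕ i)) ≈ x)

  -- Polynomials with coefficients in F (lists, lowest degree first)

  Poly : Set
  Poly = List Carrier

  coeff : Poly → ℕ → Carrier
  coeff []       _       = 0#
  coeff (a ∷ p)  zero    = a
  coeff (a ∷ p)  (suc i) = coeff p i

  -- equality of polynomials (up to trailing zeros)
  _≈ₚ_ : Poly → Poly → Set
  p ≈ₚ r = ∀ i → coeff p i ≈ coeff r i

  _+ₚ_ : Poly → Poly → Poly
  []      +ₚ r       = r
  (a ∷ p) +ₚ []      = a ∷ p
  (a ∷ p) +ₚ (b ∷ r) = (a + b) ∷ (p +ₚ r)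

  scaleₚ : Carrier → Poly → Poly
  scaleₚ a = map (a *_)

  _*ₚ_ : Poly → Poly → Poly
  []      *ₚ r = []
  (a ∷ p) *ₚ r = scaleₚ a r +ₚ (0# ∷ (p *ₚ r))

  OverFq : Poly → Set
  OverFq p = All (InSub 1) p

  _∣ₚ_ : Poly → Poly → Set
  g ∣ₚ f = Σ Poly λ h → OverFq h × (g *ₚ h) ≈ₚ f

  NonConstant : Poly → Set
  NonConstant p = Σ ℕ λ i → 1 ≤ i × ¬ (coeff p i ≈ 0#)

  Squarefree : Poly → Set
  Squarefree g = ∀ r → OverFq r → NonConstant r → ¬ ((r *ₚ r) ∣ₚ g)

  -- monic polynomials: degree d and the d lower coefficients
  Monic : Set
  Monic = Σ ℕ λ d → Vec Carrier d

  toPoly : Monic → Poly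
  toPoly (d , v) = toList v ++ (1# ∷ [])

  _≈ₘ_ : Monic → Monic → Set
  g ≈ₘ h = toPoly g ≈ₚ toPoly h

  xⁿ-1 : Poly
  xⁿ-1 = (- 1#) ∷ applyUpTo (λ i → if-last i) n
    where
      if-last : ℕ → Carrier
      if-last i with suc i Data.Nat.≟ n
      ... | yes _ = 1#
      ... | no _  = 0#

  MonicSqfreeDivisor : Monic → Set
  MonicSqfreeDivisor g =
    OverFq (toPoly g) × (toPoly g ∣ₚ xⁿ-1) × Squarefree (toPoly g)

  -- L lists every monic squarefree divisor of x^n-1 in 𝔽_q[x] exactly once,
  -- so that length L = W_q(x^n-1)
  EnumeratesW : List Monic → Set
  EnumeratesW L =
    All MonicSqfreeDivisor L
    × (∀ g → MonicSqfreeDivisor g → Any (g ≈ₘ_) L)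
    × AllPairs (λ g h → ¬ (g ≈ₘ h)) L

{-# OPTIONS --safe #-}

-- Let Q = qⁿ and D = gcd((Q-1)/(q^dᵢ-1)).  The compatibility of the aᵢ and Bézout produce one
-- element with the prescribed norms, and the whole solution set is then a coset C = αH of the
-- group H of D-th roots of unity, which has exactly D elements.
--
-- An element x fails to be normal exactly when s(σ)x = 0 for some s = (xⁿ-1)/r, where r is an
-- irreducible factor of xⁿ-1 and σ is the Frobenius.  With τ = σ⁻¹ and the trace form, the
-- indicator of ker s(σ) is the Fourier transform of the uniform weight on the subspace
-- U_r = s(τ)F, so P(x) = ∏_r Q·[s(σ)x ≠ 0] is the transform of a convolution of weights on the
-- independent subspaces U_r: the coefficient at 0 is some f > 0, and the other coefficients have
-- absolute values summing to (2^ω - 1)f, where ω is the number of factors r.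
--
-- If P vanished on C, then R = P - f would equal -f there, and
-- ∑_β (∑_{h ∈ H} R(βh))² would be at least D·(fD)²; expanding the square by orthogonality it is
-- at most Q·D·((2^ω - 1)f)².  Hence D² ≤ Q(2^ω - 1)², which contradicts D² ≥ W²Q, because the
-- 2^ω products of distinct irreducible factors are squarefree divisors and so 2^ω ≤ W.
-- A complex character is avoided by E(x) = [Tr x = 0] - [Tr x = 1].

module Submission where

open import Level using (0ℓ)
open import Algebra.Bundles using (CommutativeRing; CommutativeMonoid)
import Algebra.Properties.CommutativeMonoid.Sum as MonoidSum
import Algebra.Properties.Semiring.Sum as SemiringSum
open import Data.Empty using (⊥-elim)
open import Data.Fin as Fin using (Fin; zero; suc; toℕ; fromℕ; punchOut; funToFin; finToFun)
open import Data.Fin.Permutation using (permutation)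
import Data.Fin.Properties as Fin
open import Data.Integer as ℤ using (ℤ; +_; 0ℤ; 1ℤ; -1ℤ)
import Data.Integer.Properties as ℤ
import Data.Integer.Tactic.RingSolver as ℤ
open import Data.List using (List; []; _∷_; map; foldr; length; _++_; replicate; tabulate; lookup; applyUpTo; allFin)
open import Data.List.Membership.Propositional.Properties using (∈-lookup; ∈-allFin)
open import Data.List.Properties using (length-map; length-++; map-tabulate; map-++)
open import Data.List.Relation.Unary.All as All using (All; []; _∷_)
import Data.List.Relation.Unary.All.Properties as All
open import Data.List.Relation.Unary.AllPairs as AllPairs using (AllPairs; []; _∷_)
import Data.List.Relation.Unary.AllPairs.Properties as AllPairs
open import Data.List.Relation.Unary.Any as Any using (Any; here; there)
open import Data.List.Relation.Unary.Any.Properties using (lookup-index)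
open import Data.Nat as ℕ using (ℕ; zero; suc; _≤_; _<_; z≤n; s≤s; _!; _∸_; NonZero)
open import Data.Nat.Combinatorics as ℕ using (nCn≡1; nCk≡n!/k![n-k]!; k![n∸k]!∣n!)
open import Data.Nat.Coprimality using (Coprime; coprime-Bézout; coprime-divisor)
import Data.Nat.Divisibility as ℕ
import Data.Nat.DivMod as ℕ
open import Data.Nat.GCD using (gcd; gcd[m,n]∣m; gcd[m,n]∣n; gcd-identityʳ; gcd-greatest; gcd[m,n]≢0; gcd-GCD; module Bézout)
open import Data.Nat.Primality using (Prime; euclidsLemma; prime⇒nonTrivial; ¬prime[1])
import Data.Nat.Properties as ℕ
import Data.Nat.Tactic.RingSolver as ℕ
open import Data.Product using (Σ; _×_; _,_; proj₁; proj₂)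
open import Data.Sum using (_⊎_; inj₁; inj₂; [_,_]′)
open import Data.Vec as Vec using (Vec; []; _∷_)
open import Data.Vec.Functional using (init)
open import Data.Vec.Properties using (toList-map)
open import Function using (_∘_; id)
open import Relation.Binary using (Decidable; IsEquivalence; tri<; tri≈; tri>)
open import Relation.Binary.PropositionalEquality as ≡ using (_≡_; _≢_)
open import Relation.Nullary using (¬_; ¬?; Dec; yes; no; _→-dec_; _×-dec_)
open import Algebra.Properties.AbelianGroup ℤ.+-0-abelianGroup using (∙-cancelˡ)
open import Defs

-- Averaging over the cosets `βH` and taking a second moment takes the place of multiplicative
-- characters and Gauss sums. The saving comes from one observation: for a nonzero frequency v the
-- relation uh + vh′ = 0 leaves at most one h′ for each h, so a pair (u, v) costs Q·D. The pair (0,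
-- 0) would cost Q·D², which is why the constant f is subtracted from P before squaring. The other
-- obstacle is constructive. Irreducibility of a polynomial is never tested, and xⁿ-1 is factored
-- only under a double negation. This suffices because the goal is decidable: linear independence of
-- the conjugates is a check over the qⁿ coefficient vectors, and the element itself is searched for
-- in a finite set. Normality is therefore carried through the proof as this finite check and turned
-- into the basis property at the very end. xⁿ-1 may have repeated factors. The sieve uses one
-- representative r of each irreducible factor, while s = (xⁿ-1)/r keeps the remaining multiplicity.

-- The polynomial ring over a commutative ring.

module Polynomials (K : CommutativeRing 0ℓ 0ℓ) where

  open CommutativeRing K hiding (zero)
  open import Algebra.Solver.Ring.NaturalCoefficients.Default commutativeSemiring
    using (solve; _:=_; _:+_)
  open import Algebra.Properties.Ring (CommutativeRing.ring K)
    using (-0#≈0#)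

  Poly : Set
  Poly = List Carrier

  coeff : Poly → ℕ → Carrier
  coeff []      _       = 0#
  coeff (a ∷ p) zero    = a
  coeff (a ∷ p) (suc i) = coeff p i

  -- A record, so that the two polynomials can be inferred from a proof.
  record _≋_ (p r : Poly) : Set where
    constructor mk
    field at : ∀ i → coeff p i ≈ coeff r i
  open _≋_ public

  infix 4 _≋_
  infixl 6 _⊕_
  infixl 7 _⊛_ _·_

  _⊕_ : Poly → Poly → Poly
  []      ⊕ r       = r
  (a ∷ p) ⊕ []      = a ∷ p
  (a ∷ p) ⊕ (b ∷ r) = (a + b) ∷ (p ⊕ r)

  _·_ : Carrier → Poly → Poly
  a · p = map (a *_) p

  _⊛_ : Poly → Poly → Poly
  []      ⊛ r = []
  (a ∷ p) ⊛ r = (a · r) ⊕ (0# ∷ (p ⊛ r))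

  ⊖_ : Poly → Poly
  ⊖_ = map (-_)

  𝟙 : Poly
  𝟙 = 1# ∷ []

  ≋-isEquivalence : IsEquivalence _≋_
  ≋-isEquivalence = record
    { refl = mk λ _ → refl ; sym = λ e → mk λ i → sym (at e i)
    ; trans = λ e f → mk λ i → trans (at e i) (at f i) }

  module ≋ = IsEquivalence ≋-isEquivalence

  coeff-⊕ : ∀ p r i → coeff (p ⊕ r) i ≈ coeff p i + coeff r i
  coeff-⊕ []      r       i       = sym (+-identityˡ _)
  coeff-⊕ (a ∷ p) []      i       = sym (+-identityʳ _)
  coeff-⊕ (a ∷ p) (b ∷ r) zero    = refl
  coeff-⊕ (a ∷ p) (b ∷ r) (suc i) = coeff-⊕ p r i

  coeff-· : ∀ a p i → coeff (a · p) i ≈ a * coeff p i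
  coeff-· a []      i       = sym (zeroʳ a)
  coeff-· a (b ∷ p) zero    = refl
  coeff-· a (b ∷ p) (suc i) = coeff-· a p i

  coeff-⊖ : ∀ p i → coeff (⊖ p) i ≈ - coeff p i
  coeff-⊖ []      i       = sym -0#≈0#
  coeff-⊖ (b ∷ p) zero    = refl
  coeff-⊖ (b ∷ p) (suc i) = coeff-⊖ p i

  ⊕-cong : ∀ {p p′ r r′} → p ≋ p′ → r ≋ r′ → p ⊕ r ≋ p′ ⊕ r′
  ⊕-cong {p} {p′} {r} {r′} e f = mk λ i →
    trans (coeff-⊕ p r i) (trans (+-cong (at e i) (at f i)) (sym (coeff-⊕ p′ r′ i)))

  ·-cong : ∀ {a b p r} → a ≈ b → p ≋ r → a · p ≋ b · r
  ·-cong {a} {b} {p} {r} e f = mk λ i →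
    trans (coeff-· a p i) (trans (*-cong e (at f i)) (sym (coeff-· b r i)))

  ⊖-cong : ∀ {p r} → p ≋ r → ⊖ p ≋ ⊖ r
  ⊖-cong {p} {r} f = mk λ i →
    trans (coeff-⊖ p i) (trans (-‿cong (at f i)) (sym (coeff-⊖ r i)))

  ∷-cong : ∀ {a b p r} → a ≈ b → p ≋ r → (a ∷ p) ≋ (b ∷ r)
  ∷-cong e f = mk λ { zero → e ; (suc i) → at f i }

  ∷-cong⁻ : ∀ {a b p r} → (a ∷ p) ≋ (b ∷ r) → p ≋ r
  ∷-cong⁻ e = mk λ i → at e (suc i)

  ∷≋[]⁻ : ∀ {a p} → (a ∷ p) ≋ [] → p ≋ []
  ∷≋[]⁻ e = mk λ i → at e (suc i)

  ∷≋[] : ∀ {a p} → a ≈ 0# → p ≋ [] → (a ∷ p) ≋ []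
  ∷≋[] e f = mk λ { zero → e ; (suc i) → at f i }

  ⊕-assoc : ∀ p r s → (p ⊕ r) ⊕ s ≋ p ⊕ (r ⊕ s)
  ⊕-assoc p r s = mk λ i →
    trans (coeff-⊕ (p ⊕ r) s i) (trans (+-congʳ (coeff-⊕ p r i)) (trans (+-assoc _ _ _)
    (sym (trans (coeff-⊕ p (r ⊕ s) i) (+-congˡ (coeff-⊕ r s i))))))

  ⊕-comm : ∀ p r → p ⊕ r ≋ r ⊕ p
  ⊕-comm p r = mk λ i →
    trans (coeff-⊕ p r i) (trans (+-comm _ _) (sym (coeff-⊕ r p i)))

  ⊕-identityʳ : ∀ p → p ⊕ [] ≋ p
  ⊕-identityʳ p = ⊕-comm p []

  ⊖-inverseʳ : ∀ p → p ⊕ (⊖ p) ≋ []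
  ⊖-inverseʳ p = mk λ i →
    trans (coeff-⊕ p (⊖ p) i) (trans (+-congˡ (coeff-⊖ p i)) (-‿inverseʳ _))

  ⊖-inverseˡ : ∀ p → (⊖ p) ⊕ p ≋ []
  ⊖-inverseˡ p = ≋.trans (⊕-comm (⊖ p) p) (⊖-inverseʳ p)

  ⊕-interchange : ∀ p r s t → (p ⊕ r) ⊕ (s ⊕ t) ≋ (p ⊕ s) ⊕ (r ⊕ t)
  ⊕-interchange p r s t = mk λ i →
    trans (coeff-⊕ (p ⊕ r) (s ⊕ t) i) (trans (+-cong (coeff-⊕ p r i) (coeff-⊕ s t i))
    (trans (solve 4 (λ p r s t → (p :+ r) :+ (s :+ t) := (p :+ s) :+ (r :+ t)) refl _ _ _ _)
    (sym (trans (coeff-⊕ (p ⊕ s) (r ⊕ t) i) (+-cong (coeff-⊕ p s i) (coeff-⊕ r t i))))))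

  ·-distribˡ : ∀ a p r → a · (p ⊕ r) ≋ (a · p) ⊕ (a · r)
  ·-distribˡ a p r = mk λ i →
    trans (coeff-· a (p ⊕ r) i) (trans (*-congˡ (coeff-⊕ p r i)) (trans (distribˡ _ _ _)
    (sym (trans (coeff-⊕ (a · p) (a · r) i) (+-cong (coeff-· a p i) (coeff-· a r i))))))

  ·-distribʳ : ∀ a b r → (a + b) · r ≋ (a · r) ⊕ (b · r)
  ·-distribʳ a b r = mk λ i →
    trans (coeff-· (a + b) r i) (trans (distribʳ _ _ _)
    (sym (trans (coeff-⊕ (a · r) (b · r) i) (+-cong (coeff-· a r i) (coeff-· b r i)))))

  ·-assoc : ∀ a b r → (a * b) · r ≋ a · (b · r)
  ·-assoc a b r = mk λ i →
    trans (coeff-· (a * b) r i) (trans (*-assoc _ _ _)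
    (sym (trans (coeff-· a (b · r) i) (*-congˡ (coeff-· b r i)))))

  0·-zero : ∀ p → 0# · p ≋ []
  0·-zero p = mk λ i → trans (coeff-· 0# p i) (zeroˡ _)

  1·-identity : ∀ p → 1# · p ≋ p
  1·-identity p = mk λ i → trans (coeff-· 1# p i) (*-identityˡ _)

  ⊛-zeroʳ : ∀ p → p ⊛ [] ≋ []
  ⊛-zeroʳ []      = ≋.refl
  ⊛-zeroʳ (a ∷ p) = ∷≋[] refl (⊛-zeroʳ p)

  -- `_⊛_` recurses on the list, but a nonempty list of zeros is also the zero polynomial. This
  -- bridges representations of different lengths in `⊛-congʳ`.
  ⊛-zeroˡ′ : ∀ {p} → p ≋ [] → ∀ r → p ⊛ r ≋ []
  ⊛-zeroˡ′ {[]}    e r = ≋.refl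
  ⊛-zeroˡ′ {a ∷ p} e r = ≋.trans
    (⊕-cong (≋.trans (·-cong (at e 0) ≋.refl) (0·-zero r))
            (∷≋[] refl (⊛-zeroˡ′ (∷≋[]⁻ e) r))) ≋.refl

  ⊛-congˡ : ∀ p {r r′} → r ≋ r′ → p ⊛ r ≋ p ⊛ r′
  ⊛-congˡ []      e = ≋.refl
  ⊛-congˡ (a ∷ p) e = ⊕-cong (·-cong refl e) (∷-cong refl (⊛-congˡ p e))

  ⊛-congʳ : ∀ {p p′} r → p ≋ p′ → p ⊛ r ≋ p′ ⊛ r
  ⊛-congʳ {[]}    {p′}     r e = ≋.sym (⊛-zeroˡ′ (≋.sym e) r)
  ⊛-congʳ {a ∷ p} {[]}     r e = ⊛-zeroˡ′ e r
  ⊛-congʳ {a ∷ p} {b ∷ p′} r e =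
    ⊕-cong (·-cong (at e 0) ≋.refl) (∷-cong refl (⊛-congʳ r (∷-cong⁻ e)))

  ⊛-cong : ∀ {p p′ r r′} → p ≋ p′ → r ≋ r′ → p ⊛ r ≋ p′ ⊛ r′
  ⊛-cong {p} {p′} {r} {r′} e f = ≋.trans (⊛-congʳ r e) (⊛-congˡ p′ f)

  x⊛ : ∀ p r → (0# ∷ p) ⊛ r ≋ 0# ∷ (p ⊛ r)
  x⊛ p r = ⊕-cong (0·-zero r) ≋.refl

  ⊛-distribʳ : ∀ r p p′ → (p ⊕ p′) ⊛ r ≋ (p ⊛ r) ⊕ (p′ ⊛ r)
  ⊛-distribʳ r []      p′       = ≋.refl
  ⊛-distribʳ r (a ∷ p) []       = ≋.sym (⊕-identityʳ _)
  ⊛-distribʳ r (a ∷ p) (b ∷ p′) = ≋.trans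
    (⊕-cong (·-distribʳ a b r)
      (≋.trans (∷-cong (sym (+-identityʳ 0#)) (⊛-distribʳ r p p′)) ≋.refl))
    (⊕-interchange (a · r) (b · r) (0# ∷ (p ⊛ r)) (0# ∷ (p′ ⊛ r)))

  ·-⊛ : ∀ a p r → (a · p) ⊛ r ≋ a · (p ⊛ r)
  ·-⊛ a []      r = ≋.refl
  ·-⊛ a (b ∷ p) r = ≋.trans
    (⊕-cong (·-assoc a b r) (∷-cong (sym (zeroʳ a)) (·-⊛ a p r)))
    (≋.sym (·-distribˡ a (b · r) (0# ∷ (p ⊛ r))))

  ⊛-assoc : ∀ p r s → (p ⊛ r) ⊛ s ≋ p ⊛ (r ⊛ s)
  ⊛-assoc []      r s = ≋.refl
  ⊛-assoc (a ∷ p) r s = ≋.trans (⊛-distribʳ s (a · r) (0# ∷ (p ⊛ r)))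
    (⊕-cong (·-⊛ a r s) (≋.trans (x⊛ (p ⊛ r) s) (∷-cong refl (⊛-assoc p r s))))

  -- The defining recursion transported to the second argument, which is what the induction for
  -- commutativity needs.
  ⊛-∷ : ∀ p b r → p ⊛ (b ∷ r) ≋ (b · p) ⊕ (0# ∷ (p ⊛ r))
  ⊛-∷ []      b r = ≋.sym (∷≋[] refl ≋.refl)
  ⊛-∷ (a ∷ p) b r = ∷-cong (+-congʳ (*-comm a b))
    (≋.trans (⊕-cong (≋.refl {a · r}) (⊛-∷ p b r))
    (≋.trans (≋.sym (⊕-assoc (a · r) (b · p) (0# ∷ (p ⊛ r))))
    (≋.trans (⊕-cong (⊕-comm (a · r) (b · p)) ≋.refl) (⊕-assoc (b · p) (a · r) (0# ∷ (p ⊛ r))))))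

  ⊛-comm : ∀ p r → p ⊛ r ≋ r ⊛ p
  ⊛-comm []      r = ≋.sym (⊛-zeroʳ r)
  ⊛-comm (a ∷ p) r = ≋.trans
    (⊕-cong ≋.refl (∷-cong refl (⊛-comm p r))) (≋.sym (⊛-∷ r a p))

  ⊛-identityˡ : ∀ p → 𝟙 ⊛ p ≋ p
  ⊛-identityˡ p = ≋.trans (⊕-cong (1·-identity p) (∷≋[] refl ≋.refl)) (⊕-identityʳ p)

  ⊛-identityʳ : ∀ p → p ⊛ 𝟙 ≋ p
  ⊛-identityʳ p = ≋.trans (⊛-comm p 𝟙) (⊛-identityˡ p)

  polyRing : CommutativeRing 0ℓ 0ℓ
  polyRing = record
    { Carrier = Poly ; _≈_ = _≋_ ; _+_ = _⊕_ ; _*_ = _⊛_ ; -_ = ⊖_ ; 0# = [] ; 1# = 𝟙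
    ; isCommutativeRing = record
      { isRing = record
        { +-isAbelianGroup = record
          { isGroup = record
            { isMonoid = record
              { isSemigroup = record
                { isMagma = record { isEquivalence = ≋-isEquivalence ; ∙-cong = ⊕-cong }
                ; assoc = ⊕-assoc }
              ; identity = (λ _ → ≋.refl) , ⊕-identityʳ }
            ; inverse = ⊖-inverseˡ , ⊖-inverseʳ
            ; ⁻¹-cong = ⊖-cong }
          ; comm = ⊕-comm }
        ; *-cong = ⊛-cong
        ; *-assoc = ⊛-assoc
        ; *-identity = ⊛-identityˡ , ⊛-identityʳ
        ; distrib = (λ p r s → ≋.trans (⊛-comm p (r ⊕ s)) (≋.trans (⊛-distribʳ p r s)
                       (⊕-cong (⊛-comm r p) (⊛-comm s p)))) , ⊛-distribʳ }
      ; *-comm = ⊛-comm } }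

-- Divisibility and Bézout coprimality in a commutative ring.

module Comaximality (R : CommutativeRing 0ℓ 0ℓ) where

  open CommutativeRing R
  open import Algebra.Solver.Ring.NaturalCoefficients.Default commutativeSemiring
    using (solve; _:=_; _:+_; _:*_)

  infix 4 _∣_

  record _∣_ (a b : Carrier) : Set where
    constructor _,_
    field
      quotient : Carrier
      equality : a * quotient ≈ b

  -- Coprimality as a Bézout identity: it passes to products and divisors by pure algebra, before
  -- any gcd or factorisation is available.
  record Comax (a b : Carrier) : Set where
    constructor ⟨_⟩
    field bezout : Σ Carrier λ x → Σ Carrier λ y → x * a + y * b ≈ 1#

  ∣-resp : ∀ {a b c} → b ≈ c → a ∣ b → a ∣ c
  ∣-resp e (x , f) = x , trans f e

  ∣-trans : ∀ {a b c} → a ∣ b → b ∣ c → a ∣ c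
  ∣-trans (x , e) (y , f) = x * y , trans (sym (*-assoc _ _ _)) (trans (*-congʳ e) f)

  ∣-*ʳ : ∀ {a b} c → a ∣ b → a ∣ b * c
  ∣-*ʳ c (x , e) = x * c , trans (sym (*-assoc _ _ _)) (*-congʳ e)

  ∣-*ˡ : ∀ {a b} c → a ∣ b → a ∣ c * b
  ∣-*ˡ c d = ∣-resp (*-comm _ _) (∣-*ʳ c d)

  ∣-+ : ∀ {a b c} → a ∣ b → a ∣ c → a ∣ b + c
  ∣-+ (x , e) (y , f) = x + y , trans (distribˡ _ _ _) (+-cong e f)

  ∣-refl : ∀ {a} → a ∣ a
  ∣-refl = 1# , *-identityʳ _

  *-mono-∣ : ∀ {a b c d} → a ∣ b → c ∣ d → a * c ∣ b * d
  *-mono-∣ {a} {b} {c} {d} (x , e) (y , f) = x * y , trans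
    (solve 4 (λ a c x y → (a :* c) :* (x :* y) := (a :* x) :* (c :* y)) refl a c x y)
    (*-cong e f)

  comax-sym : ∀ {a b} → Comax a b → Comax b a
  comax-sym ⟨ x , y , e ⟩ = ⟨ y , x , trans (+-comm _ _) e ⟩

  comax-1 : ∀ {a} → Comax a 1#
  comax-1 = ⟨ 0# , 1# , trans (+-cong (zeroˡ _) (*-identityˡ _)) (+-identityˡ _) ⟩

  -- Multiply the two Bézout identities; every term of the product except y·v·(b·c) contains a.
  comax-* : ∀ {a b c} → Comax a b → Comax a c → Comax a (b * c)
  comax-* {a} {b} {c} ⟨ x , y , e ⟩ ⟨ u , v , f ⟩ =
    ⟨ x * u * a + x * v * c + y * b * u , y * v ,
    trans (solve 7 (λ a b c x y u v →
        (x :* u :* a :+ x :* v :* c :+ y :* b :* u) :* a :+ y :* v :* (b :* c)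
        := (x :* a :+ y :* b) :* (u :* a :+ v :* c)) refl a b c x y u v)
    (trans (*-cong e f) (*-identityˡ _)) ⟩

  comax-∣ : ∀ {a b c} → c ∣ b → Comax a b → Comax a c
  comax-∣ {a} {b} {c} (d , f) ⟨ x , y , e ⟩ = ⟨ x , y * d ,
    trans (+-congˡ (trans (*-assoc _ _ _) (*-congˡ (trans (*-comm _ _) f)))) e ⟩

  comax-cancel : ∀ {a b c} → Comax a b → a ∣ b * c → a ∣ c
  comax-cancel {a} {b} {c} ⟨ x , y , e ⟩ d = ∣-resp
    (trans (sym (distribʳ _ _ _)) (trans (*-congʳ e) (*-identityˡ _)))
    (∣-+ (∣-*ʳ c (∣-*ˡ x ∣-refl)) (∣-resp (sym (*-assoc _ _ _)) (∣-*ˡ y d)))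

  comax-unit : ∀ {a b} → Comax a b → a ∣ b → a ∣ 1#
  comax-unit co d = comax-cancel co (∣-resp (sym (*-identityʳ _)) d)

  ∏ : List Carrier → Carrier
  ∏ = foldr _*_ 1#

  comax-∏ : ∀ {a bs} → All (Comax a) bs → Comax a (∏ bs)
  comax-∏ []         = comax-1
  comax-∏ (co ∷ cos) = comax-* co (comax-∏ cos)

-- Polynomials over a field: division, gcd, irreducible factors.

record DecidableField : Set₁ where
  field
    commutativeRing : CommutativeRing 0ℓ 0ℓ
  open CommutativeRing commutativeRing public hiding (zero)
  field
    _≟_ : Decidable _≈_
    1≉0 : ¬ 1# ≈ 0#
    inv : ∀ x → ¬ x ≈ 0# → Σ Carrier λ y → x * y ≈ 1#

module FieldPolynomials (K : DecidableField) where

  open DecidableField K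
  open Polynomials commutativeRing public
  open Comaximality polyRing public
  private module S = CommutativeRing polyRing
  open import Algebra.Solver.Ring.NaturalCoefficients.Default S.commutativeSemiring
    using (solve; _:=_; _:+_; _:*_)
  open import Algebra.Properties.Ring ring using (-0#≈0#)

  integral : ∀ {x y} → ¬ x ≈ 0# → ¬ y ≈ 0# → ¬ x * y ≈ 0#
  integral {x} {y} x≉0 y≉0 xy≈0 with inv x x≉0
  ... | z , xz≈1 = y≉0 (trans (sym (*-identityˡ y)) (trans (*-congʳ (trans (sym xz≈1) (*-comm x z)))
    (trans (*-assoc z x y) (trans (*-congˡ xy≈0) (zeroʳ z)))))

  Deg< : ℕ → Poly → Set
  Deg< d p = ∀ i → d ≤ i → coeff p i ≈ 0#

  -- The degree is a relation and not the length of the list, since trailing zeros are allowed.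
  record HasDeg (d : ℕ) (p : Poly) : Set where
    constructor _,_
    field
      bound : Deg< (suc d) p
      lead≉ : ¬ coeff p d ≈ 0#
  open HasDeg public

  record Monic (d : ℕ) (p : Poly) : Set where
    constructor _,_
    field
      bound : Deg< (suc d) p
      lead  : coeff p d ≈ 1#

  monic⇒hasDeg : ∀ {d p} → Monic d p → HasDeg d p
  monic⇒hasDeg (b , l) = b , λ z → 1≉0 (trans (sym l) z)

  hasDeg-resp : ∀ {d p r} → p ≋ r → HasDeg d p → HasDeg d r
  hasDeg-resp e (b , l) = (λ i d<i → trans (sym (at e i)) (b i d<i)) , λ z → l (trans (at e _) z)

  deg<0 : ∀ {p} → Deg< 0 p → p ≋ []
  deg<0 b = mk λ i → b i z≤n

  deg<-tail : ∀ {d a p} → Deg< (suc d) (a ∷ p) → Deg< d p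
  deg<-tail b i d≤i = b (suc i) (s≤s d≤i)

  ⊛-lead : ∀ d e p r → Deg< (suc d) p → Deg< (suc e) r →
    Deg< (suc (d ℕ.+ e)) (p ⊛ r) × coeff (p ⊛ r) (d ℕ.+ e) ≈ coeff p d * coeff r e
  ⊛-lead d e [] r bp br = (λ _ _ → refl) , sym (zeroˡ _)
  ⊛-lead zero e (a ∷ p) r bp br =
    (λ i e<i → trans (eq i) (trans (*-congˡ (br i e<i)) (zeroʳ a))) , eq e
    where
    z : (0# ∷ (p ⊛ r)) ≋ []
    z = ∷≋[] refl (⊛-zeroˡ′ {p} (deg<0 (deg<-tail {a = a} {p} bp)) r)
    eq : ∀ i → coeff ((a · r) ⊕ (0# ∷ (p ⊛ r))) i ≈ a * coeff r i
    eq i = trans (coeff-⊕ (a · r) _ i) (trans (+-cong (coeff-· a r i) (at z i)) (+-identityʳ _))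
  ⊛-lead (suc d) e (a ∷ p) r bp br with ⊛-lead d e p r (deg<-tail {a = a} {p} bp) br
  ... | bnd , lead = (λ { (suc i) (s≤s lt) → trans (eq i (ℕ.<-trans (s≤s (ℕ.m≤n+m e d)) (s≤s lt))) (bnd i lt) })
    , trans (eq (d ℕ.+ e) (s≤s (ℕ.m≤n+m e d))) lead
    where
    eq : ∀ i → e < suc i → coeff ((a · r) ⊕ (0# ∷ (p ⊛ r))) (suc i) ≈ coeff (p ⊛ r) i
    eq i lt = trans (coeff-⊕ (a · r) _ (suc i)) (trans (+-congʳ (trans (coeff-· a r (suc i))
      (trans (*-congˡ (br (suc i) lt)) (zeroʳ a)))) (+-identityˡ _))

  ⊛-hasDeg : ∀ {d e p r} → HasDeg d p → HasDeg e r → HasDeg (d ℕ.+ e) (p ⊛ r)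
  ⊛-hasDeg {d} {e} {p} {r} (bp , lp) (br , lr) with ⊛-lead d e p r bp br
  ... | bnd , lead = bnd , λ z → integral lp lr (trans (sym lead) z)

  ⊛-monic : ∀ {d e p r} → Monic d p → Monic e r → Monic (d ℕ.+ e) (p ⊛ r)
  ⊛-monic {d} {e} {p} {r} (bp , lp) (br , lr) with ⊛-lead d e p r bp br
  ... | bnd , lead = bnd , trans lead (trans (*-cong lp lr) (*-identityˡ 1#))

  𝟙-monic : Monic 0 𝟙
  𝟙-monic = (λ { (suc i) _ → refl }) , refl

  zero⊎hasDeg : ∀ p → p ≋ [] ⊎ Σ ℕ λ d → HasDeg d p
  zero⊎hasDeg [] = inj₁ ≋.refl
  zero⊎hasDeg (a ∷ p) with zero⊎hasDeg p
  ... | inj₂ (d , b , l) = inj₂ (suc d , (λ { (suc i) (s≤s lt) → b i lt }) , l)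
  ... | inj₁ z with a ≟ 0#
  ...   | yes a≈0 = inj₁ (∷≋[] a≈0 z)
  ...   | no a≉0  = inj₂ (0 , (λ { (suc i) _ → at z i }) , a≉0)

  hasDeg-≤ : ∀ {d p i} → HasDeg d p → ¬ coeff p i ≈ 0# → i ≤ d
  hasDeg-≤ {d} {p} {i} (b , _) l with ℕ.<-cmp d i
  ... | tri< d<i _ _ = ⊥-elim (l (b i d<i))
  ... | tri≈ _ ≡.refl _ = ℕ.≤-refl
  ... | tri> _ _ i<d = ℕ.<⇒≤ i<d

  hasDeg-unique : ∀ {d e p} → HasDeg d p → HasDeg e p → d ≡ e
  hasDeg-unique hd he = ℕ.≤-antisym (hasDeg-≤ he (lead≉ hd)) (hasDeg-≤ hd (lead≉ he))

  hasDeg-≉0 : ∀ {d p} → HasDeg d p → ¬ p ≋ []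
  hasDeg-≉0 (_ , l) z = l (at z _)

  ⊛-cancelˡ : ∀ {d p r s} → HasDeg d p → p ⊛ r ≋ p ⊛ s → r ≋ s
  ⊛-cancelˡ {d} {p} {r} {s} hp e with zero⊎hasDeg (r ⊕ (⊖ s))
  ... | inj₁ z = ≋.trans (≋.sym (S.+-identityʳ r)) (≋.trans (S.+-congˡ {r} (≋.sym (S.-‿inverseˡ s)))
         (≋.trans (≋.sym (S.+-assoc r (⊖ s) s)) (S.+-congʳ {s} z)))
  ... | inj₂ (_ , h) = ⊥-elim (hasDeg-≉0 (⊛-hasDeg hp h)
         (≋.trans (S.distribˡ p r (⊖ s)) (≋.trans (S.+-congʳ {p ⊛ (⊖ s)} e)
         (≋.trans (≋.sym (S.distribˡ p s (⊖ s))) (≋.trans (⊛-congˡ p (⊖-inverseʳ s)) (⊛-zeroʳ p))))))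

  nonunit : ∀ {d p} → 1 ≤ d → HasDeg d p → ¬ p ∣ 𝟙
  nonunit {d} {p} 1≤d hp (r , e) with zero⊎hasDeg r
  ... | inj₁ z = 1≉0 (sym (at (≋.trans (≋.sym (≋.trans (⊛-congˡ p z) (⊛-zeroʳ p))) e) 0))
  ... | inj₂ (k , hr) with hasDeg-unique (hasDeg-resp e (⊛-hasDeg hp hr)) (monic⇒hasDeg 𝟙-monic)
  ...   | eq with ℕ.≤-trans 1≤d (ℕ.≤-trans (ℕ.m≤m+n d k) (ℕ.≤-reflexive eq))
  ...     | ()

  divMod : ∀ {d g} → HasDeg d g → ∀ f →
    Σ Poly λ s → Σ Poly λ ρ → f ≋ (g ⊛ s) ⊕ ρ × Deg< d ρ
  divMod {d} {g} hg [] = [] , [] , ≋.sym (≋.trans (⊕-identityʳ _) (⊛-zeroʳ g)) , λ _ _ → refl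
  divMod {d} {g} hg@(bg , lg) (a ∷ f) with divMod hg f
  -- From f = g·s + ρ follows a + X·f = g·(c + X·s) + (a + X·ρ - c·g), and c is chosen to cancel the
  -- coefficient of degree d.
  ... | s , ρ , e , b = c ∷ s , (a ∷ ρ) ⊕ (⊖ (c · g)) , eq , below
    where
    lg⁻¹ : Carrier
    lg⁻¹ = proj₁ (inv (coeff g d) lg)
    c : Carrier
    c = coeff (a ∷ ρ) d * lg⁻¹
    eq : (a ∷ f) ≋ (g ⊛ (c ∷ s)) ⊕ ((a ∷ ρ) ⊕ (⊖ (c · g)))
    eq = ≋.trans (∷-cong (sym (+-identityˡ a)) e) (≋.sym (≋.trans
      (⊕-cong (⊛-∷ g c s) ≋.refl)
      (≋.trans (solve 4 (λ u v w t → (u :+ v) :+ (w :+ t) := (u :+ t) :+ (v :+ w)) ≋.refl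
                 (c · g) (0# ∷ (g ⊛ s)) (a ∷ ρ) (⊖ (c · g)))
      (⊕-cong (⊖-inverseʳ (c · g)) ≋.refl))))
    at-ρ : ∀ i → coeff ((a ∷ ρ) ⊕ (⊖ (c · g))) i ≈ coeff (a ∷ ρ) i + - (c * coeff g i)
    at-ρ i = trans (coeff-⊕ (a ∷ ρ) (⊖ (c · g)) i)
      (+-congˡ (trans (coeff-⊖ (c · g) i) (-‿cong (coeff-· c g i))))
    at-d : coeff (a ∷ ρ) d + - (c * coeff g d) ≈ 0#
    at-d = trans (+-congˡ (-‿cong (trans (*-assoc _ _ _) (trans (*-congˡ (trans (*-comm _ _)
      (proj₂ (inv (coeff g d) lg)))) (*-identityʳ _))))) (-‿inverseʳ _)
    above : ∀ i → d < i → coeff (a ∷ ρ) i + - (c * coeff g i) ≈ 0#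
    above (suc i) lt@(s≤s d≤i) = trans (+-cong (b i d≤i) (-‿cong (trans (*-congˡ (bg (suc i) lt)) (zeroʳ c))))
      (trans (+-identityˡ _) -0#≈0#)
    below : Deg< d ((a ∷ ρ) ⊕ (⊖ (c · g)))
    below i d≤i with ℕ.m≤n⇒m<n∨m≡n d≤i
    ... | inj₁ d<i = trans (at-ρ i) (above i d<i)
    ... | inj₂ ≡.refl = trans (at-ρ d) at-d

  Gcd : Poly → Poly → Set
  Gcd f g = Σ Poly λ h → (Σ Poly λ a → Σ Poly λ b → (a ⊛ f) ⊕ (b ⊛ g) ≋ h) × h ∣ f × h ∣ g

  gcdᴾ-zero : ∀ f {g} → g ≋ [] → Gcd f g
  gcdᴾ-zero f {g} z = f , (𝟙 , [] , ≋.trans (⊕-identityʳ _) (⊛-identityˡ f)) , ∣-refl ,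
    ([] , ≋.trans (⊛-zeroʳ f) (≋.sym z))

  -- Euclid's algorithm; d bounds the degree of the second argument and drops at each division.
  gcdᴾ-bounded : ∀ d f g → Deg< d g → Gcd f g
  gcdᴾ-bounded zero f g b = gcdᴾ-zero f (deg<0 b)
  gcdᴾ-bounded (suc d) f g b with zero⊎hasDeg g
  ... | inj₁ z = gcdᴾ-zero f z
  ... | inj₂ (k , hg) with divMod hg f
  ...   | s , ρ , e , bρ with gcdᴾ-bounded d g ρ (λ i d≤i → bρ i (ℕ.≤-trans k≤d d≤i))
    where
    k≤d : k ≤ d
    k≤d = ℕ.≮⇒≥ λ d<k → lead≉ hg (b k d<k)
  ...     | h , (x , y , xy) , h∣g , h∣ρ =
    h , (y , x ⊕ ((⊖ y) ⊛ s) , eq) , ∣-resp (≋.sym e) (∣-+ (∣-*ʳ s h∣g) h∣ρ) , h∣g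
    where
    eq : (y ⊛ f) ⊕ ((x ⊕ ((⊖ y) ⊛ s)) ⊛ g) ≋ h
    eq = ≋.trans (⊕-cong (⊛-congˡ y e) ≋.refl) (≋.trans
      (solve 6 (λ x y n s g ρ → (y :* (g :* s :+ ρ)) :+ (x :+ n :* s) :* g
                  := (y :+ n) :* (s :* g) :+ (x :* g :+ y :* ρ)) ≋.refl x y (⊖ y) s g ρ)
      (≋.trans (⊕-cong (⊛-congʳ (s ⊛ g) (⊖-inverseʳ y)) ≋.refl) xy))

  gcdᴾ : ∀ f g → Gcd f g
  gcdᴾ f g = gcdᴾ-bounded (length g) f g (length-bound g)
    where
    length-bound : ∀ g → Deg< (length g) g
    length-bound []      i       _         = refl
    length-bound (a ∷ g) (suc i) (s≤s lt) = length-bound g i lt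

  normalise : ∀ {d p} → HasDeg d p → Σ Poly λ m → Monic d m × p ∣ m × m ∣ p
  normalise {d} {p} (b , l) = c · p ,
    ((λ i lt → trans (coeff-· c p i) (trans (*-congˡ (b i lt)) (zeroʳ c))) ,
     trans (coeff-· c p d) (trans (*-comm _ _) lc)) ,
    (c ∷ [] , ≋.trans (⊛-comm p (c ∷ [])) (const c p)) ,
    (coeff p d ∷ [] , ≋.trans (⊛-comm (c · p) (coeff p d ∷ [])) (≋.trans (const _ (c · p))
      (≋.trans (≋.sym (·-assoc _ c p)) (≋.trans (·-cong lc ≋.refl) (1·-identity p)))))
    where
    c = proj₁ (inv (coeff p d) l)
    lc = proj₂ (inv (coeff p d) l)
    const : ∀ a r → (a ∷ []) ⊛ r ≋ a · r
    const a r = ≋.trans (⊕-cong ≋.refl (∷≋[] refl ≋.refl)) (⊕-identityʳ _)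

  monic-0 : ∀ {p} → Monic 0 p → p ≋ 𝟙
  monic-0 (b , l) = mk λ { zero → l ; (suc i) → b (suc i) (s≤s z≤n) }

  monic-cofactor : ∀ {d e f g h} → Monic d f → Monic e g → g ⊛ h ≋ f →
    Σ ℕ λ k → Monic k h × e ℕ.+ k ≡ d
  monic-cofactor {d} {e} {f} {g} {h} mf mg eq with zero⊎hasDeg h
  ... | inj₁ z = ⊥-elim (hasDeg-≉0 (monic⇒hasDeg mf)
          (≋.trans (≋.sym eq) (≋.trans (⊛-congˡ g z) (⊛-zeroʳ g))))
  ... | inj₂ (k , hh) with hasDeg-unique (hasDeg-resp eq (⊛-hasDeg (monic⇒hasDeg mg) hh)) (monic⇒hasDeg mf)
  ...   | ≡.refl = k , (bound hh , trans (sym (*-identityˡ _)) (trans (*-congʳ (sym (Monic.lead mg)))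
            (trans (sym (proj₂ (⊛-lead e k g h (Monic.bound mg) (bound hh)))) (trans (at eq _) (Monic.lead mf))))) , ≡.refl

  -- The ideal (p) is maximal, stated as a decision. Later arguments always use irreducibility by
  -- testing p against some g.
  Maximal : Poly → Set
  Maximal p = ∀ g → p ∣ g ⊎ Comax p g

  record Irreducible (p : Poly) : Set where
    field
      {deg}   : ℕ
      deg≥1   : 1 ≤ deg
      monic   : Monic deg p
      maximal : Maximal p
    hasDeg : HasDeg deg p
    hasDeg = monic⇒hasDeg monic
    ∤𝟙 : ¬ p ∣ 𝟙
    ∤𝟙 = nonunit deg≥1 hasDeg

  Splits : ℕ → Poly → Set
  Splits d f = Σ ℕ λ k → Σ ℕ λ l → Σ Poly λ g → Σ Poly λ h →
    k < d × l < d × Monic k g × Monic l h × g ⊛ h ≋ f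

  -- Let m be the monic gcd of f and g, with f = m·t. If t is constant then f divides g; if m is
  -- constant the Bézout identity gives `Comax`; otherwise m·t is a proper splitting.
  unsplit⇒maximal : ∀ {d f} → Monic d f → ¬ Splits d f → Maximal f
  unsplit⇒maximal {d} {f} mf ¬s g with gcdᴾ f g
  ... | h , (x , y , xy) , (u , hu) , h∣g with zero⊎hasDeg h
  ...   | inj₁ z = ⊥-elim (hasDeg-≉0 (monic⇒hasDeg mf) (≋.trans (≋.sym hu) (⊛-zeroˡ′ z u)))
  ...   | inj₂ (k , hh) with normalise hh
  ...     | m , mm , (v , hv) , m∣h with ∣-trans m∣h (u , hu)
  ...       | t , mt with monic-cofactor mf mm mt
  ...         | zero , m-t , _ = inj₁ (∣-trans (𝟙 , ≋.trans (⊛-identityʳ f)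
                  (≋.trans (≋.sym mt) (≋.trans (⊛-congˡ m (monic-0 m-t)) (⊛-identityʳ m)))) (∣-trans m∣h h∣g))
  unsplit⇒maximal {d} {f} mf ¬s g
      | h , (x , y , xy) , (u , hu) , h∣g | inj₂ (zero , hh)
      | m , mm , (v , hv) , m∣h | t , mt | suc _ , m-t , _ = inj₂ ⟨ v ⊛ x , v ⊛ y ,
        ≋.trans (solve 5 (λ v x y f g → v :* x :* f :+ v :* y :* g := (x :* f :+ y :* g) :* v) ≋.refl v x y f g)
        (≋.trans (⊛-congʳ v xy) (≋.trans hv (monic-0 mm))) ⟩
  unsplit⇒maximal {d} {f} mf ¬s g
      | h , (x , y , xy) , (u , hu) , h∣g | inj₂ (suc k , hh)
      | m , mm , (v , hv) , m∣h | t , mt | suc l , m-t , ≡.refl = ⊥-elim (¬s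
        (suc k , suc l , m , t , s≤s (ℕ.m<m+n k (s≤s z≤n)) , s≤s (ℕ.m≤n+m (suc l) k) , mm , m-t , mt))

  Factorisation : Poly → Set
  Factorisation f = Σ (List Poly) λ ps → All Irreducible ps × ∏ ps ≋ f

  ∏-++ : ∀ ps rs → ∏ (ps ++ rs) ≋ ∏ ps ⊛ ∏ rs
  ∏-++ []       rs = ≋.sym (⊛-identityˡ _)
  ∏-++ (p ∷ ps) rs = ≋.trans (⊛-congˡ p (∏-++ ps rs)) (≋.sym (⊛-assoc p _ _))

  -- `Splits` is not decided, hence the double negation. Assuming that f has no factorisation, f
  -- cannot split, because both parts would factor by induction on the degree bound b; then f is
  -- irreducible and is its own factorisation.
  factorise : ∀ b d {f} → d ≤ b → Monic d f → ¬ ¬ Factorisation f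
  factorise b zero d≤b mf ¬fac = ¬fac ([] , [] , ≋.sym (monic-0 mf))
  factorise (suc b) d@(suc _) {f} d≤b mf ¬fac = ¬fac
    (f ∷ [] , record { deg≥1 = s≤s z≤n ; monic = mf ; maximal = unsplit⇒maximal mf ¬splits } ∷ [] , ⊛-identityʳ f)
    where
    ¬splits : ¬ Splits d f
    ¬splits (k , l , g , h , k<d , l<d , mg , mh , gh) =
      factorise b k (ℕ.≤-pred (ℕ.≤-trans k<d d≤b)) mg λ { (ps , ips , eps) →
      factorise b l (ℕ.≤-pred (ℕ.≤-trans l<d d≤b)) mh λ { (rs , irs , ers) →
      ¬fac (ps ++ rs , All.++⁺ ips irs ,
        ≋.trans (∏-++ ps rs) (≋.trans (⊛-cong eps ers) gh)) } }

  any⊎all : ∀ {C A B : Poly → Set} {xs} → All C xs → (∀ {x} → C x → A x ⊎ B x) → Any A xs ⊎ All B xs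
  any⊎all []         f = inj₂ []
  any⊎all (px ∷ pxs) f with f px | any⊎all pxs f
  ... | inj₁ a | _       = inj₁ (here a)
  ... | inj₂ b | inj₁ as = inj₁ (there as)
  ... | inj₂ b | inj₂ bs = inj₂ (b ∷ bs)

  -- One representative for each class of associate factors, needed because xⁿ-1 is not squarefree
  -- when the characteristic divides n.
  record Distinct (ps rs : List Poly) : Set where
    field
      irr      : All Irreducible rs
      comax    : AllPairs Comax rs
      ∏∣∏      : ∏ rs ∣ ∏ ps
      complete : All (λ p → Any (p ∣_) rs) ps

  distinct : ∀ {ps} → All Irreducible ps → Σ (List Poly) (Distinct ps)
  distinct [] = [] , record { irr = [] ; comax = [] ; ∏∣∏ = ∣-refl ; complete = [] }
  distinct {p ∷ ps} (ip ∷ ips) with distinct ips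
  ... | rs , D with any⊎all (Distinct.irr D) (λ {r} _ → Irreducible.maximal ip r)
  ...   | inj₁ old = rs , record { Distinct D ; ∏∣∏ = ∣-*ˡ p (Distinct.∏∣∏ D) ; complete = old ∷ Distinct.complete D }
  ...   | inj₂ new = p ∷ rs , record
          { irr = ip ∷ Distinct.irr D ; comax = new ∷ Distinct.comax D
          ; ∏∣∏ = *-mono-∣ (∣-refl {p}) (Distinct.∏∣∏ D)
          ; complete = here ∣-refl ∷ All.map there (Distinct.complete D) }

  any-comax : ∀ {h p rs} → All (Comax h) rs → Any (p ∣_) rs → Comax h p
  any-comax (co ∷ _)  (here d)  = comax-∣ d co
  any-comax (_ ∷ cos) (there a) = any-comax cos a

  -- If h were comaximal with every r, it would be so with every p by `complete`, hence with ∏ ps,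
  -- which it divides; then h would be a unit.
  nonunit-divisor : ∀ {ps rs h} → Distinct ps rs → ¬ h ∣ 𝟙 → h ∣ ∏ ps → Any (_∣ h) rs
  nonunit-divisor {ps} {rs} {h} D h∤1 h∣ps with any⊎all (Distinct.irr D) (λ ir → Irreducible.maximal ir h)
  ... | inj₁ a   = a
  ... | inj₂ cos = ⊥-elim (h∤1 (comax-unit (comax-∏
          (All.map (any-comax (All.map comax-sym cos)) (Distinct.complete D))) h∣ps))

  -- If the first factor r is coprime to t, it can be cancelled from the relation t² ∣ r·∏ rs.
  -- Otherwise r ∣ t, so r² divides the product, and cancelling one r leaves r ∣ ∏ rs against
  -- comaximality.
  ∏-squarefree : ∀ {rs t} → All Irreducible rs → AllPairs Comax rs → ¬ t ∣ 𝟙 → ¬ (t ⊛ t ∣ ∏ rs)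
  ∏-squarefree {[]}     {t} [] [] t∤1 d = t∤1 (∣-trans (t , ≋.refl) d)
  ∏-squarefree {r ∷ rs} {t} (ir ∷ irs) (co ∷ cos) t∤1 d with Irreducible.maximal ir t
  ... | inj₂ rt = ∏-squarefree irs cos t∤1 (comax-cancel (comax-sym (comax-* rt rt)) d)
  ... | inj₁ r∣t with ∣-trans (*-mono-∣ r∣t r∣t) d
  ...   | u , e = Irreducible.∤𝟙 ir (comax-unit (comax-∏ co)
            (u , ⊛-cancelˡ (Irreducible.hasDeg ir) (≋.trans (≋.sym (⊛-assoc r r u)) e)))

  subproducts : List Poly → List Poly
  subproducts []       = 𝟙 ∷ []
  subproducts (r ∷ rs) = map (r ⊛_) (subproducts rs) ++ subproducts rs

  length-subproducts : ∀ rs → length (subproducts rs) ≡ 2 ℕ.^ length rs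
  length-subproducts []       = ≡.refl
  length-subproducts (r ∷ rs) = ≡.trans (length-++ (map (r ⊛_) (subproducts rs)))
    (≡.cong₂ ℕ._+_ (≡.trans (length-map _ (subproducts rs)) (length-subproducts rs))
      (≡.trans (length-subproducts rs) (≡.sym (ℕ.+-identityʳ _))))

  subproducts-∣ : ∀ rs → All (_∣ ∏ rs) (subproducts rs)
  subproducts-∣ []       = ∣-refl ∷ []
  subproducts-∣ (r ∷ rs) = All.++⁺
    (All.map⁺ (All.map (*-mono-∣ (∣-refl {r})) (subproducts-∣ rs)))
    (All.map (∣-*ˡ r) (subproducts-∣ rs))

  subproducts-monic : ∀ {rs} → All Irreducible rs → All (λ g → Σ ℕ λ d → Monic d g) (subproducts rs)
  subproducts-monic []         = (0 , 𝟙-monic) ∷ []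
  subproducts-monic (ir ∷ irs) = All.++⁺
    (All.map⁺ (All.map (λ { (d , m) → _ , ⊛-monic (Irreducible.monic ir) m }) (subproducts-monic irs)))
    (subproducts-monic irs)

  subproducts-distinct : ∀ {rs} → All Irreducible rs → AllPairs Comax rs →
    AllPairs (λ g h → ¬ g ≋ h) (subproducts rs)
  subproducts-distinct {[]} [] [] = [] ∷ []
  subproducts-distinct {r ∷ rs} (ir ∷ irs) (co ∷ cos) = AllPairs.++⁺
    (AllPairs.map⁺ (AllPairs.map (λ g≉h e → g≉h (⊛-cancelˡ (Irreducible.hasDeg ir) e)) rest))
    rest
    -- A product with r cannot equal one without r: r would then divide ∏ rs, with which it is
    -- comaximal.
    (All.map⁺ (All.universal (λ g → All.map (λ {h} h∣ e → Irreducible.∤𝟙 ir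
       (comax-unit (comax-∏ co) (∣-trans (g , e) h∣))) (subproducts-∣ rs)) (subproducts rs)))
    where
    rest = subproducts-distinct irs cos

-- Integer sums and indicator functions.

module ∑ = SemiringSum ℤ.+-*-semiring

ℤ-cancelˡ-≤ : ∀ i {j k} → i ℤ.+ j ℤ.≤ i ℤ.+ k → j ℤ.≤ k
ℤ-cancelˡ-≤ i {j} {k} le = ≡.subst₂ ℤ._≤_ (undo j) (undo k) (ℤ.+-monoʳ-≤ (ℤ.- i) le)
  where
  undo : ∀ l → ℤ.- i ℤ.+ (i ℤ.+ l) ≡ l
  undo l = ≡.trans (≡.sym (ℤ.+-assoc (ℤ.- i) i l)) (≡.trans (≡.cong (ℤ._+ l) (ℤ.+-inverseˡ i)) (ℤ.+-identityˡ l))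

sum-mono : ∀ {m} (f g : Fin m → ℤ) → (∀ i → f i ℤ.≤ g i) → ∑.sum f ℤ.≤ ∑.sum g
sum-mono {zero}  f g f≤g = ℤ.≤-refl
sum-mono {suc m} f g f≤g = ℤ.+-mono-≤ (f≤g zero) (sum-mono (f ∘ suc) (g ∘ suc) (f≤g ∘ suc))

sum-zero : ∀ {m} (f : Fin m → ℤ) → (∀ i → f i ≡ 0ℤ) → ∑.sum f ≡ 0ℤ
sum-zero {m} f f≡0 = ≡.trans (∑.sum-cong-≗ f≡0) (∑.sum-replicate-zero m)

sum-single : ∀ {m} (f : Fin m → ℤ) j → (∀ i → i ≢ j → f i ≡ 0ℤ) → ∑.sum f ≡ f j
sum-single {suc m} f j f≡0 = ≡.trans (∑.sum-remove {i = j} f)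
  (≡.trans (≡.cong (ℤ._+_ (f j)) (sum-zero _ λ i → f≡0 _ (Fin.punchInᵢ≢i j i))) (ℤ.+-identityʳ _))

sum-const : ∀ m c → ∑.sum {m} (λ _ → c) ≡ + m ℤ.* c
sum-const zero    c = ≡.refl
sum-const (suc m) c = ≡.trans (≡.cong (ℤ._+_ c) (sum-const m c)) (≡.sym (ℤ.suc-* (+ m) c))

𝟏 : {A : Set} → Dec A → ℤ
𝟏 (yes _) = 1ℤ
𝟏 (no _)  = 0ℤ

𝟏-yes : ∀ {A} (d : Dec A) → A → 𝟏 d ≡ 1ℤ
𝟏-yes (yes _) a = ≡.refl
𝟏-yes (no ¬a) a = ⊥-elim (¬a a)

𝟏-no : ∀ {A} (d : Dec A) → ¬ A → 𝟏 d ≡ 0ℤ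
𝟏-no (yes a) ¬a = ⊥-elim (¬a a)
𝟏-no (no _)  ¬a = ≡.refl

𝟏-cong : ∀ {A B} (d : Dec A) (e : Dec B) → (A → B) → (B → A) → 𝟏 d ≡ 𝟏 e
𝟏-cong (yes a) e f g = ≡.sym (𝟏-yes e (f a))
𝟏-cong (no ¬a) e f g = ≡.sym (𝟏-no e (¬a ∘ g))

0≤𝟏 : ∀ {A} (d : Dec A) → 0ℤ ℤ.≤ 𝟏 d
0≤𝟏 (yes _) = ℤ.+≤+ z≤n
0≤𝟏 (no _)  = ℤ.≤-refl

𝟏-⊎ : ∀ {A B C} (d : Dec A) (e : Dec B) (f : Dec C) → (A → B ⊎ C) → 𝟏 d ℤ.≤ 𝟏 e ℤ.+ 𝟏 f
𝟏-⊎ (no _)  e f h = ℤ.+-mono-≤ (0≤𝟏 e) (0≤𝟏 f)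
𝟏-⊎ (yes a) e f h with h a
... | inj₁ b = ℤ.≤-trans (ℤ.≤-reflexive (≡.sym (≡.trans (ℤ.+-identityʳ _) (𝟏-yes e b)))) (ℤ.+-monoʳ-≤ (𝟏 e) (0≤𝟏 f))
... | inj₂ c = ℤ.≤-trans (ℤ.≤-reflexive (≡.sym (≡.trans (ℤ.+-identityˡ _) (𝟏-yes f c)))) (ℤ.+-monoˡ-≤ (𝟏 f) (0≤𝟏 e))

-- Powers and additivity of the Frobenius map.

module Powers (R : CommutativeRing 0ℓ 0ℓ) where

  open CommutativeRing R hiding (zero)
  open import Algebra.Properties.Semiring.Exp semiring public
    using (_^_; ^-congˡ; ^-homo-*; ^-assocʳ)
  open import Algebra.Properties.CommutativeSemiring.Exp commutativeSemiring public
    using (^-distrib-*)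

  1^ : ∀ m → 1# ^ m ≈ 1#
  1^ zero    = refl
  1^ (suc m) = trans (*-identityˡ _) (1^ m)

PowerAdditive : ∀ {N} → FiniteField N → ℕ → Set
PowerAdditive F m = ∀ x y → (x + y) ^ m ≈ x ^ m + y ^ m
  where
  open FiniteField F
  open Powers ring

prime∤! : ∀ {p} → Prime p → ∀ k → k < p → ¬ p ℕ.∣ k !
prime∤! pr zero    k<p d with ℕ.∣1⇒≡1 d
... | ≡.refl = ¬prime[1] pr
prime∤! pr (suc k) k<p d with euclidsLemma (suc k) (k !) pr d
... | inj₁ d′ = ℕ.>⇒∤ k<p d′
... | inj₂ d′ = prime∤! pr k (ℕ.<-trans (ℕ.n<1+n k) k<p) d′

-- p divides p! = C(p,k)·k!·(p-k)!, but neither of the two factorials in the denominator.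
prime∣C : ∀ {p k} → Prime p → 0 < k → k < p → p ℕ.∣ (p ℕ.C k)
prime∣C {p} {k} pr 0<k k<p = [ id , ⊥-elim ∘ no-den ]′ (euclidsLemma (p ℕ.C k) den pr (≡.subst (p ℕ.∣_) (≡.sym C*den) p∣p!))
  where
  instance _ = k ℕ.!* (p ℕ.∸ k) !≢0
  den = k ! ℕ.* (p ℕ.∸ k) !
  C*den : (p ℕ.C k) ℕ.* den ≡ p !
  C*den = ≡.trans (≡.cong (ℕ._* den) (nCk≡n!/k![n-k]! (ℕ.<⇒≤ k<p))) (ℕ.m/n*n≡m (k![n∸k]!∣n! (ℕ.<⇒≤ k<p)))
  p∣p! : p ℕ.∣ p !
  p∣p! = go k<p
    where
    go : ∀ {p} → k < p → p ℕ.∣ p !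
    go {suc p} _ = ℕ.m∣m*n (p !)
  no-den : ¬ p ℕ.∣ den
  no-den d with euclidsLemma (k !) ((p ℕ.∸ k) !) pr d
  ... | inj₁ d′ = prime∤! pr k k<p d′
  ... | inj₂ d′ = prime∤! pr (p ℕ.∸ k) (ℕ.∸-monoʳ-< 0<k (ℕ.<⇒≤ k<p)) d′

module Frobenius (R : CommutativeRing 0ℓ 0ℓ) {p : ℕ} (pr : Prime p) where

  open CommutativeRing R hiding (zero)
  open Powers R
  open import Algebra.Properties.Semiring.Mult semiring using (×1-homo-*; ×-assoc-*; ×-congʳ; ×-homo-1) renaming (_×_ to _✕_)
  import Algebra.Properties.CommutativeSemiring.Binomial commutativeSemiring as Binomial
  open SemiringSum semiring using (sum; sum-init-last; sum-cong-≋; sum-replicate-zero)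

  ✕-zero : ∀ {m k} x → m ✕ 1# ≈ 0# → m ℕ.∣ k → k ✕ x ≈ 0#
  ✕-zero {m} {k} x m≈0 (ℕ.divides c ≡.refl) = trans (×-congʳ (c ℕ.* m) (sym (*-identityˡ x)))
    (trans (sym (×-assoc-* (c ℕ.* m) 1# x)) (trans (*-congʳ (×1-homo-* c m)) (trans (*-congʳ (trans (*-congˡ m≈0) (zeroʳ _))) (zeroˡ x))))

  frobenius-+ : p ✕ 1# ≈ 0# → ∀ x y → (x + y) ^ p ≈ x ^ p + y ^ p
  frobenius-+ p≈0 x y = go p pr p≈0
    where
    go : ∀ m → Prime m → m ✕ 1# ≈ 0# → (x + y) ^ m ≈ x ^ m + y ^ m
    go zero ()
    go (suc m) prm m≈0 = trans (Binomial.theorem (suc m) x y)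
      (trans (+-cong (trans (×-homo-1 _) (*-identityˡ _)) (trans (sum-init-last (λ i → Binomial.binomialTerm x y (suc m) (suc i))) (+-cong middle top)))
      (trans (+-congˡ (+-identityˡ _)) (+-comm _ _)))
      where
      middle : sum (init (λ i → Binomial.binomialTerm x y (suc m) (suc i))) ≈ 0#
      middle = trans (sum-cong-≋ {m} {y = λ _ → 0#} λ i → ✕-zero _ m≈0 (prime∣C prm (s≤s z≤n)
        (s≤s (≡.subst (_< m) (≡.sym (Fin.toℕ-inject₁ i)) (Fin.toℕ<n i))))) (sum-replicate-zero m)
      top : Binomial.binomialTerm x y (suc m) (suc (fromℕ m)) ≈ x ^ suc m
      top rewrite Fin.toℕ-fromℕ m | nCn≡1 (suc m) | ℕ.n∸n≡0 m = trans (×-homo-1 _) (*-identityʳ _)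

  frobenius-+-^ : p ✕ 1# ≈ 0# → ∀ e x y → (x + y) ^ (p ℕ.^ e) ≈ x ^ (p ℕ.^ e) + y ^ (p ℕ.^ e)
  frobenius-+-^ p≈0 zero x y = distribʳ 1# x y
  frobenius-+-^ p≈0 (suc e) x y = trans (sym (^-assocʳ (x + y) p (p ℕ.^ e)))
    (trans (^-congˡ (p ℕ.^ e) (frobenius-+ p≈0 x y))
    (trans (frobenius-+-^ p≈0 e (x ^ p) (y ^ p)) (+-cong (^-assocʳ x p (p ℕ.^ e)) (^-assocʳ y p (p ℕ.^ e)))))

-- Coprime quotients by a gcd, and the numbers q^d - 1.

gcd-coprime-factors : ∀ m n → 1 ≤ m → Σ ℕ λ s → Σ ℕ λ t →
  m ≡ s ℕ.* gcd m n × n ≡ t ℕ.* gcd m n × Coprime s t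
gcd-coprime-factors m n 1≤m with gcd[m,n]∣m m n | gcd[m,n]∣n m n
... | ℕ.divides s m≡ | ℕ.divides t n≡ = s , t , m≡ , n≡ , coprime
  where
  instance
    g≢0 : ℕ.NonZero (gcd m n)
    g≢0 = ℕ.≢-nonZero (gcd[m,n]≢0 m n (inj₁ (ℕ.m<n⇒n≢0 1≤m)))
  multiple : ∀ {d k l} → d ℕ.∣ k → l ≡ k ℕ.* gcd m n → d ℕ.* gcd m n ℕ.∣ l
  multiple {d} {k} d∣k ≡.refl = ℕ.*-monoˡ-∣ (gcd m n) d∣k
  coprime : Coprime s t
  coprime {d} (d∣s , d∣t) = ℕ.∣1⇒≡1 (ℕ.*-cancelʳ-∣ (gcd m n)
    (≡.subst (d ℕ.* gcd m n ℕ.∣_) (≡.sym (ℕ.*-identityˡ _)) (gcd-greatest (multiple d∣s m≡) (multiple d∣t n≡))))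

÷-* : ∀ {a b} → 1 ≤ b → b ℕ.∣ a → (a ÷ b) ℕ.* b ≡ a
÷-* {a} {suc b} _ d = ℕ.m/n*n≡m d

module PowersMinusOne {q : ℕ} (q≥2 : 2 ≤ q) where

  M : ℕ → ℕ
  M d = q ℕ.^ d ∸ 1

  instance
    q≢0 : NonZero q
    q≢0 = ℕ.>-nonZero (ℕ.≤-trans (s≤s z≤n) q≥2)

  q^≥1 : ∀ d → 1 ≤ q ℕ.^ d
  q^≥1 d = ℕ.m^n>0 q d

  suc-M : ∀ d → suc (M d) ≡ q ℕ.^ d
  suc-M d = ℕ.m+[n∸m]≡n (q^≥1 d)

  M≥1 : ∀ {d} → 1 ≤ d → 1 ≤ M d
  M≥1 {d} 1≤d = ℕ.≤-pred (≡.subst (2 ≤_) (≡.sym (suc-M d))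
    (ℕ.≤-trans q≥2 (ℕ.≤-trans (ℕ.≤-reflexive (≡.sym (ℕ.*-identityʳ q))) (ℕ.^-monoʳ-≤ q 1≤d))))

  M-+ : ∀ a b → M (a ℕ.+ b) ≡ M b ℕ.+ (M a ℕ.* M b ℕ.+ M a)
  M-+ a b = ℕ.suc-injective (≡.trans (suc-M (a ℕ.+ b)) (≡.trans (ℕ.^-distribˡ-+-* q a b)
    (≡.trans (≡.sym (≡.cong₂ ℕ._*_ (suc-M a) (suc-M b))) (lem (M a) (M b)))))
    where
    lem : ∀ x y → suc x ℕ.* suc y ≡ suc (y ℕ.+ (x ℕ.* y ℕ.+ x))
    lem = ℕ.solve-∀

  ∣M-+ : ∀ {c} a b → c ℕ.∣ M a → c ℕ.∣ M b → c ℕ.∣ M (a ℕ.+ b)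
  ∣M-+ {c} a b ca cb = ≡.subst (c ℕ.∣_) (≡.sym (M-+ a b)) (ℕ.∣m∣n⇒∣m+n cb (ℕ.∣m∣n⇒∣m+n (ℕ.∣m⇒∣m*n (M b) ca) ca))

  ∣M-* : ∀ {c} k a → c ℕ.∣ M a → c ℕ.∣ M (k ℕ.* a)
  ∣M-* zero    a ca = _ ℕ.∣0
  ∣M-* (suc k) a ca = ∣M-+ a (k ℕ.* a) ca (∣M-* k a ca)

  ∣M-∸ : ∀ {c} a b → c ℕ.∣ M (a ℕ.+ b) → c ℕ.∣ M b → c ℕ.∣ M a
  ∣M-∸ {c} a b cab cb = ℕ.∣m+n∣m⇒∣n (ℕ.∣m+n∣m⇒∣n (≡.subst (c ℕ.∣_) (M-+ a b) cab) cb) (ℕ.∣n⇒∣m*n (M a) cb)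

  M-∣ : ∀ {a b} → a ℕ.∣ b → M a ℕ.∣ M b
  M-∣ {a} (ℕ.divides k ≡.refl) = ∣M-* k a ℕ.∣-refl

  -- Bézout gives gcd + y·b = x·a, or the same with a and b exchanged; c divides `M` of both
  -- multiples, and `∣M-∸` removes the smaller one.
  ∣M-gcd : ∀ {c} a b → c ℕ.∣ M a → c ℕ.∣ M b → c ℕ.∣ M (gcd a b)
  ∣M-gcd {c} a b ca cb with Bézout.identity (gcd-GCD a b)
  ... | Bézout.+- x y eq = ∣M-∸ (gcd a b) (y ℕ.* b) (≡.subst (λ t → c ℕ.∣ M t) (≡.sym eq) (∣M-* x a ca)) (∣M-* y b cb)
  ... | Bézout.-+ x y eq = ∣M-∸ (gcd a b) (x ℕ.* a) (≡.subst (λ t → c ℕ.∣ M t) (≡.sym eq) (∣M-* y b cb)) (∣M-* x a ca)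

  module _ {n a b : ℕ} (n≥1 : 1 ≤ n) (a∣n : a ℕ.∣ n) (b∣n : b ℕ.∣ n) where

    private
      g = gcd a b
      divisor≥1 : ∀ {d} → d ℕ.∣ n → 1 ≤ d
      divisor≥1 {zero} (ℕ.divides k eq) = ⊥-elim (ℕ.m<n⇒n≢0 n≥1 (≡.trans eq (ℕ.*-zeroʳ k)))
      divisor≥1 {suc d} _ = s≤s z≤n
      g≥1 : 1 ≤ g
      g≥1 = divisor≥1 (ℕ.∣-trans (gcd[m,n]∣m a b) a∣n)
      u = M a ÷ M g
      v = M b ÷ M g
      uM : u ℕ.* M g ≡ M a
      uM = ÷-* (M≥1 g≥1) (M-∣ (gcd[m,n]∣m a b))
      vM : v ℕ.* M g ≡ M b
      vM = ÷-* (M≥1 g≥1) (M-∣ (gcd[m,n]∣n a b))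
      instance
        Mg≢0 : NonZero (M g)
        Mg≢0 = ℕ.>-nonZero (M≥1 g≥1)
        Mn≢0 : NonZero (M n)
        Mn≢0 = ℕ.>-nonZero (M≥1 n≥1)
        u≢0 : NonZero u
        u≢0 = ℕ.≢-nonZero λ z → ℕ.m<n⇒n≢0 (M≥1 (divisor≥1 a∣n)) (≡.trans (≡.sym uM) (≡.cong (ℕ._* M g) z))
      u⊥v : Coprime u v
      u⊥v {d} (du , dv) = ℕ.∣1⇒≡1 (ℕ.*-cancelʳ-∣ (M g) (≡.subst (d ℕ.* M g ℕ.∣_) (≡.sym (ℕ.*-identityˡ (M g)))
        (∣M-gcd a b (≡.subst (d ℕ.* M g ℕ.∣_) uM (ℕ.*-monoˡ-∣ (M g) du)) (≡.subst (d ℕ.* M g ℕ.∣_) vM (ℕ.*-monoˡ-∣ (M g) dv)))))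

    -- Every relation between the two norm exponents comes from the pair (u, v) of exponents of the
    -- norms down to the intersection field. Clearing denominators gives v·x = y·u, and u, v are
    -- coprime by `∣M-gcd`. Thus the pairwise norm condition yields all the relations that gluing
    -- will ask for.
    norm-exponents : ∀ x y → (M n ÷ M a) ℕ.* x ≡ (M n ÷ M b) ℕ.* y →
      Σ ℕ λ z → x ≡ (M a ÷ M g) ℕ.* z × y ≡ (M b ÷ M g) ℕ.* z
    norm-exponents x y eq = z , x≡ , ℕ.*-cancelʳ-≡ y (v ℕ.* z) u
      (≡.trans (≡.sym vx) (≡.trans (≡.cong (v ℕ.*_) x≡) (l₃ u v z)))
      where
      open ≡.≡-Reasoning
      Na = M n ÷ M a
      Nb = M n ÷ M b
      NaM : Na ℕ.* M a ≡ M n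
      NaM = ÷-* (M≥1 (divisor≥1 a∣n)) (M-∣ a∣n)
      NbM : Nb ℕ.* M b ≡ M n
      NbM = ÷-* (M≥1 (divisor≥1 b∣n)) (M-∣ b∣n)
      vx : v ℕ.* x ≡ y ℕ.* u
      vx = ℕ.*-cancelʳ-≡ (v ℕ.* x) (y ℕ.* u) (M g) (ℕ.*-cancelˡ-≡ (v ℕ.* x ℕ.* M g) (y ℕ.* u ℕ.* M g) (M n) (begin
        M n ℕ.* (v ℕ.* x ℕ.* M g)      ≡⟨ ≡.cong (ℕ._* (v ℕ.* x ℕ.* M g)) NaM ⟨
        Na ℕ.* M a ℕ.* (v ℕ.* x ℕ.* M g) ≡⟨ l₁ Na (M a) v x (M g) ⟩
        M a ℕ.* (v ℕ.* M g) ℕ.* (Na ℕ.* x) ≡⟨ ≡.cong₂ (λ s t → M a ℕ.* s ℕ.* t) vM eq ⟩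
        M a ℕ.* M b ℕ.* (Nb ℕ.* y)       ≡⟨ l₂ (M a) (M b) Nb y ⟩
        Nb ℕ.* M b ℕ.* (y ℕ.* M a)       ≡⟨ ≡.cong₂ (λ s t → s ℕ.* (y ℕ.* t)) NbM (≡.sym uM) ⟩
        M n ℕ.* (y ℕ.* (u ℕ.* M g))      ≡⟨ ≡.cong (M n ℕ.*_) (ℕ.*-assoc y u (M g)) ⟨
        M n ℕ.* (y ℕ.* u ℕ.* M g)        ∎))
        where
        l₁ : ∀ N A v x G → N ℕ.* A ℕ.* (v ℕ.* x ℕ.* G) ≡ A ℕ.* (v ℕ.* G) ℕ.* (N ℕ.* x)
        l₁ = ℕ.solve-∀
        l₂ : ∀ A B N y → A ℕ.* B ℕ.* (N ℕ.* y) ≡ N ℕ.* B ℕ.* (y ℕ.* A)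
        l₂ = ℕ.solve-∀
      u∣x : u ℕ.∣ x
      u∣x = coprime-divisor u⊥v (ℕ.divides y vx)
      z = ℕ.quotient u∣x
      x≡ : x ≡ u ℕ.* z
      x≡ = ℕ.m∣n⇒n≡m*quotient u∣x
      l₃ : ∀ u v z → v ℕ.* (u ℕ.* z) ≡ v ℕ.* z ℕ.* u
      l₃ = ℕ.solve-∀

-- Counting in a finite field: roots, orders and power maps.

module FiniteFields {N : ℕ} (F : FiniteField N) where

  open FiniteField F hiding (zero)
  open Powers ring public
  open import Algebra.Properties.Ring (CommutativeRing.ring ring) using (+-cancelʳ)
  open import Algebra.Properties.Semiring.Mult semiring using (×1-homo-*) renaming (_×_ to _✕_)
  open import Algebra.Solver.Ring.NaturalCoefficients.Default commutativeSemiring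
    using (solve; _:=_; _:+_; _:*_; con)

  index : Carrier → Fin N
  index x = proj₁ (enum-surjective x)

  enum-index : ∀ x → enum (index x) ≈ x
  enum-index x = proj₂ (enum-surjective x)

  index-enum : ∀ i → index (enum i) ≡ i
  index-enum i = enum-injective _ _ (enum-index (enum i))

  index-cong : ∀ {x y} → x ≈ y → index x ≡ index y
  index-cong {x} {y} e = enum-injective _ _ (trans (enum-index x) (trans e (sym (enum-index y))))

  record Bijection (φ : Carrier → Carrier) : Set where
    field
      φ-cong : ∀ {x y} → x ≈ y → φ x ≈ φ y
      ψ      : Carrier → Carrier
      ψ-cong : ∀ {x y} → x ≈ y → ψ x ≈ ψ y
      φψ     : ∀ x → φ (ψ x) ≈ x
      ψφ     : ∀ x → ψ (φ x) ≈ x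

  module Reindex (M : CommutativeMonoid 0ℓ 0ℓ) where
    private module M = CommutativeMonoid M
    open MonoidSum M using (sum-permute; sum-cong-≋) renaming (sum to sumᴹ)

    -- Stated for a commutative monoid because it serves integer sums, the sum of all field elements
    -- and the product of the nonzero ones.
    reindex : ∀ (f : Carrier → M.Carrier) → (∀ {x y} → x ≈ y → f x M.≈ f y) →
      ∀ {φ} → Bijection φ → sumᴹ (f ∘ enum) M.≈ sumᴹ (f ∘ φ ∘ enum)
    reindex f f-cong {φ} B = M.trans
      (sum-permute (f ∘ enum) (permutation (index ∘ φ ∘ enum) (index ∘ ψ ∘ enum)
        (λ i → ≡.trans (index-cong (trans (φ-cong (enum-index _)) (φψ _))) (index-enum i))
        (λ i → ≡.trans (index-cong (trans (ψ-cong (enum-index _)) (ψφ _))) (index-enum i))))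
      (sum-cong-≋ {N} {f ∘ enum ∘ index ∘ φ ∘ enum} {f ∘ φ ∘ enum} λ i → f-cong (enum-index _))
      where open Bijection B

  Respects : (Carrier → ℤ) → Set
  Respects f = ∀ {x y} → x ≈ y → f x ≡ f y

  ∑ᶠ : (Carrier → ℤ) → ℤ
  ∑ᶠ f = ∑.sum (f ∘ enum)

  ∑ᶠ-reindex : ∀ {f} → Respects f → ∀ {φ} → Bijection φ → ∑ᶠ f ≡ ∑ᶠ (f ∘ φ)
  ∑ᶠ-reindex {f} = Reindex.reindex ℤ.+-0-commutativeMonoid f

  ∑ᶠ-cong : ∀ {f g : Carrier → ℤ} → (∀ x → f x ≡ g x) → ∑ᶠ f ≡ ∑ᶠ g
  ∑ᶠ-cong f≡g = ∑.sum-cong-≗ (f≡g ∘ enum)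

  ∑ᶠ-mono : ∀ {f g : Carrier → ℤ} → (∀ x → f x ℤ.≤ g x) → ∑ᶠ f ℤ.≤ ∑ᶠ g
  ∑ᶠ-mono f≤g = sum-mono _ _ (f≤g ∘ enum)

  ∑ᶠ-+ : ∀ f g → ∑ᶠ (λ x → f x ℤ.+ g x) ≡ ∑ᶠ f ℤ.+ ∑ᶠ g
  ∑ᶠ-+ f g = ∑.∑-distrib-+ (f ∘ enum) (g ∘ enum)

  ∑ᶠ-* : ∀ c f → ∑ᶠ (λ x → c ℤ.* f x) ≡ c ℤ.* ∑ᶠ f
  ∑ᶠ-* c f = ≡.sym (∑.*-distribˡ-sum c (f ∘ enum))

  ∑ᶠ-comm : ∀ (f : Carrier → Carrier → ℤ) → ∑ᶠ (λ x → ∑ᶠ (f x)) ≡ ∑ᶠ (λ y → ∑ᶠ (λ x → f x y))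
  ∑ᶠ-comm f = ∑.∑-comm (λ i j → f (enum i) (enum j))

  ∑ᶠ-const : ∀ c → ∑ᶠ (λ _ → c) ≡ + N ℤ.* c
  ∑ᶠ-const c = sum-const N c

  ∑ᶠ-single : ∀ {f} → Respects f → ∀ a → (∀ x → ¬ x ≈ a → f x ≡ 0ℤ) → ∑ᶠ f ≡ f a
  ∑ᶠ-single {f} f-cong a f≡0 = ≡.trans
    (sum-single (f ∘ enum) (index a) λ i i≢ → f≡0 _ λ e → i≢ (≡.trans (≡.sym (index-enum i)) (index-cong e)))
    (f-cong (enum-index a))

  # : {P : Carrier → Set} → (∀ x → Dec (P x)) → ℤ
  # P? = ∑ᶠ (λ x → 𝟏 (P? x))

  #-none : ∀ {P : Carrier → Set} (P? : ∀ x → Dec (P x)) → (∀ x → ¬ P x) → # P? ≡ 0ℤ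
  #-none P? ¬p = sum-zero (λ i → 𝟏 (P? (enum i))) λ i → 𝟏-no (P? (enum i)) (¬p (enum i))

  #-single : ∀ a → # (_≟ a) ≡ 1ℤ
  #-single a = ≡.trans (∑ᶠ-single {λ x → 𝟏 (x ≟ a)} (λ e → 𝟏-cong _ _ (trans (sym e)) (trans e)) a (λ x ne → 𝟏-no _ ne)) (𝟏-yes _ refl)

  exists? : ∀ {P : Carrier → Set} → (∀ x → Dec (P x)) → (∀ {x y} → x ≈ y → P x → P y) →
    Dec (Σ Carrier P)
  exists? P? resp with Fin.any? (λ i → P? (enum i))
  ... | yes (i , p) = yes (enum i , p)
  ... | no ¬p = no λ { (x , p) → ¬p (index x , resp (sym (enum-index x)) p) }

  *-cancelˡ : ∀ {x y z} → ¬ x ≈ 0# → x * y ≈ x * z → y ≈ z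
  *-cancelˡ {x} {y} {z} x≉0 e with inv x x≉0
  ... | w , xw≈1 = trans (sym (undo y)) (trans (*-congˡ e) (undo z))
    where
    undo : ∀ u → w * (x * u) ≈ u
    undo u = trans (sym (*-assoc w x u)) (trans (*-congʳ (trans (*-comm w x) xw≈1)) (*-identityˡ u))

  integral : ∀ {x y} → ¬ x ≈ 0# → ¬ y ≈ 0# → ¬ x * y ≈ 0#
  integral x≉0 y≉0 e = y≉0 (*-cancelˡ x≉0 (trans e (sym (zeroʳ _))))

  +-bijection : ∀ a → Bijection (_+ a)
  +-bijection a = record
    { φ-cong = +-congʳ ; ψ = _+ (- a) ; ψ-cong = +-congʳ
    ; φψ = λ x → trans (+-assoc x _ a) (trans (+-congˡ (-‿inverseˡ a)) (+-identityʳ x))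
    ; ψφ = λ x → trans (+-assoc x a _) (trans (+-congˡ (-‿inverseʳ a)) (+-identityʳ x)) }

  *-bijection : ∀ {a} → ¬ a ≈ 0# → Bijection (a *_)
  *-bijection {a} a≉0 = record
    { φ-cong = *-congˡ ; ψ = w *_ ; ψ-cong = *-congˡ
    ; φψ = λ x → trans (sym (*-assoc a w x)) (trans (*-congʳ aw≈1) (*-identityˡ x))
    ; ψφ = λ x → trans (sym (*-assoc w a x)) (trans (*-congʳ (trans (*-comm w a) aw≈1)) (*-identityˡ x)) }
    where
    w = proj₁ (inv a a≉0)
    aw≈1 = proj₂ (inv a a≉0)

  -- Polynomial functions

  -- φ is given by a polynomial of degree at most d whose coefficient of xᵈ is c.
  PolyFun : ℕ → Carrier → (Carrier → Carrier) → Set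
  PolyFun zero    c φ = ∀ x → φ x ≈ c
  PolyFun (suc d) c φ = Σ Carrier λ a → Σ (Carrier → Carrier) λ ψ →
    PolyFun d c ψ × (∀ x → φ x ≈ a + x * ψ x)

  polyFun-resp : ∀ d {c c′ φ φ′} → c ≈ c′ → (∀ x → φ x ≈ φ′ x) → PolyFun d c φ → PolyFun d c′ φ′
  polyFun-resp zero    e f P = λ x → trans (sym (f x)) (trans (P x) e)
  polyFun-resp (suc d) e f (a , ψ , P , g) =
    a , ψ , polyFun-resp d e (λ _ → refl) P , λ x → trans (sym (f x)) (g x)

  polyFun-raise : ∀ d {c φ} → PolyFun d c φ → PolyFun (suc d) 0# φ
  polyFun-raise zero {c} P = c , (λ _ → 0#) , (λ _ → refl) ,
    λ x → trans (P x) (sym (trans (+-congˡ (zeroʳ x)) (+-identityʳ c)))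
  polyFun-raise (suc d) (a , ψ , P , f) = a , ψ , polyFun-raise d P , f

  polyFun-< : ∀ {d e c φ} → d < e → PolyFun d c φ → PolyFun e 0# φ
  polyFun-< {d} {suc e} (s≤s d≤e) P with ℕ.m≤n⇒m<n∨m≡n d≤e
  ... | inj₁ d<e    = polyFun-raise e (polyFun-< d<e P)
  ... | inj₂ ≡.refl = polyFun-raise d P

  polyFun-+ : ∀ d {c c′ φ φ′} → PolyFun d c φ → PolyFun d c′ φ′ → PolyFun d (c + c′) (λ x → φ x + φ′ x)
  polyFun-+ zero    P P′ = λ x → +-cong (P x) (P′ x)
  polyFun-+ (suc d) (a , ψ , P , f) (a′ , ψ′ , P′ , f′) = a + a′ , _ , polyFun-+ d P P′ , λ x →
    trans (+-cong (f x) (f′ x))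
      (solve 5 (λ a a′ x u v → (a :+ x :* u) :+ (a′ :+ x :* v) := (a :+ a′) :+ x :* (u :+ v)) refl a a′ x (ψ x) (ψ′ x))

  polyFun-scale : ∀ d {c φ} b → PolyFun d c φ → PolyFun d (b * c) (λ x → b * φ x)
  polyFun-scale zero    b P = λ x → *-congˡ (P x)
  polyFun-scale (suc d) b (a , ψ , P , f) = b * a , _ , polyFun-scale d b P , λ x →
    trans (*-congˡ (f x)) (solve 4 (λ a b x u → b :* (a :+ x :* u) := b :* a :+ x :* (b :* u)) refl a b x (ψ x))

  polyFun-+< : ∀ {d e c c′ φ φ′} → d < e → PolyFun d c φ → PolyFun e c′ φ′ → PolyFun e c′ (λ x → φ x + φ′ x)
  polyFun-+< {e = e} d<e P P′ = polyFun-resp e (+-identityˡ _) (λ _ → refl) (polyFun-+ e (polyFun-< d<e P) P′)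

  polyFun-^ : ∀ m → PolyFun m 1# (_^ m)
  polyFun-^ zero    = λ _ → refl
  polyFun-^ (suc m) = 0# , _ , polyFun-^ m , λ x → sym (+-identityˡ _)

  polyFun-cong : ∀ d {c φ} → PolyFun d c φ → ∀ {x y} → x ≈ y → φ x ≈ φ y
  polyFun-cong zero    P e = trans (P _) (sym (P _))
  polyFun-cong (suc d) (a , ψ , P , f) e =
    trans (f _) (trans (+-congˡ (*-cong e (polyFun-cong d P e))) (sym (f _)))

  -- φ(x) - φ(a) = (x - a) φ′(x), without subtraction.
  polyFun-divide : ∀ d {c φ} → PolyFun (suc d) c φ → ∀ a →
    Σ (Carrier → Carrier) λ φ′ → PolyFun d c φ′ × (∀ x → φ x + a * φ′ x ≈ φ a + x * φ′ x)
  polyFun-divide zero {c} {φ} (e , ψ , P , f) a = (λ _ → c) , (λ _ → refl) , λ x →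
    trans (+-congʳ (trans (f x) (+-congˡ (*-congˡ (P x)))))
    (trans (solve 4 (λ e x c a → (e :+ x :* c) :+ a :* c := (e :+ a :* c) :+ x :* c) refl e x c a)
    (+-congʳ (sym (trans (f a) (+-congˡ (*-congˡ (P a)))))))
  polyFun-divide (suc d) {c} {φ} (e , ψ , P , f) a with polyFun-divide d P a
  ... | ψ′ , P′ , g = (λ x → a * ψ′ x + ψ x) ,
    polyFun-+< ℕ.≤-refl (polyFun-scale d a P′) P , λ x →
    trans (+-congʳ (f x)) (trans
      (solve 5 (λ e x a u v → (e :+ x :* u) :+ a :* (a :* v :+ u) := (e :+ x :* u) :+ a :* (u :+ a :* v)) refl e x a (ψ x) (ψ′ x))
    (trans (+-congˡ (*-congˡ (g x)))
    (trans (solve 6 (λ e x a u v w → (e :+ x :* u) :+ a :* (w :+ x :* v) := (e :+ a :* w) :+ x :* (a :* v :+ u)) refl e x a (ψ x) (ψ′ x) (ψ a))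
    (+-congʳ (sym (f a))))))

  root-bound : ∀ d {c φ} → ¬ c ≈ 0# → PolyFun d c φ → # (λ x → φ x ≟ 0#) ℤ.≤ + d
  root-bound zero {c} {φ} c≉0 P = ℤ.≤-reflexive (#-none (λ x → φ x ≟ 0#) λ x z → c≉0 (trans (sym (P x)) z))
  root-bound (suc d) {c} {φ} c≉0 P with exists? (λ x → φ x ≟ 0#) (λ e z → trans (sym (polyFun-cong (suc d) P e)) z)
  ... | no none = ℤ.≤-trans (ℤ.≤-reflexive (#-none (λ x → φ x ≟ 0#) λ x z → none (x , z))) (ℤ.+≤+ z≤n)
  ... | yes (a , φa≈0) with polyFun-divide d P a
  ...   | φ′ , P′ , g = ℤ.≤-trans (∑ᶠ-mono (λ x → 𝟏-⊎ (φ x ≟ 0#) (x ≟ a) (φ′ x ≟ 0#) (split x)))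
          (ℤ.≤-trans (ℤ.≤-reflexive (≡.trans (∑ᶠ-+ (λ x → 𝟏 (x ≟ a)) (λ x → 𝟏 (φ′ x ≟ 0#))) (≡.cong (ℤ._+ # (λ x → φ′ x ≟ 0#)) (#-single a))))
            (ℤ.+-monoʳ-≤ 1ℤ (root-bound d c≉0 P′)))
    where
    split : ∀ x → φ x ≈ 0# → x ≈ a ⊎ φ′ x ≈ 0#
    split x z with φ′ x ≟ 0#
    ... | yes y = inj₂ y
    ... | no y  = inj₁ (sym (*-cancelˡ y (trans (*-comm _ _) (trans (sym (+-identityˡ _)) (trans (+-congʳ (sym z))
                    (trans (g x) (trans (+-congʳ φa≈0) (trans (+-identityˡ _) (*-comm _ _)))))))))

  -- Orders of elements

  ^-≉0 : ∀ {x} → ¬ x ≈ 0# → ∀ m → ¬ x ^ m ≈ 0#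
  ^-≉0 x≉0 zero    = 1≉0
  ^-≉0 x≉0 (suc m) = integral x≉0 (^-≉0 x≉0 m)

  -- Translation by 1 permutes the field, so the sum of all elements equals itself plus N·1.
  char∣order : N ✕ 1# ≈ 0#
  char∣order = +-cancel-0 (trans (sym (∑-distrib-+ enum (λ _ → 1#))) (sym (Reindex.reindex +-commutativeMonoid id id (+-bijection 1#))))
      where
      open SemiringSum semiring using (sum; ∑-distrib-+; sum-replicate)
      +-cancel-0 : sum enum + sum {N} (λ _ → 1#) ≈ sum enum → N ✕ 1# ≈ 0#
      +-cancel-0 e = trans (sym (sum-replicate N)) (+-cancelʳ (sum enum) _ _
        (trans (+-comm _ _) (trans e (sym (+-identityˡ _)))))

  char-p : ∀ {p} e → N ≡ p ℕ.^ e → p ✕ 1# ≈ 0#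
  char-p {p} e N≡ with (p ✕ 1#) ≟ 0#
  ... | yes z = z
  ... | no nz = ⊥-elim (^-≉0 nz e (trans (sym (go e)) (≡.subst (λ m → m ✕ 1# ≈ 0#) N≡ char∣order)))
    where
    go : ∀ e → (p ℕ.^ e) ✕ 1# ≈ (p ✕ 1#) ^ e
    go zero    = +-identityʳ 1#
    go (suc e) = trans (×1-homo-* p (p ℕ.^ e)) (*-congˡ (go e))

  module Units {A : ℕ} (N≡ : N ≡ suc A) where

    ∏-constant-off : ∀ {m} (j : Fin (suc m)) (t : Fin (suc m) → Carrier) x →
      t j ≈ 1# → (∀ i → i ≢ j → t i ≈ x) → MonoidSum.sum *-commutativeMonoid t ≈ x ^ m
    ∏-constant-off {m} j t x tj ti = trans (sum-remove {i = j} t) (trans (*-cong tj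
      (trans (sum-cong-≋ {m} {y = λ _ → x} λ i → ti _ (Fin.punchInᵢ≢i j i)) (sum-replicate m))) (*-identityˡ _))
      where open MonoidSum *-commutativeMonoid using (sum-remove; sum-cong-≋; sum-replicate)

    -- Multiplication by x permutes the nonzero elements, so their product is multiplied by x^A = 1.
    -- To sum over the whole enumeration, f replaces the element 0 by 1, and g is the matching
    -- factor: x, but 1 at 0.
    lagrange : ∀ {x} → ¬ x ≈ 0# → x ^ A ≈ 1#
    lagrange {x} x≉0 = *-cancelˡ ∏f≉0 (trans (*-comm _ _) (trans (*-congʳ (sym ∏g))
      (trans (sym (∑-distrib-+ (g ∘ enum) (f ∘ enum))) (trans (sum-cong-≋ {N} (λ i → gf (enum i)))
      (trans (sym (Reindex.reindex *-commutativeMonoid f f-cong (*-bijection x≉0))) (sym (*-identityʳ _)))))))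
      where
      open MonoidSum *-commutativeMonoid using (sum; ∑-distrib-+; sum-cong-≋)
      f g : Carrier → Carrier
      f y with y ≟ 0#
      ... | yes _ = 1#
      ... | no _  = y
      g y with y ≟ 0#
      ... | yes _ = 1#
      ... | no _  = x
      f≉0 : ∀ y → ¬ f y ≈ 0#
      f≉0 y with y ≟ 0#
      ... | yes _  = 1≉0
      ... | no y≉0 = y≉0
      f-cong : ∀ {y z} → y ≈ z → f y ≈ f z
      f-cong {y} {z} e with y ≟ 0# | z ≟ 0#
      ... | yes _ | yes _ = refl
      ... | yes a | no b  = ⊥-elim (b (trans (sym e) a))
      ... | no a  | yes b = ⊥-elim (a (trans e b))
      ... | no _  | no _  = e
      gf : ∀ y → g y * f y ≈ f (x * y)
      gf y with y ≟ 0# | (x * y) ≟ 0#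
      ... | yes _ | yes _ = *-identityˡ 1#
      ... | yes a | no b  = ⊥-elim (b (trans (*-congˡ a) (zeroʳ x)))
      ... | no a  | yes b = ⊥-elim (integral x≉0 a b)
      ... | no _  | no _  = refl
      ∏≉0 : ∀ {m} (t : Fin m → Carrier) → (∀ i → ¬ t i ≈ 0#) → ¬ sum t ≈ 0#
      ∏≉0 {zero}  t h = 1≉0
      ∏≉0 {suc m} t h = integral (h zero) (∏≉0 (t ∘ suc) (h ∘ suc))
      ∏f≉0 : ¬ sum (f ∘ enum) ≈ 0#
      ∏f≉0 = ∏≉0 (f ∘ enum) (λ i → f≉0 (enum i))
      g0 : g (enum (index 0#)) ≈ 1#
      g0 with enum (index 0#) ≟ 0#
      ... | yes _ = refl
      ... | no b  = ⊥-elim (b (enum-index 0#))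
      g≠ : ∀ i → i ≢ index 0# → g (enum i) ≈ x
      g≠ i i≢ with enum i ≟ 0#
      ... | yes a = ⊥-elim (i≢ (≡.trans (≡.sym (index-enum i)) (index-cong a)))
      ... | no _  = refl
      ∏g : sum (g ∘ enum) ≈ x ^ A
      ∏g = go N≡ (g ∘ enum) (index 0#) g0 g≠
        where
        go : ∀ {n} → n ≡ suc A → (t : Fin n → Carrier) (j : Fin n) → t j ≈ 1# → (∀ i → i ≢ j → t i ≈ x) → sum t ≈ x ^ A
        go ≡.refl t j = ∏-constant-off j t x

    ^N : ∀ x → x ^ N ≈ x
    ^N x with x ≟ 0#
    ... | yes z = trans (≡.subst (λ m → x ^ m ≈ 0#) (≡.sym N≡) (trans (*-congʳ z) (zeroˡ _))) (sym z)
    ... | no nz = ≡.subst (λ m → x ^ m ≈ x) (≡.sym N≡) (trans (*-congˡ (lagrange nz)) (*-identityʳ x))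

    #≉0 : # (λ x → ¬? (x ≟ 0#)) ≡ + A
    #≉0 = ∙-cancelˡ 1ℤ _ _ (≡.trans (≡.cong (ℤ._+ # (λ x → ¬? (x ≟ 0#))) (≡.sym (#-single 0#)))
      (≡.trans (≡.sym (∑ᶠ-+ (λ x → 𝟏 (x ≟ 0#)) (λ x → 𝟏 (¬? (x ≟ 0#)))))
      (≡.trans (∑ᶠ-cong one) (≡.trans (∑ᶠ-const 1ℤ) (≡.trans (ℤ.*-identityʳ _) (≡.cong +_ N≡))))))
      where
      one : ∀ x → 𝟏 (x ≟ 0#) ℤ.+ 𝟏 (¬? (x ≟ 0#)) ≡ 1ℤ
      one x with x ≟ 0#
      ... | yes _ = ≡.refl
      ... | no _  = ≡.refl

    #-fibre≤ : ∀ m b → 1 ≤ m → # (λ x → (x ^ m) ≟ b) ℤ.≤ + m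
    #-fibre≤ m b 1≤m = ℤ.≤-trans
      (∑ᶠ-mono (λ x → ℤ.≤-reflexive (𝟏-cong ((x ^ m) ≟ b) ((- b + x ^ m) ≟ 0#)
        (λ e → trans (+-congˡ e) (-‿inverseˡ b))
        (λ e → sym (+-cancelˡ′ (trans (-‿inverseˡ b) (sym e)))))))
      (root-bound m 1≉0 (polyFun-+< 1≤m (λ _ → refl) (polyFun-^ m)))
      where
      +-cancelˡ′ : ∀ {x y} → - b + x ≈ - b + y → x ≈ y
      +-cancelˡ′ {x} {y} e = +-cancelʳ (- b) x y (trans (+-comm x _) (trans e (+-comm _ y)))

    -- The sum 1 + y + ... + y^(k-1). For A = (k+1)·m and y = x^m, x^A - 1 is (x^m - 1) times the
    -- sum with k+1 terms. All A nonzero x are roots and the second factor has at most k·m of them,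
    -- so x^m = 1 has at least m solutions.
    geometric : ℕ → Carrier → Carrier
    geometric zero    y = 0#
    geometric (suc k) y = 1# + y * geometric k y

    geometric-telescopes : ∀ k y → y * geometric k y + 1# ≈ geometric k y + y ^ k
    geometric-telescopes zero    y = +-congʳ (zeroʳ y)
    geometric-telescopes (suc k) y = trans (+-congʳ (*-congˡ (trans (+-comm _ _) (geometric-telescopes k y))))
      (solve 3 (λ y g h → y :* (g :+ h) :+ con 1 := con 1 :+ y :* g :+ y :* h) refl y (geometric k y) (y ^ k))

    polyFun-^* : ∀ m {d c φ} → PolyFun d c φ → PolyFun (m ℕ.+ d) c (λ x → x ^ m * φ x)
    polyFun-^* zero    {d} P = polyFun-resp d refl (λ x → sym (*-identityˡ _)) P
    polyFun-^* (suc m) {d} P = 0# , _ , polyFun-^* m P , λ x → trans (*-assoc _ _ _) (sym (+-identityˡ _))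

    polyFun-geometric : ∀ m k → 1 ≤ m → PolyFun (k ℕ.* m) 1# (λ x → geometric (suc k) (x ^ m))
    polyFun-geometric m zero    1≤m = λ x → trans (+-congˡ (zeroʳ _)) (+-identityʳ 1#)
    polyFun-geometric m (suc k) 1≤m =
      polyFun-+< (ℕ.≤-trans 1≤m (ℕ.m≤m+n m (k ℕ.* m))) (λ _ → refl) (polyFun-^* m (polyFun-geometric m k 1≤m))

    #-roots≥ : ∀ m k → 1 ≤ m → suc k ℕ.* m ≡ A → + m ℤ.≤ # (λ x → (x ^ m) ≟ 1#)
    #-roots≥ m k 1≤m eq = ℤ.≤-trans (ℤ.≤-reflexive (≡.sym (≡.trans (≡.cong (λ t → + t ℤ.- + (k ℕ.* m)) (≡.sym eq))
        (≡.trans (≡.cong (ℤ._- + (k ℕ.* m)) (ℤ.pos-+ m (k ℕ.* m))) (i+j-j (+ m) (+ (k ℕ.* m)))))))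
      (ℤ.≤-trans (ℤ.+-monoˡ-≤ (ℤ.- + (k ℕ.* m)) le) (ℤ.≤-reflexive (i+j-j R (+ (k ℕ.* m)))))
      where
      R = # (λ x → (x ^ m) ≟ 1#)
      i+j-j : ∀ i j → i ℤ.+ j ℤ.- j ≡ i
      i+j-j i j = ≡.trans (ℤ.+-assoc i j (ℤ.- j)) (≡.trans (≡.cong (ℤ._+_ i) (ℤ.+-inverseʳ j)) (ℤ.+-identityʳ i))
      split : ∀ x → ¬ x ≈ 0# → (x ^ m ≈ 1#) ⊎ (geometric (suc k) (x ^ m) ≈ 0#)
      split x x≉0 with geometric (suc k) (x ^ m) ≟ 0#
      ... | yes z = inj₂ z
      ... | no nz = inj₁ (*-cancelˡ nz (trans (*-comm _ _) (trans (+-cancelʳ 1# _ _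
              (trans (geometric-telescopes (suc k) (x ^ m)) (+-congˡ
                (trans (^-assocʳ x m (suc k)) (≡.subst (λ t → x ^ t ≈ 1#) (≡.trans (≡.sym eq) (ℕ.*-comm (suc k) m)) (lagrange x≉0))))))
              (sym (*-identityʳ _)))))
      le : + A ℤ.≤ R ℤ.+ + (k ℕ.* m)
      le = ℤ.≤-trans (ℤ.≤-reflexive (≡.sym #≉0)) (ℤ.≤-trans
        (∑ᶠ-mono (λ x → 𝟏-⊎ (¬? (x ≟ 0#)) ((x ^ m) ≟ 1#) (geometric (suc k) (x ^ m) ≟ 0#) (split x)))
        (ℤ.≤-trans (ℤ.≤-reflexive (∑ᶠ-+ (λ x → 𝟏 ((x ^ m) ≟ 1#)) (λ x → 𝟏 (geometric (suc k) (x ^ m) ≟ 0#))))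
          (ℤ.+-monoʳ-≤ R (root-bound (k ℕ.* m) 1≉0 (polyFun-geometric m k 1≤m)))))

    #-roots : ∀ m k → 1 ≤ m → suc k ℕ.* m ≡ A → # (λ x → (x ^ m) ≟ 1#) ≡ + m
    #-roots m k 1≤m eq = ℤ.≤-antisym (#-fibre≤ m 1# 1≤m) (#-roots≥ m k 1≤m eq)

    -- A count: the A = k·m nonzero y have m-th powers among the k-th roots of unity, and each fibre
    -- has at most m elements. If b were missed, only k-1 values would remain, giving A ≤ m·(k-1).
    ^-surjective : ∀ m k → 1 ≤ m → 1 ≤ k → k ℕ.* m ≡ A → ∀ {b} → b ^ k ≈ 1# → Σ Carrier λ y → y ^ m ≈ b
    ^-surjective m k 1≤m 1≤k eq {b} b^k with exists? (λ y → (y ^ m) ≟ b) (λ e f → trans (^-congˡ m (sym e)) f)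
    ... | yes found = found
    ... | no none = ⊥-elim (ℕ.<⇒≱ 1≤m (ℤ.drop‿+≤+ (ℤ-cancelˡ-≤ (+ A) {+ m} {0ℤ} (ℤ.≤-trans A+m≤A (ℤ.≤-reflexive (≡.sym (ℤ.+-identityʳ _)))))))
      where
      other? : ∀ c → Dec ((c ^ k ≈ 1#) × ¬ c ≈ b)
      other? c = ((c ^ k) ≟ 1#) ×-dec ¬? (c ≟ b)
      #other+1≤k : # other? ℤ.+ 1ℤ ℤ.≤ + k
      #other+1≤k = ℤ.≤-trans (ℤ.≤-reflexive (≡.trans (≡.cong (ℤ._+_ (# other?)) (≡.sym (#-single b))) (≡.sym (∑ᶠ-+ (λ c → 𝟏 (other? c)) (λ c → 𝟏 (c ≟ b))))))
        (ℤ.≤-trans (∑ᶠ-mono point) (#-fibre≤ k 1# 1≤k))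
        where
        point : ∀ c → 𝟏 (other? c) ℤ.+ 𝟏 (c ≟ b) ℤ.≤ 𝟏 ((c ^ k) ≟ 1#)
        point c with c ≟ b | (c ^ k) ≟ 1#
        ... | yes _ | yes _ = ℤ.≤-refl
        ... | yes e | no z  = ⊥-elim (z (trans (^-congˡ k e) b^k))
        ... | no _  | yes _ = ℤ.≤-refl
        ... | no _  | no _  = ℤ.≤-refl
      weight : Carrier → Carrier → ℤ
      weight y c = 𝟏 (other? c) ℤ.* 𝟏 ((y ^ m) ≟ c)
      inner : ∀ y → 𝟏 (¬? (y ≟ 0#)) ℤ.≤ ∑ᶠ (weight y)
      inner y = ℤ.≤-trans (lower (y ≟ 0#)) (ℤ.≤-reflexive (≡.sym (≡.trans (∑ᶠ-single {weight y} resp (y ^ m)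
          (λ c ne → ≡.trans (≡.cong (ℤ._*_ (𝟏 (other? c))) (𝟏-no _ (ne ∘ sym))) (ℤ.*-zeroʳ (𝟏 (other? c)))))
          (≡.trans (≡.cong (ℤ._*_ (𝟏 (other? (y ^ m)))) (𝟏-yes ((y ^ m) ≟ (y ^ m)) refl)) (ℤ.*-identityʳ _)))))
        where
        resp : Respects (weight y)
        resp {c} {d} e = ≡.cong₂ ℤ._*_
          (𝟏-cong (other? c) (other? d) (λ { (u , v) → trans (^-congˡ k (sym e)) u , λ w → v (trans e w) })
                        (λ { (u , v) → trans (^-congˡ k e) u , λ w → v (trans (sym e) w) }))
          (𝟏-cong ((y ^ m) ≟ c) ((y ^ m) ≟ d) (λ u → trans u e) (λ u → trans u (sym e)))
        lower : (d : Dec (y ≈ 0#)) → 𝟏 (¬? d) ℤ.≤ 𝟏 (other? (y ^ m))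
        lower (yes z) = 0≤𝟏 (other? (y ^ m))
        lower (no nz) = ℤ.≤-reflexive (≡.sym (𝟏-yes (other? (y ^ m))
          (trans (^-assocʳ y m k) (≡.subst (λ t → y ^ t ≈ 1#) (≡.trans (≡.sym eq) (ℕ.*-comm k m)) (lagrange nz)) ,
           λ e → none (y , e))))
      A≤ : + A ℤ.≤ + m ℤ.* # other?
      A≤ = ℤ.≤-trans (ℤ.≤-reflexive (≡.sym #≉0)) (ℤ.≤-trans (∑ᶠ-mono inner)
        (ℤ.≤-trans (ℤ.≤-reflexive (∑ᶠ-comm weight)) (ℤ.≤-trans (∑ᶠ-mono bound)
          (ℤ.≤-reflexive (∑ᶠ-* (+ m) (λ c → 𝟏 (other? c)))))))
        where
        bound : ∀ c → ∑ᶠ (λ y → weight y c) ℤ.≤ + m ℤ.* 𝟏 (other? c)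
        bound c = ℤ.≤-trans (ℤ.≤-reflexive (∑ᶠ-* (𝟏 (other? c)) (λ y → 𝟏 ((y ^ m) ≟ c))))
          (ℤ.≤-trans (mono (other? c)) (ℤ.≤-reflexive (ℤ.*-comm (𝟏 (other? c)) (+ m))))
          where
          mono : ∀ {P : Set} (d : Dec P) → 𝟏 d ℤ.* # (λ y → (y ^ m) ≟ c) ℤ.≤ 𝟏 d ℤ.* + m
          mono (yes _) = ℤ.*-monoˡ-≤-nonNeg 1ℤ (#-fibre≤ m c 1≤m)
          mono (no _)  = ℤ.≤-refl
      A+m≤A : + A ℤ.+ + m ℤ.≤ + A
      A+m≤A = ℤ.≤-trans (ℤ.+-monoˡ-≤ (+ m) A≤) (ℤ.≤-trans
        (ℤ.≤-reflexive (≡.trans (≡.cong (ℤ._+_ (+ m ℤ.* # other?)) (≡.sym (ℤ.*-identityʳ (+ m)))) (≡.sym (ℤ.*-distribˡ-+ (+ m) (# other?) 1ℤ))))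
        (ℤ.≤-trans (ℤ.*-monoˡ-≤-nonNeg (+ m) #other+1≤k)
          (ℤ.≤-reflexive (≡.trans (≡.sym (ℤ.pos-* m k)) (≡.cong +_ (≡.trans (ℕ.*-comm m k) eq))))))

  -- Systems of equations yᵐ = a

  ^-≡ : ∀ x {m n} → m ≡ n → x ^ m ≈ x ^ n
  ^-≡ x ≡.refl = refl

  ^-swap : ∀ x m n → (x ^ m) ^ n ≈ (x ^ n) ^ m
  ^-swap x m n = trans (^-assocʳ x m n) (trans (^-≡ x (ℕ.*-comm m n)) (sym (^-assocʳ x n m)))

  -- Bézout over ℕ reads 1 + y·t = x·s, or the same with s and t exchanged; then w·(w^t)^y = (w^s)^x
  -- recovers w from its two powers by one cancellation.
  coprime-rigid : ∀ {s t u v} → Coprime s t → ¬ u ≈ 0# → u ^ s ≈ v ^ s → u ^ t ≈ v ^ t → u ≈ v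
  coprime-rigid {s} {t} {u} {v} co u≉0 us ut with coprime-Bézout co
  ... | Bézout.+- x y eq = *-cancelˡ (^-≉0 (^-≉0 u≉0 t) y) (trans (*-comm _ u) (trans (step u)
          (trans (^-congˡ x us) (trans (sym (step v)) (trans (*-congˡ (^-congˡ y (sym ut))) (*-comm v _))))))
    where
    step : ∀ w → w * (w ^ t) ^ y ≈ (w ^ s) ^ x
    step w = trans (*-congˡ (^-assocʳ w t y)) (trans (^-≡ w (≡.trans (≡.cong suc (ℕ.*-comm t y)) (≡.trans eq (ℕ.*-comm x s)))) (sym (^-assocʳ w s x)))
  ... | Bézout.-+ x y eq = *-cancelˡ (^-≉0 (^-≉0 u≉0 s) x) (trans (*-comm _ u) (trans (step u)
          (trans (^-congˡ y ut) (trans (sym (step v)) (trans (*-congˡ (^-congˡ x (sym us))) (*-comm v _))))))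
    where
    step : ∀ w → w * (w ^ s) ^ x ≈ (w ^ t) ^ y
    step w = trans (*-congˡ (^-assocʳ w s x)) (trans (^-≡ w (≡.trans (≡.cong suc (ℕ.*-comm s x)) (≡.trans eq (ℕ.*-comm y t)))) (sym (^-assocʳ w t y)))

  -- With x s - y t = 1, the common root is α^x β^(-y).
  common-root′ : ∀ {s t α β} x y → 1 ℕ.+ y ℕ.* t ≡ x ℕ.* s → ¬ α ≈ 0# → ¬ β ≈ 0# → α ^ t ≈ β ^ s →
    Σ Carrier λ b → ¬ b ≈ 0# × b ^ s ≈ α × b ^ t ≈ β
  common-root′ {s} {t} {α} {β} x y eq α≉0 β≉0 αβ =
    α ^ x * w ^ y , integral (^-≉0 α≉0 x) (^-≉0 w≉0 y) , at-s , at-t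
    where
    w = proj₁ (inv β β≉0)
    βw : β * w ≈ 1#
    βw = proj₂ (inv β β≉0)
    w≉0 : ¬ w ≈ 0#
    w≉0 z = 1≉0 (trans (sym βw) (trans (*-congˡ z) (zeroʳ β)))
    βw^ : ∀ m → β ^ m * w ^ m ≈ 1#
    βw^ m = trans (sym (^-distrib-* β w m)) (trans (^-congˡ m βw) (1^ m))
    expand : ∀ r → (α ^ x * w ^ y) ^ r ≈ α ^ (x ℕ.* r) * w ^ (y ℕ.* r)
    expand r = trans (^-distrib-* (α ^ x) (w ^ y) r) (*-cong (^-assocʳ α x r) (^-assocʳ w y r))
    at-s : (α ^ x * w ^ y) ^ s ≈ α
    at-s = trans (expand s) (trans (*-congʳ (trans (^-≡ α (≡.sym eq))
      (*-congˡ (trans (^-≡ α (ℕ.*-comm y t)) (trans (sym (^-assocʳ α t y)) (trans (^-congˡ y αβ) (trans (^-assocʳ β s y) (^-≡ β (ℕ.*-comm s y)))))))))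
      (trans (*-assoc _ _ _) (trans (*-congˡ (βw^ (y ℕ.* s))) (*-identityʳ α))))
    at-t : (α ^ x * w ^ y) ^ t ≈ β
    at-t = trans (expand t) (trans (*-congʳ (trans (^-≡ α (ℕ.*-comm x t)) (trans (sym (^-assocʳ α t x))
      (trans (^-congˡ x αβ) (trans (^-assocʳ β s x) (^-≡ β (≡.trans (ℕ.*-comm s x) (≡.sym eq))))))))
      (trans (*-assoc _ _ _) (trans (*-congˡ (βw^ (y ℕ.* t))) (*-identityʳ β))))

  common-root : ∀ {s t α β} → Coprime s t → ¬ α ≈ 0# → ¬ β ≈ 0# → α ^ t ≈ β ^ s →
    Σ Carrier λ b → ¬ b ≈ 0# × b ^ s ≈ α × b ^ t ≈ β
  common-root co α≉0 β≉0 αβ with coprime-Bézout co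
  ... | Bézout.+- x y eq = common-root′ x y eq α≉0 β≉0 αβ
  ... | Bézout.-+ x y eq with common-root′ y x eq β≉0 α≉0 (sym αβ)
  ...   | b , b≉0 , bt , bs = b , b≉0 , bs , bt

  module _ {I : Set} (n : I → ℕ) (a : I → Carrier) (n≥1 : ∀ i → 1 ≤ n i) (a≉0 : ∀ i → ¬ a i ≈ 0#) where

    Compatible : I → I → Set
    Compatible i j = ∀ x y → n i ℕ.* x ≡ n j ℕ.* y → a i ^ x ≈ a j ^ y

    gcdOf : List I → ℕ
    gcdOf is = foldr gcd 0 (map n is)

    -- With G the gcd, `root` has a i as its (n i / G)-th power; quantifying over e avoids choosing
    -- these quotients. The field `rigid` says that such powers determine the element. It
    -- strengthens the induction: an equation involving `root` can be checked after raising it to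
    -- each of these exponents.
    record Glued (is : List I) : Set where
      field
        gcd≥1   : 1 ≤ gcdOf is
        gcd∣    : All (λ i → gcdOf is ℕ.∣ n i) is
        root    : Carrier
        root≉0  : ¬ root ≈ 0#
        root^   : All (λ i → ∀ e → n i ≡ e ℕ.* gcdOf is → root ^ e ≈ a i) is
        rigid   : ∀ u v → ¬ u ≈ 0# → All (λ i → ∀ e → n i ≡ e ℕ.* gcdOf is → u ^ e ≈ v ^ e) is → u ≈ v

    -- With n i = s·G and the old gcd = t·G, the new root b must satisfy b^s = a i and b^t = old
    -- root. This needs (a i)^t = root^s, which `rigid` reduces to the pairwise conditions
    -- `Compatible`.
    glue : ∀ i is → AllPairs Compatible (i ∷ is) → Glued (i ∷ is)
    glue i [] _ = record
      { gcd≥1 = ≡.subst (1 ≤_) (≡.sym g≡) (n≥1 i) ; gcd∣ = ℕ.∣-reflexive g≡ ∷ []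
      ; root = a i ; root≉0 = a≉0 i
      ; root^ = (λ e eq → trans (^-≡ (a i) (e≡1 e eq)) (*-identityʳ (a i))) ∷ []
      ; rigid = λ { u v _ (h ∷ []) → trans (sym (*-identityʳ u)) (trans (h 1 (≡.sym (≡.trans (ℕ.+-identityʳ _) g≡))) (*-identityʳ v)) } }
      where
      g≡ : gcd (n i) 0 ≡ n i
      g≡ = gcd-identityʳ (n i)
      e≡1 : ∀ e → n i ≡ e ℕ.* gcd (n i) 0 → e ≡ 1
      e≡1 e eq = ℕ.*-cancelʳ-≡ e 1 (n i) {{ℕ.>-nonZero (n≥1 i)}}
        (≡.trans (≡.cong (e ℕ.*_) (≡.sym g≡)) (≡.trans (≡.sym eq) (≡.sym (ℕ.*-identityˡ (n i)))))
    glue i (j ∷ is) (co ∷ cos) with glue j is cos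
    ... | T with gcd-coprime-factors (n i) (gcdOf (j ∷ is)) (n≥1 i)
    ...   | s , t , n≡ , G′≡ , s⊥t with common-root s⊥t (a≉0 i) (Glued.root≉0 T) αβ
      where
      open Glued T
      open ≡.≡-Reasoning
      G = gcd (n i) (gcdOf (j ∷ is))
      exps : ∀ {k} e → n k ≡ e ℕ.* gcdOf (j ∷ is) → n i ℕ.* (t ℕ.* e) ≡ n k ℕ.* s
      exps {k} e eq = begin
        n i ℕ.* (t ℕ.* e)          ≡⟨ ≡.cong (ℕ._* (t ℕ.* e)) n≡ ⟩
        s ℕ.* G ℕ.* (t ℕ.* e)      ≡⟨ lem s G t e ⟩
        e ℕ.* (t ℕ.* G) ℕ.* s      ≡⟨ ≡.cong (λ z → e ℕ.* z ℕ.* s) (≡.sym G′≡) ⟩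
        e ℕ.* gcdOf (j ∷ is) ℕ.* s ≡⟨ ≡.cong (ℕ._* s) (≡.sym eq) ⟩
        n k ℕ.* s                  ∎
        where
        lem : ∀ s G t e → s ℕ.* G ℕ.* (t ℕ.* e) ≡ e ℕ.* (t ℕ.* G) ℕ.* s
        lem = ℕ.solve-∀
      αβ : a i ^ t ≈ root ^ s
      αβ = rigid (a i ^ t) (root ^ s) (^-≉0 (a≉0 i) t) (All.zipWith
        (λ { {k} (compat , r) e eq → trans (^-assocʳ (a i) t e) (trans (compat (t ℕ.* e) s (exps {k} e eq))
              (trans (^-congˡ s (sym (r e eq))) (^-swap root e s))) }) (co , root^))
    ...     | b , b≉0 , bs , bt = record
      { gcd≥1 = G≥1
      ; gcd∣ = gcd[m,n]∣m (n i) G′ ∷ All.map (λ d → ℕ.∣-trans (gcd[m,n]∣n (n i) G′) d) gcd∣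
      ; root = b ; root≉0 = b≉0
      ; root^ = (λ e eq → trans (^-≡ b (ℕ.*-cancelʳ-≡ e s G (≡.trans (≡.sym eq) n≡))) bs)
          ∷ All.zipWith (λ { {k} (ℕ.divides e′ eq′ , r) e eq →
              trans (^-≡ b (tail-exp {k} e e′ eq eq′)) (trans (sym (^-assocʳ b t e′)) (trans (^-congˡ e′ bt) (r e′ eq′))) }) (gcd∣ , root^)
      ; rigid = λ { u v u≉0 (h ∷ hs) → coprime-rigid s⊥t u≉0 (h s n≡)
          (rigid (u ^ t) (v ^ t) (^-≉0 u≉0 t) (All.map (λ {k} g e eq →
            trans (^-assocʳ u t e) (trans (g (t ℕ.* e) (head-exp {k} e eq)) (sym (^-assocʳ v t e)))) hs)) } }
      where
      open Glued T
      G′ = gcdOf (j ∷ is)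
      G = gcd (n i) G′
      instance
        G≢0 : ℕ.NonZero G
        G≢0 = ℕ.≢-nonZero (gcd[m,n]≢0 (n i) G′ (inj₁ (ℕ.m<n⇒n≢0 (n≥1 i))))
      G≥1 : 1 ≤ G
      G≥1 = ℕ.>-nonZero⁻¹ G
      head-exp : ∀ {k} e → n k ≡ e ℕ.* G′ → n k ≡ t ℕ.* e ℕ.* G
      head-exp e eq = ≡.trans eq (≡.trans (≡.cong (e ℕ.*_) G′≡) (lem e t G))
        where
        lem : ∀ e t G → e ℕ.* (t ℕ.* G) ≡ t ℕ.* e ℕ.* G
        lem = ℕ.solve-∀
      tail-exp : ∀ {k} e e′ → n k ≡ e ℕ.* G → n k ≡ e′ ℕ.* G′ → e ≡ t ℕ.* e′
      tail-exp {k} e e′ eq eq′ = ℕ.*-cancelʳ-≡ e (t ℕ.* e′) G (≡.trans (≡.sym eq) (head-exp {k} e′ eq′))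

-- Finite sets: pigeonhole, matching and enumeration of decidable subsets.

injective⇒surjective : ∀ {m} (f : Fin m → Fin m) → (∀ {i j} → f i ≡ f j → i ≡ j) → ∀ y → Σ (Fin m) λ i → f i ≡ y
injective⇒surjective {suc m} f inj y with Fin.any? (λ i → f i Fin.≟ y)
... | yes found = found
... | no none = ⊥-elim (ℕ.1+n≰n (Fin.injective⇒≤ {f = λ i → punchOut {i = y} {f i} (λ e → none (i , ≡.sym e))}
        (λ {i} {j} e → inj (Fin.punchOut-injective (λ e → none (i , ≡.sym e)) (λ e → none (j , ≡.sym e)) e))))

funToFin-cong : ∀ {m k} {f g : Fin m → Fin k} → (∀ i → f i ≡ g i) → funToFin f ≡ funToFin g
funToFin-cong {zero}  e = ≡.refl
funToFin-cong {suc m} e = ≡.cong₂ Fin.combine (e zero) (funToFin-cong (e ∘ suc))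

lookup-AllPairs : ∀ {A : Set} {R : A → A → Set} {xs} → AllPairs R xs →
  ∀ i j → i Fin.< j → R (lookup xs i) (lookup xs j)
lookup-AllPairs (rs ∷ _)  zero    (suc j) _         = All.lookup rs (∈-lookup j)
lookup-AllPairs (_ ∷ rss) (suc i) (suc j) (s≤s lt) = lookup-AllPairs rss i j lt

distinct-matches⇒length-≤ : ∀ {A B : Set} {R : A → B → Set} {xs ys} → All (λ x → Any (R x) ys) xs →
  AllPairs (λ x x′ → ∀ y → R x y → ¬ R x′ y) xs → length xs ≤ length ys
distinct-matches⇒length-≤ {R = R} {xs} {ys} match distinct = Fin.injective⇒≤ {f = pos} inj
  where
  m : ∀ i → Any (R (lookup xs i)) ys
  m i = All.lookup match (∈-lookup i)
  pos : Fin (length xs) → Fin (length ys)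
  pos i = Any.index (m i)
  hit : ∀ i → R (lookup xs i) (lookup ys (pos i))
  hit i = lookup-index (m i)
  clash : ∀ {i j} → i Fin.< j → pos i ≢ pos j
  clash {i} {j} lt e = lookup-AllPairs distinct i j lt _ (hit i) (≡.subst (λ k → R (lookup xs j) (lookup ys k)) (≡.sym e) (hit j))
  inj : ∀ {i j} → pos i ≡ pos j → i ≡ j
  inj {i} {j} e with Fin.<-cmp i j
  ... | tri< lt _ _ = ⊥-elim (clash lt e)
  ... | tri≈ _ eq _ = eq
  ... | tri> _ _ gt = ⊥-elim (clash gt (≡.sym e))

record Enumeration {m : ℕ} (P : Fin m → Set) (k : ℕ) : Set where
  field
    elem       : Fin k → Fin m
    valid      : ∀ j → P (elem j)
    injective  : ∀ {i j} → elem i ≡ elem j → i ≡ j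
    surjective : ∀ i → P i → Σ (Fin k) λ j → elem j ≡ i

enumerate : ∀ {m} {P : Fin m → Set} (P? : ∀ i → Dec (P i)) →
  Σ ℕ λ k → + k ≡ ∑.sum (λ i → 𝟏 (P? i)) × Enumeration P k
enumerate {zero}  P? = 0 , ≡.refl , record
  { elem = λ () ; valid = λ () ; injective = λ { {()} } ; surjective = λ () }
enumerate {suc m} P? with P? zero | enumerate (P? ∘ suc)
... | no ¬p | k , eq , e = k , ≡.trans eq (≡.sym (ℤ.+-identityˡ _)) , record
  { elem = suc ∘ elem ; valid = valid ; injective = injective ∘ Fin.suc-injective
  ; surjective = λ { zero p → ⊥-elim (¬p p) ; (suc i) p → let (j , f) = surjective i p in j , ≡.cong suc f } }
  where open Enumeration e
... | yes p | k , eq , e = suc k , ≡.trans (ℤ.pos-+ 1 k) (≡.cong (ℤ._+_ 1ℤ) eq) , record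
  { elem = λ { zero → zero ; (suc j) → suc (elem j) }
  ; valid = λ { zero → p ; (suc j) → valid j }
  ; injective = λ { {zero} {zero} _ → ≡.refl ; {suc i} {suc j} f → ≡.cong suc (injective (Fin.suc-injective f)) }
  ; surjective = λ { zero _ → zero , ≡.refl ; (suc i) p → let (j , f) = surjective i p in suc j , ≡.cong suc f } }
  where open Enumeration e

-- Names the coefficient function hidden in the definition of xⁿ-1.
xⁿ-1-tail : ∀ q n (F : FiniteField (q ℕ.^ n)) →
  let open Notions q n F in Σ (ℕ → Carrier) λ f → xⁿ-1 ≡ FiniteField.-_ F (FiniteField.1# F) ∷ applyUpTo f n
xⁿ-1-tail q n F = _ , ≡.refl

xⁿ-1-tail-last : ∀ q n F i → suc i ≡ n → proj₁ (xⁿ-1-tail q n F) i ≡ FiniteField.1# F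
xⁿ-1-tail-last q n F i e with suc i ℕ.≟ n
... | yes _ = ≡.refl
... | no ne = ⊥-elim (ne e)

xⁿ-1-tail-other : ∀ q n F i → suc i ≢ n → proj₁ (xⁿ-1-tail q n F) i ≡ FiniteField.0# F
xⁿ-1-tail-other q n F i ne with suc i ℕ.≟ n
... | yes e = ⊥-elim (ne e)
... | no _  = ≡.refl

-- The extension field as a module over the polynomials in Frobenius.

module Extension (q n : ℕ) (q≥2 : 2 ≤ q) (n≥1 : 1 ≤ n) (F : FiniteField (q ℕ.^ n))
  (^q-+ : PowerAdditive F q) where

  open FiniteField F hiding (zero)
  open FiniteFields F
  open PowersMinusOne q≥2
  open Units {M n} (≡.sym (suc-M n))
  open import Algebra.Properties.Ring (CommutativeRing.ring ring)
    using (+-cancelʳ; +-cancelˡ; -‿distribˡ-*)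
  open import Algebra.Solver.Ring.NaturalCoefficients.Default commutativeSemiring
    using (solve; _:=_; _:+_; _:*_)

  q≥1 : 1 ≤ q
  q≥1 = ℕ.≤-trans (s≤s z≤n) q≥2

  0^ : ∀ {m} → 1 ≤ m → 0# ^ m ≈ 0#
  0^ {suc m} _ = zeroˡ _

  neg-unique : ∀ {x y} → x + y ≈ 0# → y ≈ - x
  neg-unique {x} {y} e = +-cancelˡ x y (- x) (trans e (sym (-‿inverseʳ x)))

  Fixed : Carrier → Set
  Fixed x = x ^ q ≈ x

  fixed-resp : ∀ {x y} → x ≈ y → Fixed x → Fixed y
  fixed-resp e f = trans (^-congˡ q (sym e)) (trans f e)

  fixed-+ : ∀ {x y} → Fixed x → Fixed y → Fixed (x + y)
  fixed-+ f g = trans (^q-+ _ _) (+-cong f g)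

  fixed-* : ∀ {x y} → Fixed x → Fixed y → Fixed (x * y)
  fixed-* f g = trans (^-distrib-* _ _ q) (*-cong f g)

  fixed-neg : ∀ {x} → Fixed x → Fixed (- x)
  fixed-neg {x} f = neg-unique (trans (+-congʳ (sym f)) (trans (sym (^q-+ x (- x)))
    (trans (^-congˡ q (-‿inverseʳ x)) (0^ q≥1))))

  fixed-inv : ∀ {x y} → ¬ x ≈ 0# → Fixed x → x * y ≈ 1# → Fixed y
  fixed-inv {x} {y} x≉0 f e = *-cancelˡ x≉0 (trans (*-congʳ (sym f))
    (trans (sym (^-distrib-* x y q)) (trans (^-congˡ q e) (trans (1^ q) (sym e)))))

  -- The base field is the set of fixed points of Frobenius, compared by first components; a
  -- coefficient thus carries the proof that it lies in the base field.
  Fq : Set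
  Fq = Σ Carrier Fixed

  subfield : CommutativeRing 0ℓ 0ℓ
  subfield = record
    { Carrier = Fq ; _≈_ = λ a b → proj₁ a ≈ proj₁ b
    ; _+_ = λ { (a , f) (b , g) → a + b , fixed-+ f g }
    ; _*_ = λ { (a , f) (b , g) → a * b , fixed-* f g }
    ; -_ = λ { (a , f) → - a , fixed-neg f }
    ; 0# = 0# , 0^ q≥1 ; 1# = 1# , 1^ q
    ; isCommutativeRing = record
      { isRing = record
        { +-isAbelianGroup = record
          { isGroup = record
            { isMonoid = record
              { isSemigroup = record
                { isMagma = record
                  { isEquivalence = record { refl = refl ; sym = sym ; trans = trans } ; ∙-cong = +-cong }
                ; assoc = λ _ _ _ → +-assoc _ _ _ }
              ; identity = (λ _ → +-identityˡ _) , λ _ → +-identityʳ _ }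
            ; inverse = (λ _ → -‿inverseˡ _) , λ _ → -‿inverseʳ _
            ; ⁻¹-cong = -‿cong }
          ; comm = λ _ _ → +-comm _ _ }
        ; *-cong = *-cong
        ; *-assoc = λ _ _ _ → *-assoc _ _ _
        ; *-identity = (λ _ → *-identityˡ _) , λ _ → *-identityʳ _
        ; distrib = (λ _ _ _ → distribˡ _ _ _) , λ _ _ _ → distribʳ _ _ _ }
      ; *-comm = λ _ _ → *-comm _ _ } }

  Fq-field : DecidableField
  Fq-field = record
    { commutativeRing = subfield ; _≟_ = λ a b → proj₁ a ≟ proj₁ b ; 1≉0 = 1≉0
    ; inv = λ { (a , f) a≉0 → let (b , e) = inv a a≉0 in (b , fixed-inv a≉0 f e) , e } }

  module K = DecidableField Fq-field
  open FieldPolynomials Fq-field hiding (integral)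

  record Linear (φ : Carrier → Carrier) : Set where
    field
      cong  : ∀ {x y} → x ≈ y → φ x ≈ φ y
      add   : ∀ x y → φ (x + y) ≈ φ x + φ y
      scale : ∀ (a : Fq) x → φ (proj₁ a * x) ≈ proj₁ a * φ x
    φ0 : φ 0# ≈ 0#
    φ0 = trans (cong (sym (zeroˡ 0#))) (trans (scale K.0# 0#) (zeroˡ _))

  module Act (φ : Carrier → Carrier) (L : Linear φ) where
    private module L = Linear L

    -- This is p(φ) applied to x. Products of polynomials become compositions (`ev-⊛`), so
    -- divisibility and comaximality translate into statements about kernels.
    ev : Poly → Carrier → Carrier
    ev []      x = 0#
    ev (a ∷ p) x = proj₁ a * x + ev p (φ x)

    ev-cong : ∀ p {x y} → x ≈ y → ev p x ≈ ev p y
    ev-cong []      e = refl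
    ev-cong (a ∷ p) e = +-cong (*-congˡ e) (ev-cong p (L.cong e))

    ev-+ : ∀ p x y → ev p (x + y) ≈ ev p x + ev p y
    ev-+ []      x y = sym (+-identityˡ 0#)
    ev-+ (a ∷ p) x y = trans (+-cong (distribˡ _ x y) (trans (ev-cong p (L.add x y)) (ev-+ p (φ x) (φ y))))
      (solve 4 (λ a b c d → (a :+ b) :+ (c :+ d) := (a :+ c) :+ (b :+ d)) refl _ _ _ _)

    ev-scale : ∀ p (a : Fq) x → ev p (proj₁ a * x) ≈ proj₁ a * ev p x
    ev-scale []      a x = sym (zeroʳ _)
    ev-scale (b ∷ p) a x = trans (+-congˡ (trans (ev-cong p (L.scale a x)) (ev-scale p a (φ x))))
      (solve 4 (λ a b x y → b :* (a :* x) :+ a :* y := a :* (b :* x :+ y)) refl (proj₁ a) (proj₁ b) x (ev p (φ x)))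

    ev-linear : ∀ p → Linear (ev p)
    ev-linear p = record { cong = ev-cong p ; add = ev-+ p ; scale = ev-scale p }

    ev-0 : ∀ p → ev p 0# ≈ 0#
    ev-0 p = Linear.φ0 (ev-linear p)

    ev-φ : ∀ p x → ev p (φ x) ≈ φ (ev p x)
    ev-φ []      x = sym L.φ0
    ev-φ (a ∷ p) x = sym (trans (L.add _ _) (+-cong (L.scale a x) (sym (ev-φ p (φ x)))))

    ev-zero : ∀ {p} → p ≋ [] → ∀ x → ev p x ≈ 0#
    ev-zero {[]}    e x = refl
    ev-zero {a ∷ p} e x = trans (+-cong (trans (*-congʳ (at e 0)) (zeroˡ x)) (ev-zero (∷≋[]⁻ e) (φ x))) (+-identityˡ 0#)

    ev-≋ : ∀ {p r} → p ≋ r → ∀ x → ev p x ≈ ev r x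
    ev-≋ {[]}    {r}     e x = sym (ev-zero (≋.sym e) x)
    ev-≋ {a ∷ p} {[]}    e x = ev-zero e x
    ev-≋ {a ∷ p} {b ∷ r} e x = +-cong (*-congʳ (at e 0)) (ev-≋ (∷-cong⁻ e) (φ x))

    ev-⊕ : ∀ p r x → ev (p ⊕ r) x ≈ ev p x + ev r x
    ev-⊕ []      r       x = sym (+-identityˡ _)
    ev-⊕ (a ∷ p) []      x = sym (+-identityʳ _)
    ev-⊕ (a ∷ p) (b ∷ r) x = trans (+-congˡ (ev-⊕ p r (φ x)))
      (solve 5 (λ a b x y z → (a :+ b) :* x :+ (y :+ z) := (a :* x :+ y) :+ (b :* x :+ z)) refl (proj₁ a) (proj₁ b) x _ _)

    ev-· : ∀ a p x → ev (a · p) x ≈ proj₁ a * ev p x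
    ev-· a []      x = sym (zeroʳ _)
    ev-· a (b ∷ p) x = trans (+-cong (*-assoc _ _ _) (ev-· a p (φ x))) (sym (distribˡ _ _ _))

    ev-⊛ : ∀ p r x → ev (p ⊛ r) x ≈ ev p (ev r x)
    ev-⊛ []      r x = refl
    ev-⊛ (a ∷ p) r x = trans (ev-⊕ (a · r) (K.0# ∷ (p ⊛ r)) x) (+-cong (ev-· a r x)
      (trans (+-congʳ (zeroˡ x)) (trans (+-identityˡ _) (trans (ev-⊛ p r (φ x)) (ev-cong p (ev-φ r x))))))

    ev-𝟙 : ∀ x → ev 𝟙 x ≈ x
    ev-𝟙 x = trans (+-identityʳ _) (*-identityˡ x)

    ev-comax : ∀ {p r x} → Comax p r → ev p x ≈ 0# → ev r x ≈ 0# → x ≈ 0#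
    ev-comax {p} {r} {x} ⟨ a , b , e ⟩ px rx = trans (sym (ev-𝟙 x)) (trans (sym (ev-≋ e x))
      (trans (ev-⊕ (a ⊛ p) (b ⊛ r) x) (trans (+-cong (kill a p px) (kill b r rx)) (+-identityˡ 0#))))
      where
      kill : ∀ c s → ev s x ≈ 0# → ev (c ⊛ s) x ≈ 0#
      kill c s e = trans (ev-⊛ c s x) (trans (ev-cong c e) (ev-0 c))

    ev-∣ : ∀ {p r x} → p ∣ r → ev p x ≈ 0# → ev r x ≈ 0#
    ev-∣ {p} {r} {x} (s , e) px = trans (sym (ev-≋ e x)) (trans (ev-≋ (⊛-comm p s) x)
      (trans (ev-⊛ s p x) (trans (ev-cong s px) (ev-0 s))))

  iterate : (Carrier → Carrier) → ℕ → Carrier → Carrier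
  iterate φ zero    x = x
  iterate φ (suc m) x = iterate φ m (φ x)

  monomial : ℕ → Poly
  monomial m = replicate m K.0# ++ 𝟙

  coeff-monomial : ∀ m → coeff (monomial m) m K.≈ K.1#
  coeff-monomial zero    = refl
  coeff-monomial (suc m) = coeff-monomial m

  coeff-monomial-≢ : ∀ m i → i ≢ m → coeff (monomial m) i K.≈ K.0#
  coeff-monomial-≢ zero    zero    ne = ⊥-elim (ne ≡.refl)
  coeff-monomial-≢ zero    (suc i) ne = refl
  coeff-monomial-≢ (suc m) zero    ne = refl
  coeff-monomial-≢ (suc m) (suc i) ne = coeff-monomial-≢ m i (ne ∘ ≡.cong suc)

  X^n-1 : Poly
  X^n-1 = monomial n ⊕ (⊖ 𝟙)

  X^n-1-monic : Monic n X^n-1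
  X^n-1-monic = (λ i lt → trans (coeff-⊕ (monomial n) (⊖ 𝟙) i) (trans (+-cong (coeff-monomial-≢ n i (λ { ≡.refl → ℕ.n≮n _ lt }))
      (above i (ℕ.<-trans n≥1 lt))) (+-identityˡ 0#))) ,
    trans (coeff-⊕ (monomial n) (⊖ 𝟙) n) (trans (+-cong (coeff-monomial n) (above n n≥1)) (+-identityʳ 1#))
    where
    above : ∀ i → 1 ≤ i → coeff (⊖ 𝟙) i K.≈ K.0#
    above (suc i) _ = refl

  module _ (φ : Carrier → Carrier) (L : Linear φ) where
    open Act φ L

    ev-monomial : ∀ m x → ev (monomial m) x ≈ iterate φ m x
    ev-monomial zero    x = ev-𝟙 x
    ev-monomial (suc m) x = trans (+-congʳ (zeroˡ x)) (trans (+-identityˡ _) (ev-monomial m (φ x)))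

    ev-X^n-1 : (∀ x → iterate φ n x ≈ x) → ∀ x → ev X^n-1 x ≈ 0#
    ev-X^n-1 per x = trans (ev-⊕ (monomial n) (⊖ 𝟙) x) (trans (+-cong (trans (ev-monomial n x) (per x))
      (trans (+-identityʳ _) (trans (sym (-‿distribˡ-* 1# x)) (-‿cong (*-identityˡ x))))) (-‿inverseʳ x))

  -- The Frobenius σ, its inverse τ, and the trace λ

  σ τ : Carrier → Carrier
  σ x = x ^ q
  τ x = x ^ (q ℕ.^ (n ℕ.∸ 1))

  ^q^-+ : ∀ k x y → (x + y) ^ (q ℕ.^ k) ≈ x ^ (q ℕ.^ k) + y ^ (q ℕ.^ k)
  ^q^-+ zero    x y = distribʳ 1# x y
  ^q^-+ (suc k) x y = trans (sym (^-assocʳ (x + y) q (q ℕ.^ k))) (trans (^-congˡ (q ℕ.^ k) (^q-+ x y))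
    (trans (^q^-+ k (x ^ q) (y ^ q)) (+-cong (^-assocʳ x q (q ℕ.^ k)) (^-assocʳ y q (q ℕ.^ k)))))

  fixed-^ : ∀ {a} → Fixed a → ∀ k → a ^ (q ℕ.^ k) ≈ a
  fixed-^ {a} f zero    = *-identityʳ a
  fixed-^ {a} f (suc k) = trans (sym (^-assocʳ a q (q ℕ.^ k))) (trans (^-congˡ (q ℕ.^ k) f) (fixed-^ f k))

  ^q^-linear : ∀ k → Linear (_^ (q ℕ.^ k))
  ^q^-linear k = record
    { cong = ^-congˡ (q ℕ.^ k) ; add = ^q^-+ k
    ; scale = λ { (a , f) x → trans (^-distrib-* a x (q ℕ.^ k)) (*-congʳ (fixed-^ f k)) } }

  σ-linear : Linear σ
  σ-linear = record
    { cong = ^-congˡ q ; add = ^q-+ ; scale = λ { (a , f) x → trans (^-distrib-* a x q) (*-congʳ f) } }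

  τ-linear : Linear τ
  τ-linear = ^q^-linear (n ℕ.∸ 1)

  module S = Act σ σ-linear
  module T = Act τ τ-linear

  iterate-σ : ∀ k x → iterate σ k x ≈ x ^ (q ℕ.^ k)
  iterate-σ zero    x = sym (*-identityʳ x)
  iterate-σ (suc k) x = trans (iterate-σ k (x ^ q)) (^-assocʳ x q (q ℕ.^ k))

  σ-period : ∀ x → iterate σ n x ≈ x
  σ-period x = trans (iterate-σ n x) (^N x)

  n≡suc : suc (n ℕ.∸ 1) ≡ n
  n≡suc = ℕ.m+[n∸m]≡n n≥1

  στ : ∀ x → σ (τ x) ≈ x
  στ x = trans (^-assocʳ x (q ℕ.^ (n ℕ.∸ 1)) q) (≡.subst (λ k → x ^ k ≈ x) (≡.trans (≡.cong (q ℕ.^_) (≡.sym n≡suc)) (ℕ.*-comm q _)) (^N x))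

  iterate-cong : ∀ {φ} → Linear φ → ∀ k {x y} → x ≈ y → iterate φ k x ≈ iterate φ k y
  iterate-cong L zero    e = e
  iterate-cong L (suc k) e = iterate-cong L k (Linear.cong L e)

  iterate-suc : ∀ φ k x → iterate φ (suc k) x ≡ φ (iterate φ k x)
  iterate-suc φ zero    x = ≡.refl
  iterate-suc φ (suc k) x = iterate-suc φ k (φ x)

  τ-period : ∀ x → iterate τ n x ≈ x
  τ-period x = trans (sym (σ-period (iterate τ n x))) (undo n x)
    where
    undo : ∀ k x → iterate σ k (iterate τ k x) ≈ x
    undo zero    x = refl
    undo (suc k) x = trans (iterate-cong σ-linear k (trans (^-congˡ q (reflexive (iterate-suc τ k x))) (στ _))) (undo k x)

  λ-poly : Poly
  λ-poly = replicate n K.1#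

  λᶠ : Carrier → Carrier
  λᶠ = S.ev λ-poly

  λ-linear : Linear λᶠ
  λ-linear = S.ev-linear λ-poly
  module λ-linear = Linear λ-linear

  λ-σ : ∀ x → λᶠ (σ x) ≈ λᶠ x
  λ-σ x = +-cancelʳ x _ _ (trans (shift n x) (+-congˡ (σ-period x)))
    where
    -- Telescoping, with the first term moved across in place of a subtraction.
    shift : ∀ k x → S.ev (replicate k K.1#) (σ x) + x ≈ S.ev (replicate k K.1#) x + iterate σ k x
    shift zero    x = refl
    shift (suc k) x = trans (+-congʳ (+-congʳ (*-identityˡ _))) (trans
      (solve 3 (λ s t x → (s :+ t) :+ x := (t :+ s) :+ x) refl (σ x) (S.ev (replicate k K.1#) (σ (σ x))) x)
      (trans (+-congʳ (shift k (σ x))) (trans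
      (solve 3 (λ a b x → (a :+ b) :+ x := (x :+ a) :+ b) refl _ _ x) (+-congʳ (+-congʳ (sym (*-identityˡ x)))))))

  λ-fixed : ∀ x → Fixed (λᶠ x)
  λ-fixed x = trans (sym (S.ev-φ λ-poly x)) (λ-σ x)

  -- The trace is σ-invariant, so Tr(u·σx) = Tr(σ(τu·x)) = Tr(τu·x): σ and τ are adjoint for the
  -- trace form, and so are p(σ) and p(τ).
  adjoint : ∀ p u x → λᶠ (u * S.ev p x) ≈ λᶠ (T.ev p u * x)
  adjoint []      u x = λ-linear.cong (trans (zeroʳ u) (sym (zeroˡ x)))
  adjoint (a ∷ p) u x = trans (λ-linear.cong (distribˡ u _ _)) (trans (λ-linear.add _ _)
    (trans (+-congˡ (trans (adjoint p u (σ x)) (trans (λ-linear.cong move) (λ-σ _))))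
    (trans (sym (λ-linear.add _ _)) (λ-linear.cong
      (solve 4 (λ u a x t → u :* (a :* x) :+ t :* x := (a :* u :+ t) :* x) refl u (proj₁ a) x (T.ev p (τ u)))))))
    where
    move : T.ev p u * σ x ≈ σ (T.ev p (τ u) * x)
    move = trans (*-congʳ (sym (trans (^-congˡ q (T.ev-φ p u)) (στ _)))) (sym (^-distrib-* _ x q))

  -- p(σ)x is a linearised polynomial of degree q^e in x; k records how many times σ has already
  -- been applied in the recursion.
  polyFun-ev : ∀ k {e} p → HasDeg e p →
    PolyFun (q ℕ.^ (k ℕ.+ e)) (proj₁ (coeff p e)) (λ x → S.ev p (x ^ (q ℕ.^ k)))
  polyFun-ev k {e} [] (_ , l) = ⊥-elim (l refl)
  polyFun-ev k {zero} (a ∷ p) (b , l) = ≡.subst (λ d → PolyFun (q ℕ.^ d) (proj₁ a) (λ x → S.ev (a ∷ p) (x ^ (q ℕ.^ k)))) (≡.sym (ℕ.+-identityʳ k))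
    (polyFun-resp (q ℕ.^ k) (*-identityʳ _) (λ x → sym (trans (+-congˡ (S.ev-zero {p} (mk λ i → b (suc i) (s≤s z≤n)) _)) (+-identityʳ _)))
      (polyFun-scale (q ℕ.^ k) (proj₁ a) (polyFun-^ (q ℕ.^ k))))
  polyFun-ev k {suc e} (a ∷ p) (b , l) = ≡.subst (λ d → PolyFun (q ℕ.^ d) (proj₁ (coeff p e)) (λ x → S.ev (a ∷ p) (x ^ (q ℕ.^ k)))) (≡.sym (ℕ.+-suc k e))
    (polyFun-resp (q ℕ.^ (suc k ℕ.+ e)) refl
      (λ x → +-congˡ (S.ev-cong p (trans (^-≡ x (ℕ.*-comm q (q ℕ.^ k))) (sym (^-assocʳ x (q ℕ.^ k) q)))))
      (polyFun-+< (ℕ.^-monoʳ-< q q≥2 (s≤s (ℕ.m≤m+n k e)))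
        (polyFun-scale (q ℕ.^ k) (proj₁ a) (polyFun-^ (q ℕ.^ k)))
        (polyFun-ev (suc k) p ((λ i lt → b (suc i) (s≤s lt)) , l))))

  -- Otherwise a polynomial function of degree q^e would have q^n > q^e roots.
  ev-nonzero : ∀ {e} p → HasDeg e p → e < n → Σ Carrier λ x → ¬ S.ev p x ≈ 0#
  ev-nonzero {e} p hp e<n with exists? (λ x → ¬? (S.ev p x ≟ 0#)) (λ eq nz z → nz (trans (S.ev-cong p eq) z))
  ... | yes found = found
  ... | no none = ⊥-elim (ℕ.<⇒≱ (ℕ.^-monoʳ-< q q≥2 e<n) (ℤ.drop‿+≤+ (ℤ.≤-trans (ℤ.≤-reflexive (≡.sym
      (≡.trans (∑ᶠ-cong {λ x → 𝟏 (S.ev p (x ^ 1) ≟ 0#)} {λ _ → 1ℤ} (λ x → 𝟏-yes (S.ev p (x ^ 1) ≟ 0#) (all x)))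
        (≡.trans (∑ᶠ-const 1ℤ) (ℤ.*-identityʳ _)))))
      (root-bound (q ℕ.^ e) (HasDeg.lead≉ hp) (polyFun-ev 0 p hp)))))
    where
    all : ∀ x → S.ev p (x ^ 1) ≈ 0#
    all x with S.ev p (x ^ 1) ≟ 0#
    ... | yes z = z
    ... | no nz = ⊥-elim (none (_ , nz))

  -- The trace polynomial has degree n-1 < n, so the trace is nonzero at some z; rescaling z by the
  -- inverse c of its trace and dividing by y gives v.
  λ-onto : ∀ {y} → ¬ y ≈ 0# → Σ Carrier λ v → λᶠ (v * y) ≈ 1#
  λ-onto {y} y≉0 with ev-nonzero λ-poly (λ-hasDeg n n≥1) (ℕ.≤-reflexive n≡suc)
    where
    λ-hasDeg : ∀ k → 1 ≤ k → HasDeg (k ℕ.∸ 1) (replicate k K.1#)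
    λ-hasDeg (suc zero)    _ = (λ { (suc i) _ → refl }) , 1≉0
    λ-hasDeg (suc (suc k)) _ with λ-hasDeg (suc k) (s≤s z≤n)
    ... | b , l = (λ { (suc i) (s≤s lt) → b i lt }) , l
  ... | z , λz≉0 with inv (λᶠ z) λz≉0 | inv y y≉0
  ...   | c , λzc | w , yw = c * z * w , trans (λ-linear.cong (trans (*-assoc _ w y)
            (trans (*-congˡ (trans (*-comm w y) yw)) (*-identityʳ _))))
            (trans (λ-linear.scale (c , fixed-inv λz≉0 (λ-fixed z) λzc) z) (trans (*-comm c _) λzc))

  -- The second moment

  open import Data.Integer using (∣_∣)

  -- The integer-valued stand-in for a nontrivial additive character: products of
  -- characters are replaced by the translation c in ∑ w E(ux + c) = P(x) E(c).
  E : Carrier → ℤ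
  E x = 𝟏 (λᶠ x ≟ 0#) ℤ.+ -1ℤ ℤ.* 𝟏 (λᶠ x ≟ 1#)

  E-λ : ∀ {x y} → λᶠ x ≈ λᶠ y → E x ≡ E y
  E-λ {x} {y} e = ≡.cong₂ (λ s t → s ℤ.+ -1ℤ ℤ.* t)
    (𝟏-cong (λᶠ x ≟ 0#) (λᶠ y ≟ 0#) (trans (sym e)) (trans e))
    (𝟏-cong (λᶠ x ≟ 1#) (λᶠ y ≟ 1#) (trans (sym e)) (trans e))

  E-cong : ∀ {x y} → x ≈ y → E x ≡ E y
  E-cong e = E-λ (λ-linear.cong e)

  E0 : E 0# ≡ 1ℤ
  E0 = ≡.cong₂ (λ s t → s ℤ.+ -1ℤ ℤ.* t) (𝟏-yes (λᶠ 0# ≟ 0#) λ-linear.φ0)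
    (𝟏-no (λᶠ 0# ≟ 1#) (λ e → 1≉0 (trans (sym e) λ-linear.φ0)))

  -- Translating x by v raises the trace by 1, so the level sets at 0 and at 1 have the same size
  -- and cancel in E. The additive map ℓ is general because it is applied to x ↦ w·x and to x ↦
  -- s(τ)x·y.
  ∑E-vanishes : ∀ (ℓ : Carrier → Carrier) → (∀ {x y} → x ≈ y → ℓ x ≈ ℓ y) →
    (∀ x y → ℓ (x + y) ≈ ℓ x + ℓ y) → ∀ v → λᶠ (ℓ v) ≈ 1# → ∀ c →
    ∑ᶠ (λ x → E (ℓ x + c)) ≡ 0ℤ
  ∑E-vanishes ℓ ℓ-cong ℓ-+ v λv≈1 c = ≡.trans (∑ᶠ-+ f (λ x → -1ℤ ℤ.* g x))
    (≡.trans (≡.cong₂ ℤ._+_ f≡g (∑ᶠ-* -1ℤ g)) (lem (∑ᶠ g)))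
    where
    f g : Carrier → ℤ
    f x = 𝟏 (λᶠ (ℓ x + c) ≟ 0#)
    g x = 𝟏 (λᶠ (ℓ x + c) ≟ 1#)
    lem : ∀ i → i ℤ.+ -1ℤ ℤ.* i ≡ 0ℤ
    lem i = ≡.trans (≡.cong (ℤ._+_ i) (ℤ.-1*i≡-i i)) (ℤ.+-inverseʳ i)
    g-cong : Respects g
    g-cong {x} {y} e = 𝟏-cong (λᶠ (ℓ x + c) ≟ 1#) (λᶠ (ℓ y + c) ≟ 1#) (trans (sym e′)) (trans e′)
      where
      e′ : λᶠ (ℓ x + c) ≈ λᶠ (ℓ y + c)
      e′ = λ-linear.cong (+-congʳ (ℓ-cong e))
    shift : ∀ x → λᶠ (ℓ (x + v) + c) ≈ λᶠ (ℓ x + c) + 1#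
    shift x = trans (λ-linear.cong (trans (+-congʳ (ℓ-+ x v)) (trans (+-assoc _ _ _) (trans (+-congˡ (+-comm _ c)) (sym (+-assoc _ _ _))))))
      (trans (λ-linear.add (ℓ x + c) (ℓ v)) (+-congˡ λv≈1))
    f≡g : ∑ᶠ f ≡ ∑ᶠ g
    f≡g = ≡.trans (∑ᶠ-cong {f} {g ∘ (_+ v)} (λ x → 𝟏-cong (λᶠ (ℓ x + c) ≟ 0#) (λᶠ (ℓ (x + v) + c) ≟ 1#)
        (λ e → trans (shift x) (trans (+-congʳ e) (+-identityˡ 1#)))
        (λ e → +-cancelʳ 1# _ _ (trans (sym (shift x)) (trans e (sym (+-identityˡ 1#)))))))
      (≡.sym (∑ᶠ-reindex {g} g-cong (+-bijection v)))

  Q : ℤ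
  Q = + (q ℕ.^ n)

  ∑E : ∀ w → ∑ᶠ (λ x → E (w * x)) ≡ Q ℤ.* 𝟏 (w ≟ 0#)
  ∑E w with w ≟ 0#
  ... | yes z = ≡.trans (∑ᶠ-cong {λ x → E (w * x)} {λ _ → 1ℤ} (λ x → ≡.trans (E-cong (trans (*-congʳ z) (zeroˡ x))) E0)) (∑ᶠ-const 1ℤ)
  ... | no nz with λ-onto nz
  ...   | v , λvw = ≡.trans (∑ᶠ-cong {λ x → E (w * x)} {λ x → E (w * x + 0#)} (λ x → E-cong (sym (+-identityʳ _))))
            (≡.trans (∑E-vanishes (w *_) *-congˡ (distribˡ w) v (trans (λ-linear.cong (*-comm w v)) λvw) 0#) (≡.sym (ℤ.*-zeroʳ Q)))

  -- A finitely supported integer measure on frequencies. Entries with equal frequency are not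
  -- merged, so `norm` adds absolute values with repetition.
  Weights : Set
  Weights = List (ℤ × Carrier)

  LS : Weights → (Carrier → ℤ) → ℤ
  LS []             g = 0ℤ
  LS ((w , u) ∷ ws) g = w ℤ.* g u ℤ.+ LS ws g

  norm : Weights → ℕ
  norm []             = 0
  norm ((w , u) ∷ ws) = ∣ w ∣ ℕ.+ norm ws

  LS-cong : ∀ ws {g h : Carrier → ℤ} → (∀ u → g u ≡ h u) → LS ws g ≡ LS ws h
  LS-cong []             e = ≡.refl
  LS-cong ((w , u) ∷ ws) e = ≡.cong₂ (λ s t → w ℤ.* s ℤ.+ t) (e u) (LS-cong ws e)

  LS-* : ∀ ws c g → c ℤ.* LS ws g ≡ LS ws (λ u → c ℤ.* g u)
  LS-* []             c g = ℤ.*-zeroʳ c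
  LS-* ((w , u) ∷ ws) c g = ≡.trans (lem c w (g u) (LS ws g)) (≡.cong (ℤ._+_ (w ℤ.* (c ℤ.* g u))) (LS-* ws c g))
    where
    lem : ∀ c w g s → c ℤ.* (w ℤ.* g ℤ.+ s) ≡ w ℤ.* (c ℤ.* g) ℤ.+ c ℤ.* s
    lem = ℤ.solve-∀

  LS-∑ : ∀ ws (g : Carrier → Carrier → ℤ) → ∑ᶠ (λ x → LS ws (g x)) ≡ LS ws (λ u → ∑ᶠ (λ x → g x u))
  LS-∑ []             g = ≡.trans (∑ᶠ-const 0ℤ) (ℤ.*-zeroʳ Q)
  LS-∑ ((w , u) ∷ ws) g = ≡.trans (∑ᶠ-+ (λ x → w ℤ.* g x u) (λ x → LS ws (g x)))
    (≡.cong₂ ℤ._+_ (∑ᶠ-* w (λ x → g x u)) (LS-∑ ws g))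

  LS-bound : ∀ {ws g b} → All (λ wu → ∣ g (proj₂ wu) ∣ ≤ b) ws → ∣ LS ws g ∣ ≤ norm ws ℕ.* b
  LS-bound {[]}           []       = z≤n
  LS-bound {(w , u) ∷ ws} {g} {b} (h ∷ hs) = ℕ.≤-trans (ℤ.∣i+j∣≤∣i∣+∣j∣ (w ℤ.* g u) (LS ws g))
    (ℕ.≤-trans (ℕ.+-mono-≤ (ℕ.≤-trans (ℕ.≤-reflexive (ℤ.abs-* w (g u))) (ℕ.*-monoʳ-≤ ∣ w ∣ h)) (LS-bound hs))
      (ℕ.≤-reflexive (≡.sym (ℕ.*-distribʳ-+ b ∣ w ∣ (norm ws)))))

  Transform : Weights → (Carrier → ℤ) → Set
  Transform ws P = ∀ x c → LS ws (λ u → E (u * x + c)) ≡ P x ℤ.* E c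

  square : ℤ → ℤ
  square i = i ℤ.* i

  0≤square : ∀ i → 0ℤ ℤ.≤ square i
  0≤square (+ m)     = ℤ.≤-trans (ℤ.+≤+ z≤n) (ℤ.≤-reflexive (ℤ.pos-* m m))
  0≤square ℤ.-[1+ m ] = ℤ.+≤+ z≤n

  module _ {D : ℕ} (#H : # (λ x → (x ^ D) ≟ 1#) ≡ + D)
    {ws : Weights} {R : Carrier → ℤ} (tr : Transform ws R)
    (nonzero : All (λ wu → ¬ proj₂ wu ≈ 0#) ws)
    {α : Carrier} (α≉0 : ¬ α ≈ 0#) {f₀ : ℤ}
    (R-on-coset : ∀ h → h ^ D ≈ 1# → R (α * h) ≡ f₀) where

    private
      H : Carrier → ℤ
      H x = 𝟏 ((x ^ D) ≟ 1#)

      R-LS : ∀ x → R x ≡ LS ws (λ u → E (u * x + 0#))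
      R-LS x = ≡.sym (≡.trans (tr x 0#) (≡.trans (≡.cong (ℤ._*_ (R x)) E0) (ℤ.*-identityʳ _)))

      R-cong : Respects R
      R-cong {x} {y} e = ≡.trans (R-LS x) (≡.trans (LS-cong ws (λ u → E-cong (+-congʳ (*-congˡ e)))) (≡.sym (R-LS y)))

      T : Carrier → ℤ
      T β = ∑ᶠ (λ h → H h ℤ.* R (β * h))

      T-cong : Respects T
      T-cong {x} {y} e = ∑ᶠ-cong {λ h → H h ℤ.* R (x * h)} {λ h → H h ℤ.* R (y * h)}
        (λ h → ≡.cong (ℤ._*_ (H h)) (R-cong {x * h} {y * h} (*-congʳ e)))

      H-≤ : ∀ h {i j} → (h ^ D ≈ 1# → i ℤ.≤ j) → H h ℤ.* i ℤ.≤ H h ℤ.* j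
      H-≤ h {i} {j} le with (h ^ D) ≟ 1#
      ... | yes e = ℤ.*-monoˡ-≤-nonNeg 1ℤ (le e)
      ... | no _  = ℤ.≤-refl

      H-≡ : ∀ h {i j} → (h ^ D ≈ 1# → i ≡ j) → H h ℤ.* i ≡ H h ℤ.* j
      H-≡ h {i} {j} eq with (h ^ D) ≟ 1#
      ... | yes e = ≡.cong (ℤ._*_ 1ℤ) (eq e)
      ... | no _  = ≡.refl

      T-on-coset : ∀ g → g ^ D ≈ 1# → T (α * g) ≡ f₀ ℤ.* + D
      T-on-coset g gD = ≡.trans (∑ᶠ-cong {λ h → H h ℤ.* R (α * g * h)} {λ h → f₀ ℤ.* H h} (λ h → ≡.trans (H-≡ h (λ hD →
          ≡.trans (R-cong (*-assoc α g h)) (R-on-coset (g * h) (trans (^-distrib-* g h D) (trans (*-cong gD hD) (*-identityˡ 1#))))))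
            (ℤ.*-comm (H h) f₀)))
        (≡.trans (∑ᶠ-* f₀ H) (≡.cong (ℤ._*_ f₀) #H))

      lower : + D ℤ.* square (f₀ ℤ.* + D) ℤ.≤ ∑ᶠ (λ β → square (T β))
      -- Substituting β = αg turns the points of the coset into g ∈ H; the other squares are only
      -- bounded below by 0.
      lower = ℤ.≤-trans (ℤ.≤-reflexive (≡.trans (≡.trans (≡.cong (ℤ._* square (f₀ ℤ.* + D)) (≡.sym #H)) (ℤ.*-comm (∑ᶠ H) _))
          (≡.sym (∑ᶠ-* (square (f₀ ℤ.* + D)) H))))
        (ℤ.≤-trans (∑ᶠ-mono {λ g → square (f₀ ℤ.* + D) ℤ.* H g} {λ g → square (T (α * g))} pointwise)
        (ℤ.≤-reflexive (≡.sym (∑ᶠ-reindex {λ β → square (T β)} (λ e → ≡.cong square (T-cong e)) (*-bijection α≉0)))))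
        where
        pointwise : ∀ g → square (f₀ ℤ.* + D) ℤ.* H g ℤ.≤ square (T (α * g))
        pointwise g with (g ^ D) ≟ 1#
        ... | yes gD = ℤ.≤-reflexive (≡.trans (ℤ.*-identityʳ _) (≡.cong square (≡.sym (T-on-coset g gD))))
        ... | no _   = ℤ.≤-trans (ℤ.≤-reflexive (ℤ.*-zeroʳ (square (f₀ ℤ.* + D)))) (0≤square (T (α * g)))

      Kβ : Carrier → Carrier → Carrier → ℤ
      Kβ u v β = ∑ᶠ (λ h → ∑ᶠ (λ h′ → H h ℤ.* (H h′ ℤ.* E (u * (β * h) + (v * (β * h′) + 0#)))))

      -- R(y) is expanded first; the transform of R(x) is then read with translation v·y. This
      -- yields the joint frequency u·x + v·y although E is not multiplicative.
      RR : ∀ x y → R x ℤ.* R y ≡ LS ws (λ v → LS ws (λ u → E (u * x + (v * y + 0#))))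
      RR x y = ≡.trans (≡.cong (ℤ._*_ (R x)) (R-LS y)) (≡.trans (LS-* ws (R x) _)
        (LS-cong ws (λ v → ≡.sym (tr x (v * y + 0#)))))

      LS₂ : (Carrier → Carrier → ℤ) → ℤ
      LS₂ k = LS ws (λ v → LS ws (λ u → k u v))

      LS₂-∑ : ∀ (k : Carrier → Carrier → Carrier → ℤ) → ∑ᶠ (λ x → LS₂ (k x)) ≡ LS₂ (λ u v → ∑ᶠ (λ x → k x u v))
      LS₂-∑ k = ≡.trans (LS-∑ ws (λ x v → LS ws (λ u → k x u v))) (LS-cong ws (λ v → LS-∑ ws (λ x u → k x u v)))

      LS₂-* : ∀ c k → c ℤ.* LS₂ k ≡ LS₂ (λ u v → c ℤ.* k u v)
      LS₂-* c k = ≡.trans (LS-* ws c _) (LS-cong ws (λ v → LS-* ws c (λ u → k u v)))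

      T² : ∀ β → square (T β) ≡ LS₂ (λ u v → Kβ u v β)
      T² β = ≡.trans (≡.sym (∑ᶠ-* (T β) f)) (≡.trans (∑ᶠ-cong step) (LS₂-∑ (λ h u v → ∑ᶠ (λ h′ → k h h′ u v))))
        where
        f : Carrier → ℤ
        f h = H h ℤ.* R (β * h)
        k : Carrier → Carrier → Carrier → Carrier → ℤ
        k h h′ u v = H h ℤ.* (H h′ ℤ.* E (u * (β * h) + (v * (β * h′) + 0#)))
        step : ∀ h → T β ℤ.* f h ≡ LS₂ (λ u v → ∑ᶠ (λ h′ → k h h′ u v))
        step h = ≡.trans (ℤ.*-comm (T β) (f h)) (≡.trans (≡.sym (∑ᶠ-* (f h) f)) (≡.trans (∑ᶠ-cong inner) (LS₂-∑ (λ h′ u v → k h h′ u v))))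
          where
          swap : ∀ a b c d → a ℤ.* b ℤ.* (c ℤ.* d) ≡ a ℤ.* (c ℤ.* (b ℤ.* d))
          swap = ℤ.solve-∀
          inner : ∀ h′ → f h ℤ.* f h′ ≡ LS₂ (λ u v → k h h′ u v)
          inner h′ = ≡.trans (swap (H h) (R (β * h)) (H h′) (R (β * h′)))
            (≡.trans (≡.cong (λ z → H h ℤ.* (H h′ ℤ.* z)) (RR (β * h) (β * h′)))
            (≡.trans (≡.cong (ℤ._*_ (H h)) (LS₂-* (H h′) _)) (LS₂-* (H h) _)))

      -- The value of the sum of `Kβ` over β after orthogonality: Q times the number of pairs h, h′
      -- in H with uh + vh′ = 0.
      K : Carrier → Carrier → ℤ
      K u v = ∑ᶠ (λ h → H h ℤ.* ∑ᶠ (λ h′ → H h′ ℤ.* (Q ℤ.* 𝟏 ((u * h + v * h′) ≟ 0#))))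

      ∑Kβ : ∀ u v → ∑ᶠ (Kβ u v) ≡ K u v
      ∑Kβ u v = ≡.trans (∑ᶠ-comm (λ β h → ∑ᶠ (λ h′ → k β h h′))) (∑ᶠ-cong (λ h →
          ≡.trans (∑ᶠ-comm (λ β h′ → k β h h′)) (≡.trans (∑ᶠ-cong (λ h′ →
            ≡.trans (∑ᶠ-* (H h) (λ β → H h′ ℤ.* e β h h′)) (≡.cong (ℤ._*_ (H h)) (≡.trans (∑ᶠ-* (H h′) (λ β → e β h h′))
              (≡.cong (ℤ._*_ (H h′)) (≡.trans (∑ᶠ-cong (λ β → E-cong (collect β h h′))) (∑E (u * h + v * h′))))))))
            (∑ᶠ-* (H h) (λ h′ → H h′ ℤ.* (Q ℤ.* 𝟏 ((u * h + v * h′) ≟ 0#)))))))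
        where
        e k : Carrier → Carrier → Carrier → ℤ
        e β h h′ = E (u * (β * h) + (v * (β * h′) + 0#))
        k β h h′ = H h ℤ.* (H h′ ℤ.* e β h h′)
        collect : ∀ β h h′ → u * (β * h) + (v * (β * h′) + 0#) ≈ (u * h + v * h′) * β
        collect β h h′ = trans (+-congˡ (+-identityʳ _))
          (solve 5 (λ u v β h h′ → u :* (β :* h) :+ v :* (β :* h′) := (u :* h :+ v :* h′) :* β) refl u v β h h′)

      K≥0 : ∀ u v → 0ℤ ℤ.≤ K u v
      K≥0 u v = ∑ᶠ≥0 (λ h → 𝟏*≥0 ((h ^ D) ≟ 1#) (∑ᶠ≥0 (λ h′ → 𝟏*≥0 ((h′ ^ D) ≟ 1#)
          (ℤ.≤-trans (ℤ.≤-reflexive (≡.sym (ℤ.*-zeroʳ Q))) (ℤ.*-monoˡ-≤-nonNeg Q (0≤𝟏 ((u * h + v * h′) ≟ 0#)))))))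
        where
        ∑ᶠ≥0 : ∀ {f : Carrier → ℤ} → (∀ x → 0ℤ ℤ.≤ f x) → 0ℤ ℤ.≤ ∑ᶠ f
        ∑ᶠ≥0 h = ℤ.≤-trans (ℤ.≤-reflexive (≡.sym (≡.trans (∑ᶠ-const 0ℤ) (ℤ.*-zeroʳ Q)))) (∑ᶠ-mono h)
        𝟏*≥0 : ∀ {A : Set} (d : Dec A) {i} → 0ℤ ℤ.≤ i → 0ℤ ℤ.≤ 𝟏 d ℤ.* i
        𝟏*≥0 (yes _) le = ℤ.≤-trans le (ℤ.≤-reflexive (≡.sym (ℤ.*-identityˡ _)))
        𝟏*≥0 (no _)  le = ℤ.≤-refl

      #-solution≤1 : ∀ {v} → ¬ v ≈ 0# → ∀ y → # (λ x → (y + v * x) ≟ 0#) ℤ.≤ 1ℤ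
      #-solution≤1 {v} v≉0 y with inv v v≉0
      ... | w , vw = ℤ.≤-trans (∑ᶠ-mono (λ x → ℤ.≤-reflexive (𝟏-cong ((y + v * x) ≟ 0#) (x ≟ (w * (- y))) (to x) (from x))))
                       (ℤ.≤-reflexive (#-single (w * (- y))))
        where
        vw- : v * (w * (- y)) ≈ - y
        vw- = trans (sym (*-assoc v w _)) (trans (*-congʳ vw) (*-identityˡ _))
        to : ∀ x → y + v * x ≈ 0# → x ≈ w * (- y)
        to x e = *-cancelˡ v≉0 (trans (neg-unique e) (sym vw-))
        from : ∀ x → x ≈ w * (- y) → y + v * x ≈ 0#
        from x e = trans (+-congˡ (trans (*-congˡ e) vw-)) (-‿inverseʳ y)

      -- A nonzero v determines h′ from h, so each of the D values of h contributes at most Q.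
      K≤ : ∀ u {v} → ¬ v ≈ 0# → K u v ℤ.≤ Q ℤ.* + D
      K≤ u {v} v≉0 = ℤ.≤-trans (∑ᶠ-mono {g = λ h → Q ℤ.* H h} (λ h → ℤ.≤-trans (H-≤ h (λ _ → inner h)) (ℤ.≤-reflexive (ℤ.*-comm (H h) Q))))
        (ℤ.≤-reflexive (≡.trans (∑ᶠ-* Q H) (≡.cong (ℤ._*_ Q) #H)))
        where
        inner : ∀ h → ∑ᶠ (λ h′ → H h′ ℤ.* (Q ℤ.* 𝟏 ((u * h + v * h′) ≟ 0#))) ℤ.≤ Q
        inner h = ℤ.≤-trans (∑ᶠ-mono {g = λ h′ → Q ℤ.* 𝟏 ((u * h + v * h′) ≟ 0#)} (λ h′ → drop ((h′ ^ D) ≟ 1#) ((u * h + v * h′) ≟ 0#)))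
          (ℤ.≤-trans (ℤ.≤-reflexive (∑ᶠ-* Q (λ h′ → 𝟏 ((u * h + v * h′) ≟ 0#))))
            (ℤ.≤-trans (ℤ.*-monoˡ-≤-nonNeg Q (#-solution≤1 v≉0 (u * h))) (ℤ.≤-reflexive (ℤ.*-identityʳ Q))))
          where
          drop : ∀ {A B : Set} (d : Dec A) (e : Dec B) → 𝟏 d ℤ.* (Q ℤ.* 𝟏 e) ℤ.≤ Q ℤ.* 𝟏 e
          drop (yes _) e = ℤ.≤-reflexive (ℤ.*-identityˡ _)
          drop (no _)  e = ℤ.≤-trans (ℤ.≤-reflexive (≡.sym (ℤ.*-zeroʳ Q))) (ℤ.*-monoˡ-≤-nonNeg Q (0≤𝟏 e))

      ∣K∣≤ : ∀ u {v} → ¬ v ≈ 0# → ∣ K u v ∣ ≤ q ℕ.^ n ℕ.* D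
      ∣K∣≤ u {v} v≉0 = ℤ.drop‿+≤+ (ℤ.≤-trans (ℤ.≤-reflexive (ℤ.0≤i⇒+∣i∣≡i (K≥0 u v)))
        (ℤ.≤-trans (K≤ u v≉0) (ℤ.≤-reflexive (≡.sym (ℤ.pos-* (q ℕ.^ n) D)))))

      upper : ∣ ∑ᶠ (λ β → square (T β)) ∣ ≤ norm ws ℕ.* (norm ws ℕ.* (q ℕ.^ n ℕ.* D))
      upper = ≡.subst (λ z → ∣ z ∣ ≤ norm ws ℕ.* (norm ws ℕ.* (q ℕ.^ n ℕ.* D)))
        (≡.sym (≡.trans (∑ᶠ-cong T²) (≡.trans (LS₂-∑ (λ β u v → Kβ u v β)) (LS-cong ws (λ v → LS-cong ws (λ u → ∑Kβ u v))))))
        (LS-bound (All.map (λ v≉0 → LS-bound (All.universal (λ wu → ∣K∣≤ (proj₂ wu) v≉0) ws)) nonzero))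

    second-moment : D ℕ.* ((∣ f₀ ∣ ℕ.* D) ℕ.* (∣ f₀ ∣ ℕ.* D)) ≤ norm ws ℕ.* (norm ws ℕ.* (q ℕ.^ n ℕ.* D))
    second-moment = ℕ.≤-trans (ℤ.drop‿+≤+ (ℤ.≤-trans (ℤ.≤-reflexive lhs) (ℤ.≤-trans lower
        (ℤ.≤-reflexive (≡.sym (ℤ.0≤i⇒+∣i∣≡i (ℤ.≤-trans lhs≥0 lower))))))) upper
      where
      sq : square (f₀ ℤ.* + D) ≡ + ((∣ f₀ ∣ ℕ.* D) ℕ.* (∣ f₀ ∣ ℕ.* D))
      sq = ≡.trans (≡.sym (ℤ.0≤i⇒+∣i∣≡i (0≤square (f₀ ℤ.* + D))))
        (≡.cong +_ (≡.trans (ℤ.abs-* (f₀ ℤ.* + D) (f₀ ℤ.* + D)) (≡.cong₂ ℕ._*_ (ℤ.abs-* f₀ (+ D)) (ℤ.abs-* f₀ (+ D)))))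
      lhs : + (D ℕ.* ((∣ f₀ ∣ ℕ.* D) ℕ.* (∣ f₀ ∣ ℕ.* D))) ≡ + D ℤ.* square (f₀ ℤ.* + D)
      lhs = ≡.trans (ℤ.pos-* D _) (≡.cong (ℤ._*_ (+ D)) (≡.sym sq))
      lhs≥0 : 0ℤ ℤ.≤ + D ℤ.* square (f₀ ℤ.* + D)
      lhs≥0 = ℤ.≤-trans (ℤ.+≤+ z≤n) (ℤ.≤-reflexive lhs)

  -- The sieve weights

  shift : ℤ × Carrier → Weights → Weights
  shift (w , u) = map (λ { (w′ , u′) → w ℤ.* w′ , u + u′ })

  convolve : Weights → Weights → Weights
  convolve []        ws′ = []
  convolve (wu ∷ ws) ws′ = shift wu ws′ ++ convolve ws ws′

  LS-++ : ∀ ws ws′ g → LS (ws ++ ws′) g ≡ LS ws g ℤ.+ LS ws′ g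
  LS-++ []             ws′ g = ≡.sym (ℤ.+-identityˡ _)
  LS-++ ((w , u) ∷ ws) ws′ g = ≡.trans (≡.cong (ℤ._+_ (w ℤ.* g u)) (LS-++ ws ws′ g)) (≡.sym (ℤ.+-assoc (w ℤ.* g u) _ _))

  LS-shift : ∀ w u ws g → LS (shift (w , u) ws) g ≡ w ℤ.* LS ws (λ u′ → g (u + u′))
  LS-shift w u []               g = ≡.sym (ℤ.*-zeroʳ w)
  LS-shift w u ((w′ , u′) ∷ ws) g = ≡.trans (≡.cong (ℤ._+_ (w ℤ.* w′ ℤ.* g (u + u′))) (LS-shift w u ws g))
    (lem w w′ (g (u + u′)) _)
    where
    lem : ∀ w w′ g s → w ℤ.* w′ ℤ.* g ℤ.+ w ℤ.* s ≡ w ℤ.* (w′ ℤ.* g ℤ.+ s)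
    lem = ℤ.solve-∀

  LS-convolve : ∀ ws ws′ g → LS (convolve ws ws′) g ≡ LS ws (λ u → LS ws′ (λ u′ → g (u + u′)))
  LS-convolve []             ws′ g = ≡.refl
  LS-convolve ((w , u) ∷ ws) ws′ g = ≡.trans (LS-++ (shift (w , u) ws′) _ g)
    (≡.cong₂ ℤ._+_ (LS-shift w u ws′ g) (LS-convolve ws ws′ g))

  -- The inner sum is a transform with translation u·x + c, the outer one with translation c; this
  -- nesting stands in for E(a + b) = E(a)E(b).
  transform-convolve : ∀ {ws ws′ P P′} → Transform ws P → Transform ws′ P′ →
    Transform (convolve ws ws′) (λ x → P x ℤ.* P′ x)
  transform-convolve {ws} {ws′} {P} {P′} tr tr′ x c = ≡.trans (LS-convolve ws ws′ _)
    (≡.trans (LS-cong ws (λ u → ≡.trans (LS-cong ws′ (λ u′ → E-cong (rearrange u u′))) (tr′ x (u * x + c))))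
    (≡.trans (≡.sym (LS-* ws (P′ x) _)) (≡.trans (≡.cong (ℤ._*_ (P′ x)) (tr x c)) (lem (P x) (P′ x) (E c)))))
    where
    lem : ∀ a b e → b ℤ.* (a ℤ.* e) ≡ a ℤ.* b ℤ.* e
    lem = ℤ.solve-∀
    rearrange : ∀ u u′ → (u + u′) * x + c ≈ u′ * x + (u * x + c)
    rearrange u u′ = trans (+-congʳ (trans (distribʳ x u u′) (+-comm _ _))) (+-assoc _ _ _)

  norm-++ : ∀ ws ws′ → norm (ws ++ ws′) ≡ norm ws ℕ.+ norm ws′
  norm-++ []             ws′ = ≡.refl
  norm-++ ((w , u) ∷ ws) ws′ = ≡.trans (≡.cong (∣ w ∣ ℕ.+_) (norm-++ ws ws′)) (≡.sym (ℕ.+-assoc ∣ w ∣ _ _))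

  norm-shift : ∀ w u ws → norm (shift (w , u) ws) ≡ ∣ w ∣ ℕ.* norm ws
  norm-shift w u []               = ≡.sym (ℕ.*-zeroʳ ∣ w ∣)
  norm-shift w u ((w′ , u′) ∷ ws) = ≡.trans (≡.cong₂ ℕ._+_ (ℤ.abs-* w w′) (norm-shift w u ws)) (≡.sym (ℕ.*-distribˡ-+ ∣ w ∣ ∣ w′ ∣ (norm ws)))

  norm-convolve : ∀ ws ws′ → norm (convolve ws ws′) ≡ norm ws ℕ.* norm ws′
  norm-convolve []             ws′ = ≡.refl
  norm-convolve ((w , u) ∷ ws) ws′ = ≡.trans (norm-++ (shift (w , u) ws′) _)
    (≡.trans (≡.cong₂ ℕ._+_ (norm-shift w u ws′) (norm-convolve ws ws′)) (≡.sym (ℕ.*-distribʳ-+ (norm ws′) ∣ w ∣ (norm ws))))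

  all-shift : ∀ {B C : Carrier → Set} w u {ws} → (∀ {u′} → B u′ → C (u + u′)) →
    All (B ∘ proj₂) ws → All (C ∘ proj₂) (shift (w , u) ws)
  all-shift w u f bs = All.map⁺ (All.map f bs)

  all-convolve : ∀ {A B C : Carrier → Set} {ws ws′} → (∀ {u u′} → A u → B u′ → C (u + u′)) →
    All (A ∘ proj₂) ws → All (B ∘ proj₂) ws′ → All (C ∘ proj₂) (convolve ws ws′)
  all-convolve f []       bs = []
  all-convolve {A} {B} {C} {(w , u) ∷ ws} f (a ∷ as) bs = All.++⁺ (all-shift {B} {C} w u (f a) bs) (all-convolve {A} {B} {C} f as bs)

  Avoids : List Poly → Carrier → Set
  Avoids rs x = All (λ r → ∀ s → r ⊛ s ≋ X^n-1 → ¬ S.ev s x ≈ 0#) rs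

  -- The sieve weights, split into the mass `head` at frequency 0 and the rest, which has mass (2^ω
  -- - 1)·`head` for ω = `length rs`. The field `killed` places the frequencies in the kernel of (∏
  -- rs)(τ); this makes the systems of coprime factors independent.
  record System (rs : List Poly) : Set where
    field
      head      : ℕ
      head≥1    : 1 ≤ head
      rest      : Weights
      norm-rest : norm rest ℕ.+ head ≡ 2 ℕ.^ length rs ℕ.* head
      nonzero   : All (λ wu → ¬ proj₂ wu ≈ 0#) rest
      killed    : All (λ wu → T.ev (∏ rs) (proj₂ wu) ≈ 0#) rest
      P         : Carrier → ℤ
    full : Weights
    full = (+ head , 0#) ∷ rest
    field
      transform : Transform full P
      detects   : ∀ x → P x ≡ 0ℤ ⊎ Avoids rs x

  E0* : ∀ x c → E (0# * x + c) ≡ E c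
  E0* x c = E-cong (trans (+-congʳ (zeroˡ x)) (+-identityˡ c))

  trivial-system : System []
  trivial-system = record
    { head = 1 ; head≥1 = s≤s z≤n ; rest = [] ; norm-rest = ≡.refl ; nonzero = [] ; killed = []
    ; P = λ _ → 1ℤ ; transform = λ x c → ≡.trans (ℤ.+-identityʳ _) (≡.cong (ℤ._*_ 1ℤ) (E0* x c))
    ; detects = λ _ → inj₂ [] }

  negatives : ∀ {m} → (Fin m → Carrier) → Weights
  negatives {zero}  t = []
  negatives {suc m} t with t zero ≟ 0#
  ... | yes _ = negatives (t ∘ suc)
  ... | no _  = (-1ℤ , t zero) ∷ negatives (t ∘ suc)

  -- Terms with t i = 0 cancel since g takes the value e there. Each remaining term leaves one unit
  -- of mass e and one weight -1, so the coefficient of e is exactly the norm.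
  negatives-sum : ∀ {m} (t : Fin m → Carrier) g e → (∀ u → u ≈ 0# → g u ≡ e) →
    LS (negatives t) g ℤ.+ + norm (negatives t) ℤ.* e ≡ ∑.sum (λ i → e ℤ.+ -1ℤ ℤ.* g (t i))
  negatives-sum {zero}  t g e g0 = ≡.trans (ℤ.+-identityˡ _) (ℤ.*-zeroˡ e)
  negatives-sum {suc m} t g e g0 with t zero ≟ 0#
  ... | yes z = ≡.trans (negatives-sum (t ∘ suc) g e g0) (≡.sym (≡.trans (≡.cong (ℤ._+ rest) cancel) (ℤ.+-identityˡ rest)))
    where
    rest = ∑.sum (λ i → e ℤ.+ -1ℤ ℤ.* g (t (suc i)))
    cancel : e ℤ.+ -1ℤ ℤ.* g (t zero) ≡ 0ℤ
    cancel = ≡.trans (≡.cong (ℤ._+_ e) (≡.trans (ℤ.-1*i≡-i _) (≡.cong ℤ.-_ (g0 _ z)))) (ℤ.+-inverseʳ e)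
  ... | no _  = ≡.trans (≡.cong (λ z → -1ℤ ℤ.* g (t zero) ℤ.+ L ℤ.+ z ℤ.* e) (ℤ.pos-+ 1 (norm (negatives (t ∘ suc)))))
      (≡.trans (lem (-1ℤ ℤ.* g (t zero)) L (+ norm (negatives (t ∘ suc))) e) (≡.cong (ℤ._+_ (e ℤ.+ -1ℤ ℤ.* g (t zero))) (negatives-sum (t ∘ suc) g e g0)))
    where
    L = LS (negatives (t ∘ suc)) g
    lem : ∀ a l k e → a ℤ.+ l ℤ.+ (1ℤ ℤ.+ k) ℤ.* e ≡ (e ℤ.+ a) ℤ.+ (l ℤ.+ k ℤ.* e)
    lem = ℤ.solve-∀

  negatives-all : ∀ {m} {B : Carrier → Set} (t : Fin m → Carrier) → (∀ i → ¬ t i ≈ 0# → B (t i)) →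
    All (B ∘ proj₂) (negatives t)
  negatives-all {zero}  t b = []
  negatives-all {suc m} {B} t b with t zero ≟ 0#
  ... | yes _ = negatives-all {B = B} (t ∘ suc) (b ∘ suc)
  ... | no nz = b zero nz ∷ negatives-all {B = B} (t ∘ suc) (b ∘ suc)

  negatives-norm : ∀ {m} (t : Fin m → Carrier) i → ¬ t i ≈ 0# → 1 ≤ norm (negatives t)
  negatives-norm t zero nz with t zero ≟ 0#
  ... | yes z = ⊥-elim (nz z)
  ... | no _  = s≤s z≤n
  negatives-norm t (suc i) nz with t zero ≟ 0#
  ... | yes _ = negatives-norm (t ∘ suc) i nz
  ... | no _  = s≤s z≤n

  nondegenerate : ∀ s {x} → ¬ S.ev s x ≈ 0# → Σ Carrier λ v → λᶠ (T.ev s v * x) ≈ 1#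
  nondegenerate s {x} nz with λ-onto nz
  ... | v , e = v , trans (sym (adjoint s v x)) e

  -- The weights of r: U = s(τ)F is the annihilator of ker s(σ), and ∑_{u ∈ U} is
  -- written as a sum over all v ∈ F with u = s(τ)v, so every u is repeated.
  irreducible-system : ∀ {r} → Irreducible r → r ∣ X^n-1 → System (r ∷ [])
  irreducible-system {r} ir (s , rs≋X) = record
    -- In Q·δ₀ minus the sum of δ over all s(τ)v, the mass at 0 is the number of v with s(τ)v ≠ 0,
    -- which is also the total mass elsewhere. Hence the factor 2 for one irreducible.
    { head = norm ws
    ; head≥1 = head≥1
    ; rest = ws
    ; norm-rest = ≡.cong (norm ws ℕ.+_) (≡.sym (ℕ.+-identityʳ (norm ws)))
    ; nonzero = negatives-all {B = λ u → ¬ u ≈ 0#} t (λ i nz → nz)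
    ; killed = negatives-all {B = λ u → T.ev (r ⊛ 𝟙) u ≈ 0#} t (λ i _ →
        trans (T.ev-≋ (⊛-identityʳ r) _) (trans (sym (T.ev-⊛ r s (enum i)))
          (trans (T.ev-≋ rs≋X (enum i)) (ev-X^n-1 τ τ-linear τ-period (enum i)))))
    ; P = P
    ; transform = transform
    ; detects = detects }
    where
    U : Carrier → Carrier
    U = T.ev s
    t : Fin (q ℕ.^ n) → Carrier
    t i = U (enum i)
    ws = negatives t
    P : Carrier → ℤ
    P x = Q ℤ.* 𝟏 (¬? (S.ev s x ≟ 0#))
    s-nonzero : Σ Carrier λ x → ¬ S.ev s x ≈ 0#
    s-nonzero with monic-cofactor X^n-1-monic (Irreducible.monic ir) rs≋X
    ... | k , ms , eq = ev-nonzero s (monic⇒hasDeg ms) (≡.subst (k <_) eq (ℕ.+-monoˡ-≤ k (Irreducible.deg≥1 ir)))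
    head≥1 : 1 ≤ norm ws
    head≥1 with s-nonzero
    ... | x , nz with nondegenerate s nz
    ...   | v , e = negatives-norm t (index v) (λ z → 1≉0 (trans (sym e) (trans (λ-linear.cong
              (trans (*-congʳ (trans (T.ev-cong s (sym (enum-index v))) z)) (zeroˡ x))) λ-linear.φ0)))
    ∑U : ∀ x c → ∑ᶠ (λ v → E (U v * x + c)) ≡ Q ℤ.* 𝟏 (S.ev s x ≟ 0#) ℤ.* E c
    ∑U x c with S.ev s x ≟ 0#
    ... | yes z = ≡.trans (∑ᶠ-cong {λ v → E (U v * x + c)} {λ _ → E c} (λ v → E-λ (trans (λ-linear.add _ c) (trans (+-congʳ
              (trans (sym (adjoint s v x)) (trans (λ-linear.cong (trans (*-congˡ z) (zeroʳ v))) λ-linear.φ0))) (+-identityˡ _)))))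
            (≡.trans (∑ᶠ-const (E c)) (≡.cong (ℤ._* E c) (≡.sym (ℤ.*-identityʳ Q))))
    ... | no nz with nondegenerate s nz
    ...   | v , e = ≡.trans (∑E-vanishes (λ w → U w * x) (λ f → *-congʳ (T.ev-cong s f))
                (λ y z → trans (*-congʳ (T.ev-+ s y z)) (distribʳ x _ _)) v e c)
              (≡.sym (≡.cong (ℤ._* E c) (ℤ.*-zeroʳ Q)))
    transform : Transform ((+ norm ws , 0#) ∷ ws) P
    transform x c = ≡.trans (≡.cong (λ z → + norm ws ℤ.* z ℤ.+ LS ws g) (E0* x c))
      (≡.trans (ℤ.+-comm (+ norm ws ℤ.* E c) _)
      (≡.trans (negatives-sum t g (E c) (λ u z → E-cong (trans (+-congʳ (trans (*-congʳ z) (zeroˡ x))) (+-identityˡ c))))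
      (≡.trans (∑ᶠ-+ (λ _ → E c) (λ v → -1ℤ ℤ.* g (U v)))
      (≡.trans (≡.cong₂ ℤ._+_ (∑ᶠ-const (E c)) (≡.trans (∑ᶠ-* -1ℤ (λ v → g (U v))) (≡.cong (ℤ._*_ -1ℤ) (∑U x c))))
      (complement (S.ev s x ≟ 0#))))))
      where
      g : Carrier → ℤ
      g u = E (u * x + c)
      l₁ : ∀ Q e → Q ℤ.* e ℤ.+ -1ℤ ℤ.* (Q ℤ.* 1ℤ ℤ.* e) ≡ Q ℤ.* 0ℤ ℤ.* e
      l₁ = ℤ.solve-∀
      l₂ : ∀ Q e → Q ℤ.* e ℤ.+ -1ℤ ℤ.* (Q ℤ.* 0ℤ ℤ.* e) ≡ Q ℤ.* 1ℤ ℤ.* e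
      l₂ = ℤ.solve-∀
      complement : ∀ {A : Set} (d : Dec A) →
        Q ℤ.* E c ℤ.+ -1ℤ ℤ.* (Q ℤ.* 𝟏 d ℤ.* E c) ≡ Q ℤ.* 𝟏 (¬? d) ℤ.* E c
      complement (yes _) = l₁ Q (E c)
      complement (no _)  = l₂ Q (E c)
    detects : ∀ x → P x ≡ 0ℤ ⊎ Avoids (r ∷ []) x
    detects x with S.ev s x ≟ 0#
    ... | yes _ = inj₁ (ℤ.*-zeroʳ Q)
    ... | no nz = inj₂ ((λ s′ rs′ z → nz (trans (S.ev-≋ (⊛-cancelˡ (Irreducible.hasDeg ir) (≋.trans rs≋X (≋.sym rs′))) x) z)) ∷ [])

  -- The two supports lie in the kernels of r(τ) and (∏ rs)(τ), which meet only in 0. No nonzero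
  -- frequency of the first system can be cancelled by one of the second, so the mass at 0 is
  -- exactly the product of the heads.
  extend-system : ∀ {r rs} → Comax r (∏ rs) → System (r ∷ []) → System rs → System (r ∷ rs)
  extend-system {r} {rs} co A B = record
    { head = A.head ℕ.* B.head
    ; head≥1 = ℕ.*-mono-≤ A.head≥1 B.head≥1
    ; rest = rest
    ; norm-rest = norm-rest
    ; nonzero = All.++⁺
        (all-shift {λ u → ¬ u ≈ 0#} {λ u → ¬ u ≈ 0#} (+ A.head) 0# (λ nz z → nz (trans (sym (+-identityˡ _)) z)) B.nonzero)
        (all-convolve {λ u → ¬ u ≈ 0# × T.ev r u ≈ 0#} {λ u → T.ev (∏ rs) u ≈ 0#} {λ u → ¬ u ≈ 0#} independent
          (All.zip (A.nonzero , A-killed)) B-killed)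
    ; killed = All.++⁺
        (all-shift {λ u → T.ev (∏ rs) u ≈ 0#} {λ u → T.ev (r ⊛ ∏ rs) u ≈ 0#} (+ A.head) 0# (kill (T.ev-0 r)) B.killed)
        (all-convolve {λ u → T.ev r u ≈ 0#} {λ u → T.ev (∏ rs) u ≈ 0#} {λ u → T.ev (r ⊛ ∏ rs) u ≈ 0#} kill A-killed B-killed)
    ; P = λ x → A.P x ℤ.* B.P x
    ; transform = λ x c → ≡.trans (≡.cong₂ (λ z y → z ℤ.* y ℤ.+ LS rest (λ u → E (u * x + c)))
          (ℤ.pos-* A.head B.head) (E-cong (+-congʳ (*-congʳ (sym (+-identityˡ 0#))))))
        (transform-convolve {A.full} {B.full} {A.P} {B.P} A.transform B.transform x c)
    ; detects = detects }
    where
    module A = System A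
    module B = System B
    -- This is the convolution of the two full systems without its first entry, the product of the
    -- heads at 0 + 0.
    rest = shift (+ A.head , 0#) B.rest ++ convolve A.rest B.full
    A-killed : All (λ wu → T.ev r (proj₂ wu) ≈ 0#) A.rest
    A-killed = All.map (λ e → trans (T.ev-≋ (≋.sym (⊛-identityʳ r)) _) e) A.killed
    B-killed : All (λ wu → T.ev (∏ rs) (proj₂ wu) ≈ 0#) B.full
    B-killed = T.ev-0 (∏ rs) ∷ B.killed
    kill : ∀ {u u′} → T.ev r u ≈ 0# → T.ev (∏ rs) u′ ≈ 0# → T.ev (r ⊛ ∏ rs) (u + u′) ≈ 0#
    kill e e′ = trans (T.ev-+ (r ⊛ ∏ rs) _ _) (trans (+-cong (T.ev-∣ (∣-*ʳ (∏ rs) (∣-refl {r})) e)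
      (T.ev-∣ (∣-*ˡ r (∣-refl {∏ rs})) e′)) (+-identityˡ 0#))
    independent : ∀ {u u′} → (¬ u ≈ 0#) × T.ev r u ≈ 0# → T.ev (∏ rs) u′ ≈ 0# → ¬ u + u′ ≈ 0#
    independent {u} {u′} (nz , e) e′ z = nz (trans (sym (+-identityʳ u)) (trans (+-congˡ (sym u′≈0)) z))
      where
      u′≈0 : u′ ≈ 0#
      u′≈0 = T.ev-comax co (trans (sym (+-identityˡ _)) (trans (+-congʳ (sym e)) (trans (sym (T.ev-+ r u u′)) (trans (T.ev-cong r z) (T.ev-0 r))))) e′
    norm-rest : norm rest ℕ.+ A.head ℕ.* B.head ≡ 2 ℕ.^ length (r ∷ rs) ℕ.* (A.head ℕ.* B.head)
    norm-rest = ≡.trans (≡.cong (ℕ._+ A.head ℕ.* B.head) (≡.trans (norm-++ (shift (+ A.head , 0#) B.rest) _)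
        (≡.cong₂ ℕ._+_ (norm-shift (+ A.head) 0# B.rest) (norm-convolve A.rest B.full))))
      (≡.trans (l₁ A.head B.head (norm A.rest) (norm B.rest)) (≡.trans
        (≡.cong₂ ℕ._*_ A.norm-rest B.norm-rest) (l₂ A.head (2 ℕ.^ length rs) B.head)))
      where
      l₁ : ∀ a b m k → a ℕ.* k ℕ.+ m ℕ.* (b ℕ.+ k) ℕ.+ a ℕ.* b ≡ (m ℕ.+ a) ℕ.* (k ℕ.+ b)
      l₁ = ℕ.solve-∀
      l₂ : ∀ a p b → 2 ℕ.* a ℕ.* (p ℕ.* b) ≡ 2 ℕ.* p ℕ.* (a ℕ.* b)
      l₂ = ℕ.solve-∀
    detects : ∀ x → A.P x ℤ.* B.P x ≡ 0ℤ ⊎ Avoids (r ∷ rs) x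
    detects x with A.detects x | B.detects x
    ... | inj₁ z        | _       = inj₁ (≡.trans (≡.cong (ℤ._* B.P x) z) (ℤ.*-zeroˡ (B.P x)))
    ... | inj₂ _        | inj₁ z  = inj₁ (≡.trans (≡.cong (ℤ._*_ (A.P x)) z) (ℤ.*-zeroʳ (A.P x)))
    ... | inj₂ (a ∷ []) | inj₂ as = inj₂ (a ∷ as)

  system : ∀ {rs} → All Irreducible rs → AllPairs Comax rs → All (_∣ X^n-1) rs → System rs
  system []         []         []       = trivial-system
  system (ir ∷ irs) (co ∷ cos) (d ∷ ds) =
    extend-system (comax-∏ co) (irreducible-system ir d) (system irs cos ds)

  -- Here m = (B - 1)·f is strictly below W·f, so the non-strict bound W²Q ≤ D² already contradicts
  -- the moment inequality once D and Q are cancelled.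
  moment-contradiction : ∀ {D f m B W Q : ℕ} → 1 ≤ D → 1 ≤ f → 1 ≤ Q → m ℕ.+ f ≡ B ℕ.* f → B ≤ W →
    W ℕ.* W ℕ.* Q ≤ D ℕ.* D → ¬ D ℕ.* ((f ℕ.* D) ℕ.* (f ℕ.* D)) ≤ m ℕ.* (m ℕ.* (Q ℕ.* D))
  moment-contradiction {D} {f} {m} {B} {W} {Q} D≥1 f≥1 Q≥1 mf B≤W WQ le =
    ℕ.<⇒≱ (ℕ.*-mono-< m<Wf m<Wf) (ℕ.*-cancelʳ-≤ _ _ Q {{ℕ.>-nonZero Q≥1}} (ℕ.*-cancelˡ-≤ D {{ℕ.>-nonZero D≥1}} chain))
    where
    open ℕ.≤-Reasoning
    m<Wf : m < W ℕ.* f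
    m<Wf = ℕ.<-≤-trans (ℕ.m<m+n m f≥1) (ℕ.≤-trans (ℕ.≤-reflexive mf) (ℕ.*-monoˡ-≤ f B≤W))
    l₁ : ∀ D W f Q → D ℕ.* (W ℕ.* f ℕ.* (W ℕ.* f) ℕ.* Q) ≡ D ℕ.* (f ℕ.* f) ℕ.* (W ℕ.* W ℕ.* Q)
    l₁ = ℕ.solve-∀
    l₂ : ∀ D f → D ℕ.* (f ℕ.* f) ℕ.* (D ℕ.* D) ≡ D ℕ.* ((f ℕ.* D) ℕ.* (f ℕ.* D))
    l₂ = ℕ.solve-∀
    l₃ : ∀ m Q D → m ℕ.* (m ℕ.* (Q ℕ.* D)) ≡ D ℕ.* (m ℕ.* m ℕ.* Q)
    l₃ = ℕ.solve-∀
    chain : D ℕ.* (W ℕ.* f ℕ.* (W ℕ.* f) ℕ.* Q) ≤ D ℕ.* (m ℕ.* m ℕ.* Q)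
    chain = begin
      D ℕ.* (W ℕ.* f ℕ.* (W ℕ.* f) ℕ.* Q)     ≡⟨ l₁ D W f Q ⟩
      D ℕ.* (f ℕ.* f) ℕ.* (W ℕ.* W ℕ.* Q)     ≤⟨ ℕ.*-monoʳ-≤ (D ℕ.* (f ℕ.* f)) WQ ⟩
      D ℕ.* (f ℕ.* f) ℕ.* (D ℕ.* D)           ≡⟨ l₂ D f ⟩
      D ℕ.* ((f ℕ.* D) ℕ.* (f ℕ.* D))         ≤⟨ le ⟩
      m ℕ.* (m ℕ.* (Q ℕ.* D))                 ≡⟨ l₃ m Q D ⟩
      D ℕ.* (m ℕ.* m ℕ.* Q)                   ∎

  sieve : ∀ {rs} → System rs → ∀ {D W} → 1 ≤ D → # (λ x → (x ^ D) ≟ 1#) ≡ + D →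
    2 ℕ.^ length rs ≤ W → W ℕ.* W ℕ.* q ℕ.^ n ≤ D ℕ.* D → ∀ {α} → ¬ α ≈ 0# →
    ¬ (∀ h → h ^ D ≈ 1# → ¬ Avoids rs (α * h))
  sieve {rs} Sys {D} {W} D≥1 #H B≤W WQ {α} α≉0 none =
    moment-contradiction D≥1 head≥1 (q^≥1 n) norm-rest B≤W WQ
      (≡.subst (λ k → D ℕ.* ((k ℕ.* D) ℕ.* (k ℕ.* D)) ≤ norm rest ℕ.* (norm rest ℕ.* (q ℕ.^ n ℕ.* D))) (ℤ.∣-i∣≡∣i∣ (+ head))
        (second-moment #H {rest} {R} R-transform nonzero α≉0 R-on-coset))
    where
    open System Sys
    R : Carrier → ℤ
    R x = P x ℤ.+ ℤ.- (+ head)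
    R-transform : Transform rest R
    R-transform x c = ≡.trans (lem (+ head ℤ.* E c) (LS rest (λ u → E (u * x + c))))
      (≡.trans (≡.cong (ℤ._+ ℤ.- (+ head ℤ.* E c)) (≡.trans (≡.cong (λ z → + head ℤ.* z ℤ.+ LS rest (λ u → E (u * x + c))) (≡.sym (E0* x c))) (transform x c)))
        (lem′ (P x) (+ head) (E c)))
      where
      lem : ∀ a b → b ≡ a ℤ.+ b ℤ.+ ℤ.- a
      lem = ℤ.solve-∀
      lem′ : ∀ p h e → p ℤ.* e ℤ.+ ℤ.- (h ℤ.* e) ≡ (p ℤ.+ ℤ.- h) ℤ.* e
      lem′ = ℤ.solve-∀
    R-on-coset : ∀ h → h ^ D ≈ 1# → R (α * h) ≡ ℤ.- (+ head)
    R-on-coset h hD with detects (α * h)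
    ... | inj₁ z = ≡.trans (≡.cong (ℤ._+ ℤ.- (+ head)) z) (ℤ.+-identityˡ _)
    ... | inj₂ a = ⊥-elim (none h hD a)

  -- Normal elements

  private module N = Notions q n F

  avoids-cofactor : ∀ {rs x h t} → Avoids rs x → h ⊛ t ≋ X^n-1 → Any (_∣ t) rs → ¬ S.ev h x ≈ 0#
  avoids-cofactor {r ∷ _} {x} {h} {t} (av ∷ _) ht (here (w , rw)) hx =
    av (h ⊛ w) (≋.trans (⊛-comm r (h ⊛ w)) (≋.trans (⊛-assoc h w r) (≋.trans (⊛-congˡ h (≋.trans (⊛-comm w r) rw)) ht)))
       (trans (S.ev-≋ (⊛-comm h w) x) (trans (S.ev-⊛ w h x) (trans (S.ev-cong w hx) (S.ev-0 w))))
  avoids-cofactor {h = h} (_ ∷ avs) ht (there a) hx = avoids-cofactor {h = h} avs ht a hx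

  -- If p ≠ 0 of degree below n annihilates x, so does h = gcd(p, Xⁿ-1). Its cofactor t is
  -- nonconstant, hence divisible by some r; then h divides (Xⁿ-1)/r, which does not annihilate x.
  avoids⇒independent : ∀ {ps rs} → Distinct ps rs → ∏ ps ≋ X^n-1 → ∀ {x} → Avoids rs x →
    ∀ p → Deg< n p → S.ev p x ≈ 0# → p ≋ []
  avoids⇒independent {ps} {rs} D ps≋X {x} av p p<n px with zero⊎hasDeg p
  ... | inj₁ z = z
  ... | inj₂ (e , hp) with gcdᴾ p X^n-1
  ...   | h , (a , b , ab) , (w , hw) , (t , ht) with zero⊎hasDeg h | zero⊎hasDeg w | zero⊎hasDeg t
  ...     | inj₁ z | _ | _ = ⊥-elim (hasDeg-≉0 hp (≋.trans (≋.sym hw) (⊛-zeroˡ′ z w)))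
  ...     | inj₂ _ | inj₁ z | _ = ⊥-elim (hasDeg-≉0 hp (≋.trans (≋.sym hw) (≋.trans (⊛-congˡ h z) (⊛-zeroʳ h))))
  ...     | inj₂ _ | inj₂ _ | inj₁ z = ⊥-elim (hasDeg-≉0 (monic⇒hasDeg X^n-1-monic) (≋.trans (≋.sym ht) (≋.trans (⊛-congˡ h z) (⊛-zeroʳ h))))
  ...     | inj₂ (k , hh) | inj₂ (l , hhw) | inj₂ (j , hht) =
    ⊥-elim (avoids-cofactor {h = h} av ht (nonunit-divisor D (nonunit 1≤j hht) (h , ≋.trans (⊛-comm t h) (≋.trans ht (≋.sym ps≋X)))) hx)
    where
    k+l≡e : k ℕ.+ l ≡ e
    k+l≡e = hasDeg-unique (hasDeg-resp hw (⊛-hasDeg hh hhw)) hp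
    k+j≡n : k ℕ.+ j ≡ n
    k+j≡n = hasDeg-unique (hasDeg-resp ht (⊛-hasDeg hh hht)) (monic⇒hasDeg X^n-1-monic)
    e<n : e < n
    e<n = ℕ.≰⇒> (λ n≤e → HasDeg.lead≉ hp (p<n e n≤e))
    1≤j : 1 ≤ j
    1≤j = ℕ.+-cancelˡ-< k 0 j (ℕ.≤-<-trans (ℕ.≤-trans (ℕ.≤-reflexive (ℕ.+-identityʳ k)) (ℕ.m≤m+n k l))
      (ℕ.≤-<-trans (ℕ.≤-reflexive k+l≡e) (ℕ.<-≤-trans e<n (ℕ.≤-reflexive (≡.sym k+j≡n)))))
    hx : S.ev h x ≈ 0#
    hx = trans (sym (S.ev-≋ ab x)) (trans (S.ev-⊕ (a ⊛ p) (b ⊛ X^n-1) x) (trans (+-cong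
      (trans (S.ev-⊛ a p x) (trans (S.ev-cong a px) (S.ev-0 a)))
      (trans (S.ev-⊛ b X^n-1 x) (trans (S.ev-cong b (ev-X^n-1 σ σ-linear σ-period x)) (S.ev-0 b)))) (+-identityˡ 0#)))

  pow≡^ : ∀ x m → N.pow x m ≡ x ^ m
  pow≡^ x zero    = ≡.refl
  pow≡^ x (suc m) = ≡.cong (x *_) (pow≡^ x m)

  InSub-1⇒Fixed : ∀ {x} → N.InSub 1 x → Fixed x
  InSub-1⇒Fixed {x} e = ≡.subst (_≈ x) (≡.trans (pow≡^ x (q ℕ.* 1)) (≡.cong (x ^_) (ℕ.*-identityʳ q))) e

  Fixed⇒InSub-1 : ∀ {x} → Fixed x → N.InSub 1 x
  Fixed⇒InSub-1 {x} e = ≡.subst (_≈ x) (≡.sym (≡.trans (pow≡^ x (q ℕ.* 1)) (≡.cong (x ^_) (ℕ.*-identityʳ q)))) e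

  #Fq : # (λ x → (x ^ q) ≟ x) ≡ + q
  #Fq = ≡.trans (∑ᶠ-cong split) (≡.trans (∑ᶠ-+ (λ x → 𝟏 (x ≟ 0#)) (λ x → 𝟏 ((x ^ M 1) ≟ 1#)))
    (≡.trans (≡.cong₂ ℤ._+_ (#-single 0#) units) (≡.cong +_ (≡.trans (suc-M 1) (ℕ.*-identityʳ q)))))
    where
    q≡ : suc (M 1) ≡ q
    q≡ = ≡.trans (suc-M 1) (ℕ.*-identityʳ q)
    units : # (λ x → (x ^ M 1) ≟ 1#) ≡ + M 1
    units with M-∣ {1} {n} (ℕ.1∣ n)
    ... | ℕ.divides zero    eq = ⊥-elim (ℕ.m<n⇒n≢0 (M≥1 n≥1) eq)
    ... | ℕ.divides (suc k) eq = #-roots (M 1) k (M≥1 {1} (s≤s z≤n)) (≡.sym eq)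
    ^q≡ : ∀ x → x ^ q ≈ x * x ^ M 1
    ^q≡ x = reflexive (≡.cong (x ^_) (≡.sym q≡))
    split : ∀ x → 𝟏 ((x ^ q) ≟ x) ≡ 𝟏 (x ≟ 0#) ℤ.+ 𝟏 ((x ^ M 1) ≟ 1#)
    split x with x ≟ 0#
    ... | yes z = ≡.trans (𝟏-yes ((x ^ q) ≟ x) (trans (^-congˡ q z) (trans (0^ q≥1) (sym z))))
                    (≡.cong (ℤ._+_ 1ℤ) (≡.sym (𝟏-no ((x ^ M 1) ≟ 1#)
                      (λ e → 1≉0 (trans (sym e) (trans (^-congˡ (M 1) z) (0^ (M≥1 {1} (s≤s z≤n)))))))))
    ... | no nz = ≡.trans (𝟏-cong ((x ^ q) ≟ x) ((x ^ M 1) ≟ 1#)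
                      (λ e → *-cancelˡ nz (trans (sym (^q≡ x)) (trans e (sym (*-identityʳ x)))))
                      (λ e → trans (^q≡ x) (trans (*-congˡ e) (*-identityʳ x))))
                    (≡.sym (ℤ.+-identityˡ _))

  Fq-enumeration : Enumeration (λ i → Fixed (enum i)) q
  Fq-enumeration with enumerate (λ i → (enum i ^ q) ≟ enum i)
  ... | k , eq , e = ≡.subst (Enumeration _) (ℤ.+-injective (≡.trans eq #Fq)) e

  open Enumeration Fq-enumeration

  scalar : Fin q → Fq
  scalar j = enum (elem j) , valid j

  scalar-injective : ∀ {i j} → scalar i K.≈ scalar j → i ≡ j
  scalar-injective e = injective (enum-injective _ _ e)

  scalar-surjective : ∀ (a : Fq) → Σ (Fin q) λ j → scalar j K.≈ a
  scalar-surjective (a , f) with surjective (index a) (fixed-resp (sym (enum-index a)) f)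
  ... | j , e = j , trans (reflexive (≡.cong enum e)) (enum-index a)

  combination : (Fin n → Fq) → Carrier → Carrier
  combination c = S.ev (tabulate c)

  vector : Fin (q ℕ.^ n) → Fin n → Fq
  vector v i = scalar (finToFun v i)

  -- Coefficient vectors are coded by the numbers below q^n, so independence becomes a decidable
  -- property of x.
  Independent : Carrier → Set
  Independent x = ∀ v → combination (vector v) x ≈ 0# → ∀ i → vector v i K.≈ K.0#

  independent? : ∀ x → Dec (Independent x)
  independent? x = Fin.all? λ v → (combination (vector v) x ≟ 0#) →-dec Fin.all? (λ i → proj₁ (vector v i) ≟ 0#)

  coeff-tabulate : ∀ {m} (c : Fin m → Fq) i → coeff (tabulate c) (toℕ i) ≡ c i
  coeff-tabulate c zero    = ≡.refl
  coeff-tabulate c (suc i) = coeff-tabulate (c ∘ suc) i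

  tabulate-deg< : ∀ {m} (c : Fin m → Fq) → Deg< m (tabulate c)
  tabulate-deg< {zero}  c i       _        = refl
  tabulate-deg< {suc m} c (suc i) (s≤s le) = tabulate-deg< (c ∘ suc) i le

  tabulate-≋ : ∀ {m} {c d : Fin m → Fq} → (∀ i → c i K.≈ d i) → tabulate c ≋ tabulate d
  tabulate-≋ {zero}  e = ≋.refl
  tabulate-≋ {suc m} e = ∷-cong (e zero) (tabulate-≋ (e ∘ suc))

  avoids⇒Independent : ∀ {ps rs} → Distinct ps rs → ∏ ps ≋ X^n-1 → ∀ {x} → Avoids rs x → Independent x
  avoids⇒Independent D ps≋X {x} av v e i = trans (reflexive (≡.cong proj₁ (≡.sym (coeff-tabulate (vector v) i))))
    (at (avoids⇒independent D ps≋X av (tabulate (vector v)) (tabulate-deg< (vector v)) e) (toℕ i))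

  Independent⇒injective : ∀ {x} → Independent x → ∀ (c : Fin n → Fq) → combination c x ≈ 0# → ∀ i → c i K.≈ K.0#
  Independent⇒injective {x} ind c e i = trans (sym (agree i)) (ind v (trans (S.ev-≋ (tabulate-≋ agree) x) e) i)
    where
    f : Fin n → Fin q
    f i = proj₁ (scalar-surjective (c i))
    v = funToFin f
    agree : ∀ i → vector v i K.≈ c i
    agree i = trans (reflexive (≡.cong (proj₁ ∘ scalar) (Fin.finToFun-funToFin f i))) (proj₂ (scalar-surjective (c i)))

  combination-sub : ∀ {m} (c d : Fin m → Fq) x →
    S.ev (tabulate (λ i → c i K.+ (K.- d i))) x + S.ev (tabulate d) x ≈ S.ev (tabulate c) x
  combination-sub c d x = trans (sym (S.ev-⊕ (tabulate (λ i → c i K.+ (K.- d i))) (tabulate d) x))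
    (S.ev-≋ {tabulate (λ i → c i K.+ (K.- d i)) ⊕ tabulate d} {tabulate c} (mk (eq c d)) x)
    where
    eq : ∀ {m} (c d : Fin m → Fq) i → coeff (tabulate (λ i → c i K.+ (K.- d i)) ⊕ tabulate d) i K.≈ coeff (tabulate c) i
    eq {zero}  c d i       = refl
    eq {suc m} c d zero    = trans (+-assoc _ _ _) (trans (+-congˡ (-‿inverseˡ _)) (+-identityʳ _))
    eq {suc m} c d (suc i) = eq (c ∘ suc) (d ∘ suc) i

  module _ {x : Carrier} (ind : Independent x) where

    value : Fin (q ℕ.^ n) → Fin (q ℕ.^ n)
    value v = index (combination (vector v) x)

    value-injective : ∀ {v w} → value v ≡ value w → v ≡ w
    value-injective {v} {w} e = ≡.trans (≡.sym (Fin.funToFin-finToFin {n} {q} v))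
      (≡.trans (funToFin-cong {n} {q} {finToFun v} {finToFun w} same) (Fin.funToFin-finToFin {n} {q} w))
      where
      equal : combination (vector v) x ≈ combination (vector w) x
      equal = trans (sym (enum-index _)) (trans (reflexive (≡.cong enum e)) (enum-index _))
      diff : ∀ i → vector v i K.+ (K.- vector w i) K.≈ K.0#
      diff = Independent⇒injective ind (λ i → vector v i K.+ (K.- vector w i)) (+-cancelʳ (combination (vector w) x) _ _
        (trans (combination-sub (vector v) (vector w) x) (trans equal (sym (+-identityˡ _)))))
      same : ∀ i → finToFun v i ≡ finToFun w i
      same i = scalar-injective (+-cancelʳ (- proj₁ (vector w i)) _ _ (trans (diff i) (sym (-‿inverseʳ _))))

    -- There are q^n coefficient vectors and q^n field elements; the injective evaluation map is
    -- therefore onto.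
    Independent⇒spanning : ∀ y → Σ (Fin n → Fq) λ c → combination c x ≈ y
    Independent⇒spanning y = vector (proj₁ preimage) ,
      trans (sym (enum-index _)) (trans (reflexive (≡.cong enum (proj₂ preimage))) (enum-index y))
      where
      preimage : Σ (Fin (q ℕ.^ n)) λ v → value v ≡ index y
      preimage = injective⇒surjective value value-injective (index y)

  combination-Σᶠ : ∀ (c : Fin n → Fq) x →
    combination c x ≈ N.Σᶠ n (λ i → proj₁ (c i) * N.pow x (q ℕ.^ toℕ i))
  combination-Σᶠ c x = trans (go c x) (reflexive (≡.cong (foldr _+_ 0#) (≡.sym (map-tabulate {n = n} id (term c x)))))
    where
    term : ∀ {m} → (Fin m → Fq) → Carrier → Fin m → Carrier
    term c x i = proj₁ (c i) * N.pow x (q ℕ.^ toℕ i)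
    fold-cong : ∀ {m} (f g : Fin m → Carrier) → (∀ i → f i ≈ g i) → foldr _+_ 0# (tabulate f) ≈ foldr _+_ 0# (tabulate g)
    fold-cong {zero}  f g e = refl
    fold-cong {suc m} f g e = +-cong (e zero) (fold-cong (f ∘ suc) (g ∘ suc) (e ∘ suc))
    pow-σ : ∀ x k → N.pow (σ x) (q ℕ.^ k) ≈ N.pow x (q ℕ.^ suc k)
    pow-σ x k = trans (reflexive (pow≡^ (σ x) (q ℕ.^ k))) (trans (^-assocʳ x q (q ℕ.^ k)) (reflexive (≡.sym (pow≡^ x (q ℕ.^ suc k)))))
    go : ∀ {m} (c : Fin m → Fq) x → S.ev (tabulate c) x ≈ foldr _+_ 0# (tabulate (term c x))
    go {zero}  c x = refl
    go {suc m} c x = +-cong (*-congˡ (sym (*-identityʳ x))) (trans (go (c ∘ suc) (σ x))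
      (fold-cong (term (c ∘ suc) (σ x)) (term c x ∘ suc) λ i → *-congˡ (pow-σ x (toℕ i))))

  Independent⇒IsNormal : ∀ {x} → Independent x → N.IsNormal x
  Independent⇒IsNormal {x} ind =
    (λ c c∈ e i → Independent⇒injective ind (λ j → c j , InSub-1⇒Fixed (c∈ j)) (trans (combination-Σᶠ _ x) e) i) ,
    λ y → let (c , e) = Independent⇒spanning ind y in
      proj₁ ∘ c , (λ i → Fixed⇒InSub-1 (proj₂ (c i))) , trans (sym (combination-Σᶠ c x)) e

  -- Divisors of xⁿ - 1

  forget : Poly → N.Poly
  forget = map proj₁

  forget-OverFq : ∀ p → N.OverFq (forget p)
  forget-OverFq []            = []
  forget-OverFq ((a , f) ∷ p) = Fixed⇒InSub-1 f ∷ forget-OverFq p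

  lift : ∀ p → N.OverFq p → Poly
  lift []      []       = []
  lift (a ∷ p) (f ∷ fs) = (a , InSub-1⇒Fixed f) ∷ lift p fs

  forget-lift : ∀ p fs → forget (lift p fs) ≡ p
  forget-lift []      []       = ≡.refl
  forget-lift (a ∷ p) (f ∷ fs) = ≡.cong (a ∷_) (forget-lift p fs)

  forget-coeff : ∀ p i → N.coeff (forget p) i ≡ proj₁ (coeff p i)
  forget-coeff []      i       = ≡.refl
  forget-coeff (a ∷ p) zero    = ≡.refl
  forget-coeff (a ∷ p) (suc i) = forget-coeff p i

  forget-⊕ : ∀ p r → forget (p ⊕ r) ≡ forget p N.+ₚ forget r
  forget-⊕ []      r       = ≡.refl
  forget-⊕ (a ∷ p) []      = ≡.refl
  forget-⊕ (a ∷ p) (b ∷ r) = ≡.cong (_ ∷_) (forget-⊕ p r)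

  forget-· : ∀ a p → forget (a · p) ≡ N.scaleₚ (proj₁ a) (forget p)
  forget-· a []      = ≡.refl
  forget-· a (b ∷ p) = ≡.cong (_ ∷_) (forget-· a p)

  forget-⊛ : ∀ p r → forget (p ⊛ r) ≡ forget p N.*ₚ forget r
  forget-⊛ []      r = ≡.refl
  forget-⊛ (a ∷ p) r = ≡.trans (forget-⊕ (a · r) (K.0# ∷ (p ⊛ r)))
    (≡.cong₂ N._+ₚ_ (forget-· a r) (≡.cong (0# ∷_) (forget-⊛ p r)))

  ≋⇒≈ₚ : ∀ {p r} → p ≋ r → forget p N.≈ₚ forget r
  ≋⇒≈ₚ {p} {r} e i = trans (reflexive (forget-coeff p i)) (trans (at e i) (reflexive (≡.sym (forget-coeff r i))))

  ≈ₚ⇒≋ : ∀ {p r} → forget p N.≈ₚ forget r → p ≋ r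
  ≈ₚ⇒≋ {p} {r} e = mk λ i → trans (reflexive (≡.sym (forget-coeff p i))) (trans (e i) (reflexive (forget-coeff r i)))

  forget-X^n-1 : forget X^n-1 N.≈ₚ N.xⁿ-1
  forget-X^n-1 i = trans (reflexive (forget-coeff X^n-1 i)) (trans (coeff-⊕ (monomial n) (⊖ 𝟙) i) (go i))
    where
    f : ℕ → Carrier
    f = proj₁ (xⁿ-1-tail q n F)
    inside : ∀ (g : ℕ → Carrier) m j → j < m → N.coeff (applyUpTo g m) j ≡ g j
    inside g (suc m) zero    _        = ≡.refl
    inside g (suc m) (suc j) (s≤s lt) = inside (g ∘ suc) m j lt
    outside : ∀ (g : ℕ → Carrier) m j → m ≤ j → N.coeff (applyUpTo g m) j ≡ 0#
    outside g zero    j       _        = ≡.refl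
    outside g (suc m) (suc j) (s≤s le) = outside (g ∘ suc) m j le
    tail : ∀ j → proj₁ (coeff (monomial n) (suc j)) ≈ N.coeff (applyUpTo f n) j
    tail j with suc j ℕ.≟ n
    ... | yes ≡.refl = trans (coeff-monomial n) (reflexive (≡.sym (≡.trans (inside f n j ℕ.≤-refl) (xⁿ-1-tail-last q n F j ≡.refl))))
    ... | no ne = trans (coeff-monomial-≢ n (suc j) ne) (reflexive (≡.sym (zero-there (j ℕ.<? n))))
      where
      zero-there : Dec (j < n) → N.coeff (applyUpTo f n) j ≡ 0#
      zero-there (yes lt) = ≡.trans (inside f n j lt) (xⁿ-1-tail-other q n F j ne)
      zero-there (no ge)  = outside f n j (ℕ.≮⇒≥ ge)
    go : ∀ i → proj₁ (coeff (monomial n) i) + proj₁ (coeff (⊖ 𝟙) i) ≈ N.coeff N.xⁿ-1 i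
    go zero    = trans (+-congʳ (coeff-monomial-≢ n 0 (ℕ.m<n⇒n≢0 n≥1 ∘ ≡.sym))) (+-identityˡ _)
    go (suc j) = trans (+-identityʳ _) (tail j)

  lower : ∀ d → Poly → Vec Fq d
  lower zero    p       = []
  lower (suc d) []      = K.0# ∷ lower d []
  lower (suc d) (a ∷ p) = a ∷ lower d p

  toMonic : ℕ → Poly → N.Monic
  toMonic d p = d , Vec.map proj₁ (lower d p)

  rebuilt : ℕ → Poly → Poly
  rebuilt d p = Vec.toList (lower d p) ++ 𝟙

  toPoly-toMonic : ∀ d p → N.toPoly (toMonic d p) ≡ forget (rebuilt d p)
  toPoly-toMonic d p = ≡.trans (≡.cong (_++ (1# ∷ [])) (toList-map proj₁ (lower d p))) (≡.sym (map-++ proj₁ (Vec.toList (lower d p)) 𝟙))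

  rebuilt-≋ : ∀ {d p} → Monic d p → rebuilt d p ≋ p
  rebuilt-≋ {zero} {p} m = ≋.sym (monic-0 m)
  rebuilt-≋ {suc d} {[]} (_ , l) = ⊥-elim (1≉0 (sym l))
  rebuilt-≋ {suc d} {a ∷ p} (b , l) = ∷-cong refl (rebuilt-≋ {d} {p} ((λ i lt → b (suc i) (s≤s lt)) , l))

  ∣-toMonic : ∀ {d g f} → Monic d g → g ∣ f → N.toPoly (toMonic d g) N.∣ₚ forget f
  ∣-toMonic {d} {g} {f} m (h , e) = forget h , forget-OverFq h ,
    ≡.subst (N._≈ₚ forget f) (≡.trans (forget-⊛ (rebuilt d g) h) (≡.cong (N._*ₚ forget h) (≡.sym (toPoly-toMonic d g))))
      (≋⇒≈ₚ (≋.trans (⊛-congʳ h (rebuilt-≋ m)) e))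

  toMonic-squarefree : ∀ {d g} → Monic d g → (∀ t → ¬ t ∣ 𝟙 → ¬ (t ⊛ t ∣ g)) → N.Squarefree (N.toPoly (toMonic d g))
  toMonic-squarefree {d} {g} m sqf r r∈ (i , 1≤i , ri≉0) (h , h∈ , e) = sqf r̃ r̃∤1
    (lift h h∈ , ≋.trans (≈ₚ⇒≋ {(r̃ ⊛ r̃) ⊛ lift h h∈} {rebuilt d g} (≡.subst₂ N._≈ₚ_ (≡.sym product) (toPoly-toMonic d g) e)) (rebuilt-≋ m))
    where
    r̃ = lift r r∈
    product : forget ((r̃ ⊛ r̃) ⊛ lift h h∈) ≡ (r N.*ₚ r) N.*ₚ h
    product = ≡.trans (forget-⊛ (r̃ ⊛ r̃) (lift h h∈)) (≡.cong₂ N._*ₚ_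
      (≡.trans (forget-⊛ r̃ r̃) (≡.cong₂ N._*ₚ_ (forget-lift r r∈) (forget-lift r r∈))) (forget-lift h h∈))
    r̃i≉0 : ¬ coeff r̃ i K.≈ K.0#
    r̃i≉0 z = ri≉0 (trans (reflexive (≡.trans (≡.cong (λ p → N.coeff p i) (≡.sym (forget-lift r r∈))) (forget-coeff r̃ i))) z)
    r̃∤1 : ¬ r̃ ∣ 𝟙
    r̃∤1 with zero⊎hasDeg r̃
    ... | inj₁ z       = ⊥-elim (r̃i≉0 (at z i))
    ... | inj₂ (k , h) = nonunit (ℕ.≤-trans 1≤i (hasDeg-≤ h r̃i≉0)) h

  ∣ₚ-resp : ∀ {g f f′} → f N.≈ₚ f′ → g N.∣ₚ f → g N.∣ₚ f′
  ∣ₚ-resp e (h , h∈ , f) = h , h∈ , λ i → trans (f i) (e i)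

  -- Recomputed from p alone, so that `monicOf` is a function of the polynomial and not of a chosen
  -- monicity proof.
  degree : Poly → ℕ
  degree p with zero⊎hasDeg p
  ... | inj₁ _       = 0
  ... | inj₂ (d , _) = d

  degree-monic : ∀ {d p} → Monic d p → Monic (degree p) p
  degree-monic {d} {p} m with zero⊎hasDeg p
  ... | inj₁ z        = ⊥-elim (hasDeg-≉0 (monic⇒hasDeg m) z)
  ... | inj₂ (d′ , h) = ≡.subst (λ k → Monic k p) (hasDeg-unique (monic⇒hasDeg m) h) m

  monicOf : Poly → N.Monic
  monicOf p = toMonic (degree p) p

  module _ {rs : List Poly} (irr : All Irreducible rs) (co : AllPairs Comax rs) (∏∣X : ∏ rs ∣ X^n-1) where

    2^r≤W : ∀ {L} → N.EnumeratesW L → 2 ℕ.^ length rs ≤ length L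
    2^r≤W {L} (_ , complete , _) = ≡.subst (_≤ length L) (length-subproducts rs)
      -- Monicity is part of the matching relation because only a monic g can be recovered from
      -- `monicOf g`.
      (distinct-matches⇒length-≤ {R = λ g l → (Σ ℕ λ d → Monic d g) × monicOf g N.≈ₘ l}
        (All.zipWith (λ { {g} (g∣ , (d , m)) → Any.map (λ e → (d , m) , e)
            (complete (monicOf g) (over g , ∣ₚ-resp {N.toPoly (monicOf g)} {forget X^n-1} {N.xⁿ-1} forget-X^n-1 (∣-toMonic (degree-monic m) (∣-trans g∣ ∏∣X)) ,
              toMonic-squarefree (degree-monic m) (λ t t∤1 tt∣g → ∏-squarefree irr co t∤1 (∣-trans tt∣g g∣)))) })
          (subproducts-∣ rs , subproducts-monic irr))
        (AllPairs.map (λ {g} {h} g≉h l → λ { ((_ , mg) , eg) ((_ , mh) , eh) → g≉h (same mg mh (λ i → trans (eg i) (sym (eh i)))) })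
          (subproducts-distinct irr co)))
      where
      over : ∀ g → N.OverFq (N.toPoly (monicOf g))
      over g = ≡.subst N.OverFq (≡.sym (toPoly-toMonic (degree g) g)) (forget-OverFq (rebuilt (degree g) g))
      same : ∀ {d e g h} → Monic d g → Monic e h → monicOf g N.≈ₘ monicOf h → g ≋ h
      same {g = g} {h} mg mh e = ≋.trans (≋.sym (rebuilt-≋ (degree-monic mg))) (≋.trans
        (≈ₚ⇒≋ {rebuilt (degree g) g} {rebuilt (degree h) h} (≡.subst₂ N._≈ₚ_ (toPoly-toMonic (degree g) g) (toPoly-toMonic (degree h) h) e))
        (rebuilt-≋ (degree-monic mh)))

  -- Elements with prescribed norms

  module _ {k : ℕ} (d : Fin (suc k) → ℕ) (d∣n : ∀ i → d i ℕ.∣ n) where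

    exponent : Fin (suc k) → ℕ
    exponent i = M n ÷ M (d i)

    d≥1 : ∀ i → 1 ≤ d i
    d≥1 i with d i | d∣n i
    ... | zero  | ℕ.divides c eq = ⊥-elim (ℕ.m<n⇒n≢0 n≥1 (≡.trans eq (ℕ.*-zeroʳ c)))
    ... | suc _ | _              = s≤s z≤n

    exponent-* : ∀ i → exponent i ℕ.* M (d i) ≡ M n
    exponent-* i = ÷-* (M≥1 (d≥1 i)) (M-∣ (d∣n i))

    exponent≥1 : ∀ i → 1 ≤ exponent i
    exponent≥1 i = ℕ.n≢0⇒n>0 λ z → ℕ.m<n⇒n≢0 (M≥1 n≥1) (≡.trans (≡.sym (exponent-* i)) (≡.cong (ℕ._* M (d i)) z))

    module _ (a : Fin (suc k) → Carrier)
      (a∈ : ∀ i → N.InSub (d i) (a i) × ¬ (a i ≈ 0#))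
      (norms : ∀ i j → i Fin.< j →
         N.Norm (d i) (gcd (d i) (d j)) (a i) ≈ N.Norm (d j) (gcd (d i) (d j)) (a j)) where

      divisors-of-∏ : ∀ rs → All (_∣ ∏ rs) rs
      divisors-of-∏ []       = []
      divisors-of-∏ (r ∷ rs) = ∣-*ʳ (∏ rs) (∣-refl {r}) ∷ All.map (∣-*ˡ r) (divisors-of-∏ rs)

      compatible : ∀ {i j} → i Fin.< j → Compatible exponent a exponent≥1 (λ i → proj₂ (a∈ i)) i j
      compatible {i} {j} i<j x y eq = trans (^-≡ (a i) x≡) (trans (sym (^-assocʳ (a i) u z)) (trans (^-congˡ z
          (trans (reflexive (≡.sym (pow≡^ (a i) u))) (trans (norms i j i<j) (reflexive (pow≡^ (a j) v)))))
          (trans (^-assocʳ (a j) v z) (^-≡ (a j) (≡.sym y≡)))))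
        where
        g = gcd (d i) (d j)
        u = M (d i) ÷ M g
        v = M (d j) ÷ M g
        exponents : Σ ℕ λ z → x ≡ u ℕ.* z × y ≡ v ℕ.* z
        exponents = norm-exponents n≥1 (d∣n i) (d∣n j) x y eq
        z = proj₁ exponents
        x≡ = proj₁ (proj₂ exponents)
        y≡ = proj₂ (proj₂ exponents)

      -- Since `exponent i` is `cofactor i` times D, every D-th root of `root` has the prescribed
      -- norms, and so does its product with any element of H.
      record CommonRoot (D : ℕ) : Set where
        field
          D≥1       : 1 ≤ D
          cofactor  : Fin (suc k) → ℕ
          exponent≡ : ∀ i → exponent i ≡ cofactor i ℕ.* D
          root      : Carrier
          root≉0    : ¬ root ≈ 0#
          root^     : ∀ i → root ^ cofactor i ≈ a i

      commonRoot : CommonRoot (gcdFam (suc k) exponent)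
      commonRoot = record
        { D≥1 = gcd≥1
        ; cofactor = λ i → ℕ.quotient (All.lookup gcd∣ (∈-allFin i))
        ; exponent≡ = λ i → ℕ._∣_.equality (All.lookup gcd∣ (∈-allFin i))
        ; root = root
        ; root≉0 = root≉0
        ; root^ = λ i → All.lookup root^ (∈-allFin i) (ℕ.quotient (All.lookup gcd∣ (∈-allFin i))) (ℕ._∣_.equality (All.lookup gcd∣ (∈-allFin i))) }
        where
        glued : Glued exponent a exponent≥1 (λ i → proj₂ (a∈ i)) (allFin (suc k))
        glued = glue exponent a exponent≥1 (λ i → proj₂ (a∈ i)) Fin.zero (tabulate Fin.suc) (AllPairs.tabulate⁺-< compatible)
        open Glued glued

      a^M : ∀ i → a i ^ M (d i) ≈ 1#
      a^M i = *-cancelˡ (proj₂ (a∈ i)) (trans (reflexive (≡.trans (≡.cong (a i ^_) (suc-M (d i))) (≡.sym (pow≡^ (a i) (q ℕ.^ d i)))))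
        (trans (proj₁ (a∈ i)) (sym (*-identityʳ (a i)))))

      Solution : Carrier → Set
      Solution α = ¬ (α ≈ 0#) × Independent α × (∀ i → N.Norm n (d i) α ≈ a i)

      solution? : ∀ α → Dec (Solution α)
      solution? α = ¬? (α ≟ 0#) ×-dec independent? α ×-dec Fin.all? (λ i → N.Norm n (d i) α ≟ a i)

      solution-resp : ∀ {α β} → α ≈ β → Solution α → Solution β
      solution-resp {α} {β} e (nz , ind , nm) = (λ z → nz (trans e z)) ,
        (λ v z i → ind v (trans (S.ev-cong (tabulate (vector v)) e) z) i) ,
        λ i → trans (reflexive (pow≡^ β (exponent i))) (trans (^-congˡ (exponent i) (sym e)) (trans (reflexive (≡.sym (pow≡^ α (exponent i)))) (nm i)))

      module _ {D : ℕ} (C : CommonRoot D) where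

        open CommonRoot C

        root-exponent : ℕ
        -- This is (q^n - 1)/D, computed at the index 0. The power `cofactor 0` sends `root` to an
        -- element of the subfield of degree `d 0`, whose nonzero elements satisfy y^M = 1; so
        -- `root` is killed by this exponent and is a D-th power.
        root-exponent = M (d Fin.zero) ℕ.* cofactor Fin.zero

        root-exponent-D : root-exponent ℕ.* D ≡ M n
        root-exponent-D = ≡.trans (ℕ.*-assoc (M (d Fin.zero)) _ D) (≡.trans (≡.cong (M (d Fin.zero) ℕ.*_) (≡.sym (exponent≡ Fin.zero)))
          (≡.trans (ℕ.*-comm (M (d Fin.zero)) _) (exponent-* Fin.zero)))

        root-exponent≥1 : 1 ≤ root-exponent
        root-exponent≥1 = ℕ.n≢0⇒n>0 λ z → ℕ.m<n⇒n≢0 (M≥1 n≥1) (≡.trans (≡.sym root-exponent-D) (≡.cong (ℕ._* D) z))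

        root-order : root ^ root-exponent ≈ 1#
        root-order = trans (^-≡ root (ℕ.*-comm (M (d Fin.zero)) (cofactor Fin.zero)))
          (trans (sym (^-assocʳ root (cofactor Fin.zero) (M (d Fin.zero))))
          (trans (^-congˡ (M (d Fin.zero)) (root^ Fin.zero)) (a^M Fin.zero)))

        D-th-root : Σ Carrier λ y → y ^ D ≈ root
        D-th-root = ^-surjective D root-exponent D≥1 root-exponent≥1 root-exponent-D root-order

        #H : # (λ x → (x ^ D) ≟ 1#) ≡ ℤ.+ D
        #H = go root-exponent root-exponent≥1 root-exponent-D
          where
          go : ∀ c → 1 ≤ c → c ℕ.* D ≡ M n → # (λ x → (x ^ D) ≟ 1#) ≡ ℤ.+ D
          go (suc c) _ eq = #-roots D c D≥1 eq

        ^D≉0 : ∀ {x z} → ¬ z ≈ 0# → x ^ D ≈ z → ¬ x ≈ 0#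
        ^D≉0 z≉0 e x≈0 = z≉0 (trans (sym e) (trans (^-congˡ D x≈0) (0^ D≥1)))

        norm-on-coset : ∀ {y h} → y ^ D ≈ root → h ^ D ≈ 1# → ∀ i → N.Norm n (d i) (y * h) ≈ a i
        norm-on-coset {y} {h} yD hD i = trans (reflexive (pow≡^ (y * h) (exponent i)))
          (trans (^-≡ (y * h) (≡.trans (exponent≡ i) (ℕ.*-comm (cofactor i) D)))
          (trans (sym (^-assocʳ (y * h) D (cofactor i))) (trans (^-congˡ (cofactor i) (trans (^-distrib-* y h D)
            (trans (*-cong yD hD) (*-identityʳ root)))) (root^ i))))

        no-solution⇒⊥ : ∀ {L} → N.EnumeratesW L → length L ℕ.* length L ℕ.* q ℕ.^ n ≤ D ℕ.* D →
          ¬ Σ Carrier Solution → ¬ Factorisation X^n-1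
        no-solution⇒⊥ enumL large none (ps , irr-ps , ps≋X) with distinct irr-ps | D-th-root
        ... | rs , Ds | y , yD = sieve (system irr comax (All.map (λ r∣ → ∣-trans r∣ ∏rs∣X) (divisors-of-∏ rs))) D≥1 #H
                (2^r≤W irr comax ∏rs∣X enumL) large y≉0
                (λ h hD av → none (y * h ,
                  integral y≉0 (^D≉0 1≉0 hD) , avoids⇒Independent Ds ps≋X av , norm-on-coset yD hD))
          where
          open Distinct Ds
          y≉0 : ¬ y ≈ 0#
          y≉0 = ^D≉0 root≉0 yD
          ∏rs∣X : ∏ rs ∣ X^n-1
          ∏rs∣X = ∣-resp ps≋X ∏∣∏

        -- Deciding `Solution` by exhaustion discharges the double negation left by `factorise`.
        solution : ∀ {L} → N.EnumeratesW L → length L ℕ.* length L ℕ.* q ℕ.^ n ≤ D ℕ.* D → Σ Carrier Solution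
        solution enumL large with exists? solution? solution-resp
        ... | yes found = found
        ... | no none   = ⊥-elim (factorise n n ℕ.≤-refl X^n-1-monic (no-solution⇒⊥ enumL large none))

-- Consequences of q being a prime power, and the conclusion.

primePower≥2 : ∀ {p e} → Prime p → 1 ≤ e → 2 ≤ p ℕ.^ e
primePower≥2 {p} {e} pr 1≤e = ℕ.≤-trans (ℕ.nonTrivial⇒n>1 p {{prime⇒nonTrivial pr}})
  (ℕ.≤-trans (ℕ.≤-reflexive (≡.sym (ℕ.*-identityʳ p))) (ℕ.^-monoʳ-≤ p {{ℕ.nonTrivial⇒nonZero p {{prime⇒nonTrivial pr}}}} 1≤e))

power-+ : ∀ {q p e} n → Prime p → q ≡ p ℕ.^ e → (F : FiniteField (q ℕ.^ n)) → PowerAdditive F q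
power-+ {q} {p} {e} n pr q≡ F x y = ≡.subst (λ m → (x + y) ^ m ≈ x ^ m + y ^ m) (≡.sym q≡)
  (Frobenius.frobenius-+-^ ring pr (FiniteFields.char-p F (e ℕ.* n) (≡.trans (≡.cong (ℕ._^ n) q≡) (ℕ.^-*-assoc p e n))) e x y)
  where
  open FiniteField F
  open Powers ring

open import Data.Nat using (_*_; _^_)
open import Data.Nat.Divisibility using (_∣_)
open import Data.Fin using () renaming (_<_ to _<ᶠ_)

theorem2 : ∀ (q n : ℕ) → IsPrimePower q → 1 < n → ¬ IsPrimePower n →
    ∀ (k : ℕ) → 1 < k → k < δ n →
    ∀ (d : Fin k → ℕ) →
    (∀ i → d i ∣ n) →
    (∀ i j → i <ᶠ j → d i < d j) →
    (∀ i → d i < n) →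
    (∀ i j → ¬ (i ≡ j) → ¬ (d i ∣ d j)) →
    ∀ (F : FiniteField (q ^ n)) →
    let open Notions q n F in
    ∀ (a : Fin k → Carrier) →
    (∀ i → InSub (d i) (a i) × ¬ (a i ≈ 0#)) →
    (∀ i j → i <ᶠ j →
    Norm (d i) (gcd (d i) (d j)) (a i) ≈ Norm (d j) (gcd (d i) (d j)) (a j)) →
    ∀ (L : List Monic) → EnumeratesW L →
    (length L ^ 2) * q ^ n ≤ gcdFam k (λ i → (q ^ n ∸ 1) ÷ (q ^ d i ∸ 1)) ^ 2 →
    Σ Carrier λ α → ¬ (α ≈ 0#) × IsNormal α × (∀ i → Norm n (d i) α ≈ a i)
theorem2 q n (p , e , pr , 1≤e , q≡) 1<n _ (suc k) _ _ d d∣n _ _ _ F a a∈ norms L enumL large =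
  let (α , α≉0 , ind , nm) = Extension.solution q n q≥2 n≥1 F ^q-+ d d∣n a a∈ norms (Extension.commonRoot q n q≥2 n≥1 F ^q-+ d d∣n a a∈ norms) enumL
        (≡.subst₂ (λ s t → s * q ^ n ≤ t) (square (length L)) (square (gcdFam (suc k) (λ i → (q ^ n ∸ 1) ÷ (q ^ d i ∸ 1)))) large)
  in α , α≉0 , Extension.Independent⇒IsNormal q n q≥2 n≥1 F ^q-+ ind , nm
  where
  q≥2 : 2 ≤ q
  q≥2 = ≡.subst (2 ≤_) (≡.sym q≡) (primePower≥2 pr 1≤e)
  n≥1 : 1 ≤ n
  n≥1 = ℕ.<⇒≤ 1<n
  ^q-+ : PowerAdditive F q
  ^q-+ = power-+ {e = e} n pr q≡ F
  square : ∀ m → m ^ 2 ≡ m * m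
  square m = ≡.cong (m *_) (ℕ.*-identityʳ m)
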